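{- Let $k\ge3$, $c_1,\dots,c_k\in\mathbb{Z}\setminus\{0\}$, and let $\mathcal{L}$ be the equation $\sum_{i=1}^kc_ix_i=0$. Assume there exists $I\subseteq[k]$ with $|I|\ge3$ and $\sum_{i\in I}c_i=0$. Then for every $\varepsilon>0$ there exists $C=C(\varepsilon,\mathcal{L})$ such that for every prime $p$ and every $\mathcal{L}$-solution-free set $A\subseteq\mathbb{F}_p$ with $|A|\ge\varepsilon p$, one has $\chi(\mathsf{Cay}(\mathbb{F}_p,A))\le C$.
   Context: Coefficients are reduced modulo $p$. A set $A\subseteq\mathbb{F}_p$ is $\mathcal{L}$-solution-free if there is no $(x_1,\dots,x_k)\in A^k$ with pairwise distinct entries and $\sum_i c_ix_i=0$ in $\mathbb{F}_p$. $\mathsf{Cay}(\mathbb{F}_p,A)$ is the Cayley digraph with an arc from $u$ to $v$ whenever $v-u\in A$; $\chi$ is the chromatic number of its underlying undirected graph (distinct $u,v$ adjacent iff $v-u\in A$ or $u-v\in A$). -}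

module Defs where

open import Data.Nat using (ℕ; zero; suc)
open import Data.Integer using (ℤ; +_; _+_; _-_; _*_; 0ℤ)
open import Data.Integer.Divisibility using (_∣_)
open import Data.Fin using (Fin; toℕ)
open import Data.Fin.Subset using (Subset; _∈_)
open import Data.Vec using (lookup)
open import Data.Bool using (if_then_else_)
open import Data.Product using (∃; _×_)
open import Relation.Binary.PropositionalEquality using (_≡_)
open import Relation.Nullary using (¬_)
open import Function.Definitions using (Injective)

sumFin : ∀ {k} → (Fin k → ℤ) → ℤ
sumFin {zero} f = 0ℤ
sumFin {suc k} f = f Fin.zero + sumFin (λ i → f (Fin.suc i))
  where import Data.Fin as Fin

sumOver : ∀ {k} → Subset k → (Fin k → ℤ) → ℤ
sumOver I c = sumFin (λ i → if lookup I i then c i else 0ℤ)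

-- Elements of 𝔽_p are represented by Fin p (residues 0..p-1); an equation holds
-- in 𝔽_p iff p divides the corresponding integer expression.
ι : ∀ {p} → Fin p → ℤ
ι x = + toℕ x

SolutionFree : ∀ {k} (c : Fin k → ℤ) (p : ℕ) → Subset p → Set
SolutionFree {k} c p A =
  ¬ (∃ λ (x : Fin k → Fin p) →
       Injective _≡_ _≡_ x × (∀ i → x i ∈ A) × ((+ p) ∣ sumFin (λ i → c i * ι (x i))))

Arc : ∀ {p} → Subset p → Fin p → Fin p → Set
Arc {p} A u v = ∃ λ a → a ∈ A × ((+ p) ∣ (ι v - ι u - ι a))

open import Data.Sum using (_⊎_)
Adjacent : ∀ {p} → Subset p → Fin p → Fin p → Set
Adjacent A u v = ¬ (u ≡ v) × (Arc A u v ⊎ Arc A v u)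

ChromaticAtMost : ∀ {p} → Subset p → ℕ → Set
ChromaticAtMost {p} A C =
  ∃ λ (col : Fin p → Fin C) → ∀ u v → Adjacent A u v → ¬ (col u ≡ col v)

{-# OPTIONS --safe #-}
module Submission where

-- Let I be the zero-sum set of indices.  Dense sets A contain many solutions of
-- c₁x + c₂y + c₃z = 0 when c₁ + c₂ + c₃ = 0: in the tripartite graph whose triangles are the
-- solutions, the trivial ones x = y = z form an edge-disjoint family, so the triangle removal
-- lemma applies.  The number of solutions of c₁x + c₂y + c₃z = s barely changes when s moves by
-- an almost period of the underlying convolution, and by weak regularity the almost periods
-- contain all differences inside the classes of a bounded colouring κ of 𝔽_p.  A zero-sum
-- equation in more variables reduces to three by merging two coefficients with nonzero sum: the
-- popular elements z of A, with many x, y ∈ A such that c₁x + c₂y = (c₁ + c₂)z, are again dense.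
-- Now let A* consist of those y ∈ A for which each cⱼy, j ∉ I, is a difference inside a class of
-- κ.  If A* has at least k − ∣I∣ elements, the variables outside I can be taken from A* and the
-- equation completed by the variables in I, contradicting solution-freeness.  Otherwise Cay(A*)
-- has bounded degree, and a proper colouring of it together with the κ-colours of all cⱼu
-- colours Cay(A) properly.

open import Defs using (ι; SolutionFree; Arc; Adjacent; ChromaticAtMost; sumFin; sumOver)
open import Algebra.Bundles using (CommutativeRing)
import Algebra.Properties.Semiring.Sum as SemiringSum
open import Data.Bool using (Bool; true; false; not; if_then_else_; _∧_)
import Data.Bool.Properties as Bool
open import Data.Empty using (⊥; ⊥-elim)
open import Data.Fin using (Fin; zero; suc; combine; fromℕ<; inject≤; remQuot; toℕ)
open import Data.Fin.Permutation using (Permutation′; _⟨$⟩ʳ_; permutation)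
import Data.Fin.Properties as Fin
open import Data.Fin.Properties using (combine-injective; inject≤-injective; remQuot-combine)
open import Data.Fin.Subset using (Subset; ∣_∣; _∈_)
open import Data.Fin.Subset.Properties using (anySubset?; drop-there)
open import Data.Integer using (ℤ; +_; 0ℤ)
import Data.Integer as ℤ
open import Data.Integer.Divisibility.Signed using (∣ᵤ⇒∣; ∣⇒∣ᵤ; ∣m∣n⇒∣m+n; ∣n⇒∣m*n; divides)
import Data.Integer.Divisibility.Signed as Signed
import Data.Integer.DivMod as ℤ
import Data.Integer.Properties as ℤ
import Data.Integer.Tactic.RingSolver as ℤSolver
open import Data.List using (List; []; _∷_; _++_; allFin; foldr; length)
import Data.List as List
open import Data.List.Membership.Propositional using () renaming (_∈_ to _∈ₗ_; _∉_ to _∉ₗ_)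
open import Data.List.Membership.Propositional.Properties using (∈-allFin; ∈-map⁺; ∈-map⁻; ∈-++⁺ˡ; ∈-++⁺ʳ; ∈-++⁻)
import Data.List.Properties as List
open import Data.List.Relation.Binary.Permutation.Propositional using (_↭_; prep; swap; ↭-refl; ↭-trans)
import Data.List.Relation.Binary.Permutation.Propositional as Perm
open import Data.List.Relation.Binary.Permutation.Propositional.Properties using (++-comm; shift)
open import Data.List.Relation.Unary.All using (All; []; _∷_)
import Data.List.Relation.Unary.All as All
open import Data.List.Relation.Unary.All.Properties using (¬Any⇒All¬)
import Data.List.Relation.Unary.All.Properties as All
open import Data.List.Relation.Unary.AllPairs using (AllPairs; []; _∷_)
open import Data.List.Relation.Unary.Any using (Any; here; there)
import Data.List.Relation.Unary.Any as Any
open import Data.List.Relation.Unary.Any.Properties using (lookup-index)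
open import Data.Nat using (ℕ; zero; suc; _≥_)
import Data.Nat as ℕ
open import Data.Nat.Coprimality using (prime⇒coprime; coprime-Bézout)
import Data.Nat.Divisibility as ℕ
open import Data.Nat.GCD using (module Bézout)
open import Data.Nat.Primality using (Prime; prime⇒nonZero)
import Data.Nat.Properties as ℕ
open import Data.Product using (∃; ∃₂; Σ; _×_; _,_; proj₁; proj₂)
open import Data.Rational hiding (∣_∣; _÷_; _≥_)
import Data.Rational as ℚ
open import Data.Rational.Properties
import Data.Rational.Unnormalised as ℚᵘ
import Data.Rational.Unnormalised.Properties as ℚᵘ
open import Data.Sum using (_⊎_; inj₁; inj₂)
open import Data.Vec using ([]; _∷_; lookup; tabulate)
open import Data.Vec.Properties using (lookup∘tabulate; []=⇒lookup; lookup⇒[]=)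
open import Function.Definitions using (Injective)
open import Relation.Binary.PropositionalEquality hiding (J)
open import Relation.Nullary using (¬_; Dec; yes; no; does; contradiction)
open import Relation.Nullary.Decidable using (dec-true; dec-false; dec⇒maybe; map′; _×-dec_)
import Tactic.RingSolver as RingSolver
import Tactic.RingSolver.Core.AlmostCommutativeRing as ACR

-- Rational inequalities and finite sums

-- Why three zero-sum variables: two of them form the convolution `Q`, whose translates can be
-- compared in L¹, and the third is only tested against it. So the solution count `T₃` survives a
-- change of the right-hand side, which can then absorb the variables outside I. A Bohr set would
-- serve here, but its characters need complex numbers; all that is wanted of it is a bounded number
-- of classes whose differences move `Q` little. Uniformity shapes the rest: the number of colours
-- must not depend on p or A. Hence every energy iteration runs on fuel fixed beforehand, and a
-- partition that becomes regular early is padded to the prescribed number of cells. The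
-- approximants are arbitrary step functions with values in [0,1], carried along with the partition,
-- not cell averages: no division by a cell size occurs, but Pythagoras is lost, so removal compares
-- two approximants through their midpoint. Distinctness is enforced by lists of forbidden values,
-- which cost O(p²) out of a count of order p³; small p are given p colours.

ℚ-ring : ACR.AlmostCommutativeRing _ _
ℚ-ring = ACR.fromCommutativeRing +-*-commutativeRing (λ x → dec⇒maybe (0ℚ ≟ x))

0≤a+b : ∀ {a b} → 0ℚ ≤ a → 0ℚ ≤ b → 0ℚ ≤ a + b
0≤a+b = +-mono-≤

0≤a*b : ∀ {a b} → 0ℚ ≤ a → 0ℚ ≤ b → 0ℚ ≤ a * b
0≤a*b {a} {b} p q = nonNegative⁻¹ _ ⦃ nonNeg*nonNeg⇒nonNeg a ⦃ nonNegative p ⦄ b ⦃ nonNegative q ⦄ ⦄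

0<a*b : ∀ {a b} → 0ℚ < a → 0ℚ < b → 0ℚ < a * b
0<a*b {a} {b} p q = positive⁻¹ _ ⦃ pos*pos⇒pos a ⦃ positive p ⦄ b ⦃ positive q ⦄ ⦄

*-monoˡ : ∀ {a b c} → 0ℚ ≤ c → a ≤ b → c * a ≤ c * b
*-monoˡ {c = c} p = *-monoˡ-≤-nonNeg c ⦃ nonNegative p ⦄

*-monoʳ : ∀ {a b c} → 0ℚ ≤ c → a ≤ b → a * c ≤ b * c
*-monoʳ {c = c} p = *-monoʳ-≤-nonNeg c ⦃ nonNegative p ⦄

*-mono : ∀ {a b c d} → 0ℚ ≤ a → 0ℚ ≤ d → a ≤ b → c ≤ d → a * c ≤ b * d
*-mono p q r s = ≤-trans (*-monoˡ p s) (*-monoʳ q r)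

diff-nonNeg : ∀ {a b} → a ≤ b → 0ℚ ≤ b - a
diff-nonNeg {a} {b} p = subst (_≤ b - a) (+-inverseʳ a) (+-monoˡ-≤ (- a) p)

≤-by-diff : ∀ {a b d} → 0ℚ ≤ d → b - a ≡ d → a ≤ b
≤-by-diff {a} {b} p q = subst₂ _≤_ (+-identityˡ a) (lemma a b) (+-monoˡ-≤ a (subst (0ℚ ≤_) (sym q) p))
  where
  lemma : ∀ a b → b - a + a ≡ b
  lemma = RingSolver.solve-∀ ℚ-ring

0≤a² : ∀ a → 0ℚ ≤ a * a
0≤a² a with ≤-total 0ℚ a
... | inj₁ p = 0≤a*b p p
... | inj₂ p = subst (0ℚ ≤_) (lemma a) (0≤a*b q q)
  where
  q : 0ℚ ≤ - a
  q = neg-antimono-≤ p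
  lemma : ∀ a → (- a) * (- a) ≡ a * a
  lemma = RingSolver.solve-∀ ℚ-ring

ℕ⇒ℚ : ℕ → ℚ
ℕ⇒ℚ n = + n / 1

ℕ⇒ℚ-+ : ∀ m n → ℕ⇒ℚ (m ℕ.+ n) ≡ ℕ⇒ℚ m + ℕ⇒ℚ n
ℕ⇒ℚ-+ m n = toℚᵘ-injective (begin-equality
  toℚᵘ (ℕ⇒ℚ (m ℕ.+ n))                    ≃⟨ toℚᵘ-fromℚᵘ (ℚᵘ.mkℚᵘ (+ (m ℕ.+ n)) 0) ⟩
  ℚᵘ.mkℚᵘ (+ (m ℕ.+ n)) 0                 ≃⟨ ℚᵘ.*≡* (cong₂ ℤ._*_ eq refl) ⟩
  ℚᵘ.mkℚᵘ (+ m) 0 ℚᵘ.+ ℚᵘ.mkℚᵘ (+ n) 0    ≃⟨ ℚᵘ.+-cong (toℚᵘ-fromℚᵘ (ℚᵘ.mkℚᵘ (+ m) 0))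
      (toℚᵘ-fromℚᵘ (ℚᵘ.mkℚᵘ (+ n) 0)) ⟨
  toℚᵘ (ℕ⇒ℚ m) ℚᵘ.+ toℚᵘ (ℕ⇒ℚ n)          ≃⟨ toℚᵘ-homo-+ (ℕ⇒ℚ m) (ℕ⇒ℚ n) ⟨
  toℚᵘ (ℕ⇒ℚ m + ℕ⇒ℚ n)                    ∎)
  where
  open ℚᵘ.≤-Reasoning
  eq : + (m ℕ.+ n) ≡ + m ℤ.* + 1 ℤ.+ + n ℤ.* + 1
  eq = sym (cong₂ ℤ._+_ (ℤ.*-identityʳ (+ m)) (ℤ.*-identityʳ (+ n)))

0≤ℕ⇒ℚ : ∀ n → 0ℚ ≤ ℕ⇒ℚ n
0≤ℕ⇒ℚ n = nonNegative⁻¹ _ ⦃ normalize-nonNeg n 1 ⦄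

ℕ⇒ℚ-mono : ∀ {m n} → m ℕ.≤ n → ℕ⇒ℚ m ≤ ℕ⇒ℚ n
ℕ⇒ℚ-mono {m} {n} m≤n = subst₂ _≤_ (+-identityʳ (ℕ⇒ℚ m)) eq (+-monoʳ-≤ (ℕ⇒ℚ m) (0≤ℕ⇒ℚ (n ℕ.∸ m)))
  where
  eq : ℕ⇒ℚ m + ℕ⇒ℚ (n ℕ.∸ m) ≡ ℕ⇒ℚ n
  eq = trans (sym (ℕ⇒ℚ-+ m (n ℕ.∸ m))) (cong ℕ⇒ℚ (ℕ.m+[n∸m]≡n m≤n))

ℕ⇒ℚ-suc : ∀ n → ℕ⇒ℚ (suc n) ≡ 1ℚ + ℕ⇒ℚ n
ℕ⇒ℚ-suc n = ℕ⇒ℚ-+ 1 n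

0<ℕ⇒ℚ : ∀ n → .⦃ ℕ.NonZero n ⦄ → 0ℚ < ℕ⇒ℚ n
0<ℕ⇒ℚ n = positive⁻¹ _ ⦃ normalize-pos n 1 ⦄

ℕ⇒ℚ-cancel-< : ∀ {m n} → ℕ⇒ℚ m < ℕ⇒ℚ n → m ℕ.< n
ℕ⇒ℚ-cancel-< {m} {n} p with m ℕ.<? n
... | yes q = q
... | no q  = contradiction (<-≤-trans p (ℕ⇒ℚ-mono (ℕ.≮⇒≥ q))) (<-irrefl refl)

ℕ⇒ℚ-cancel-≤ : ∀ {m n} → ℕ⇒ℚ m ≤ ℕ⇒ℚ n → m ℕ.≤ n
ℕ⇒ℚ-cancel-≤ {m} {n} p = ℕ.s≤s⁻¹ (ℕ⇒ℚ-cancel-< (≤-<-trans p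
  (subst₂ _<_ (+-identityˡ _) (sym (ℕ⇒ℚ-suc n)) (+-monoˡ-< (ℕ⇒ℚ n) (0<ℕ⇒ℚ 1)))))

archimedean : ∀ a → ∃ λ n → a ≤ ℕ⇒ℚ n
archimedean a@(mkℚ n d _) = ℤ.∣ n ∣ , toℚᵘ-cancel-≤ (ℚᵘ.≤-trans bound
    (ℚᵘ.≤-reflexive (ℚᵘ.≃-sym (toℚᵘ-fromℚᵘ (ℚᵘ.mkℚᵘ (+ ℤ.∣ n ∣) 0)))))
  where
  bound : ℚᵘ.mkℚᵘ n d ℚᵘ.≤ ℚᵘ.mkℚᵘ (+ ℤ.∣ n ∣) 0
  bound = ℚᵘ.*≤* (ℤ.≤-trans (ℤ.≤-reflexive (ℤ.*-identityʳ n))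
    (ℤ.≤-trans (i≤∣i∣ n) (subst (+ ℤ.∣ n ∣ ℤ.≤_) (ℤ.pos-* ℤ.∣ n ∣ (suc d))
        (ℤ.+≤+ (ℕ.m≤m*n ℤ.∣ n ∣ (suc d))))))
    where
    i≤∣i∣ : ∀ i → i ℤ.≤ + ℤ.∣ i ∣
    i≤∣i∣ (+ _)      = ℤ.≤-refl
    i≤∣i∣ ℤ.-[1+ _ ] = ℤ.-≤+

-- Source of every iteration fuel, of the lower bound on p and of the removal parameter.
archimedean′ : ∀ a {b} → 0ℚ < b → ∃ λ n → a ≤ ℕ⇒ℚ n * b
archimedean′ a {b} 0<b = n , subst₂ _≤_ (cancel a b) refl (*-monoʳ (<⇒≤ 0<b) bound)
  where
  instance
    b≢0 = >-nonZero 0<b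
  n = proj₁ (archimedean (a * 1/ b))
  bound = proj₂ (archimedean (a * 1/ b))
  cancel : ∀ a b .⦃ _ : NonZero b ⦄ → a * 1/ b * b ≡ a
  cancel a b = trans (*-assoc a (1/ b) b) (trans (cong (a *_) (*-inverseˡ b)) (*-identityʳ a))

eq-≤ : ∀ {a b c} → a ≡ b → b ≤ c → a ≤ c
eq-≤ refl p = p

≤-eq : ∀ {a b c} → a ≤ b → b ≡ c → a ≤ c
≤-eq p refl = p

<-eq : ∀ {a b c} → a < b → b ≡ c → a < c
<-eq p refl = p

0≤1 : 0ℚ ≤ 1ℚ
0≤1 = 0≤ℕ⇒ℚ 1

𝟙 : Bool → ℚ
𝟙 true  = 1ℚ
𝟙 false = 0ℚ

0≤𝟙 : ∀ b → 0ℚ ≤ 𝟙 b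
0≤𝟙 true  = 0≤1
0≤𝟙 false = ≤-refl

𝟙≤1 : ∀ b → 𝟙 b ≤ 1ℚ
𝟙≤1 true  = ≤-refl
𝟙≤1 false = 0≤1

0<𝟙⇒true : ∀ {b} → 0ℚ < 𝟙 b → b ≡ true
0<𝟙⇒true {true}  p = refl
0<𝟙⇒true {false} p = contradiction p (<-irrefl refl)

_==_ : ∀ {n} → Fin n → Fin n → Bool
i == j = does (i Fin.≟ j)

==-refl : ∀ {n} (i : Fin n) → (i == i) ≡ true
==-refl i = dec-true (i Fin.≟ i) refl

private
  module Sum = SemiringSum (CommutativeRing.semiring +-*-commutativeRing)

opaque
  ∑ : ∀ {n} → (Fin n → ℚ) → ℚ
  ∑ f = Sum.sum f

  ∑-cong : ∀ {n} {f g : Fin n → ℚ} → (∀ i → f i ≡ g i) → ∑ f ≡ ∑ g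
  ∑-cong = Sum.sum-cong-≗

  ∑-zero : ∀ n → ∑ {n} (λ _ → 0ℚ) ≡ 0ℚ
  ∑-zero = Sum.sum-replicate-zero

  ∑-distrib-+ : ∀ {n} (f g : Fin n → ℚ) → ∑ (λ i → f i + g i) ≡ ∑ f + ∑ g
  ∑-distrib-+ = Sum.∑-distrib-+

  ∑-comm : ∀ {m n} (f : Fin m → Fin n → ℚ) → ∑ (λ i → ∑ (f i)) ≡ ∑ (λ j → ∑ (λ i → f i j))
  ∑-comm = Sum.∑-comm

  ∑-permute : ∀ {n} (f : Fin n → ℚ) (π : Permutation′ n) → ∑ f ≡ ∑ (λ i → f (π ⟨$⟩ʳ i))
  ∑-permute = Sum.∑-permute

  *-distribˡ-∑ : ∀ {n} c (f : Fin n → ℚ) → c * ∑ f ≡ ∑ (λ i → c * f i)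
  *-distribˡ-∑ = Sum.*-distribˡ-sum

  *-distribʳ-∑ : ∀ {n} c (f : Fin n → ℚ) → ∑ f * c ≡ ∑ (λ i → f i * c)
  *-distribʳ-∑ = Sum.*-distribʳ-sum

  ∑-empty : ∀ (f : Fin 0 → ℚ) → ∑ f ≡ 0ℚ
  ∑-empty f = refl

  ∑-suc : ∀ {n} (f : Fin (suc n) → ℚ) → ∑ f ≡ f zero + ∑ (λ i → f (suc i))
  ∑-suc f = refl

∑-mono : ∀ {n} {f g : Fin n → ℚ} → (∀ i → f i ≤ g i) → ∑ f ≤ ∑ g
∑-mono {zero}  {f} {g} p = eq-≤ (∑-empty f) (≤-reflexive (sym (∑-empty g)))
∑-mono {suc n} {f} {g} p = eq-≤ (∑-suc f) (≤-eq (+-mono-≤ (p zero) (∑-mono (λ i → p (suc i))))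
    (sym (∑-suc g)))

∑-const : ∀ n c → ∑ {n} (λ _ → c) ≡ ℕ⇒ℚ n * c
∑-const zero    c = trans (∑-empty (λ _ → c)) (sym (*-zeroˡ c))
∑-const (suc n) c = trans (∑-suc (λ _ → c)) (trans (cong (_+_ c) (∑-const n c))
  (trans (lemma c (ℕ⇒ℚ n)) (cong (_* c) (sym (ℕ⇒ℚ-suc n)))))
  where
  lemma : ∀ c m → c + m * c ≡ (1ℚ + m) * c
  lemma = RingSolver.solve-∀ ℚ-ring

∑-nonNeg : ∀ {n} {f : Fin n → ℚ} → (∀ i → 0ℚ ≤ f i) → 0ℚ ≤ ∑ f
∑-nonNeg {n} p = eq-≤ (sym (∑-zero n)) (∑-mono p)

∑-≤-const : ∀ {n c} {f : Fin n → ℚ} → (∀ i → f i ≤ c) → ∑ f ≤ ℕ⇒ℚ n * c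
∑-≤-const {n} {c} p = ≤-eq (∑-mono p) (∑-const n c)

∑-neg : ∀ {n} (f : Fin n → ℚ) → ∑ (λ i → - f i) ≡ - ∑ f
∑-neg f = trans (∑-cong (λ i → lemma (f i))) (trans (sym (*-distribˡ-∑ (- 1ℚ) f)) (sym (lemma (∑ f))))
  where
  lemma : ∀ a → - a ≡ (- 1ℚ) * a
  lemma = RingSolver.solve-∀ ℚ-ring

∑-distrib-- : ∀ {n} (f g : Fin n → ℚ) → ∑ (λ i → f i - g i) ≡ ∑ f - ∑ g
∑-distrib-- f g = trans (∑-distrib-+ f (λ i → - g i)) (cong (_+_ (∑ f)) (∑-neg g))

∑-delta : ∀ {n} (i : Fin n) (f : Fin n → ℚ) → ∑ (λ j → 𝟙 (i == j) * f j) ≡ f i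
∑-delta {suc n} zero    f = trans (∑-suc _) (trans (cong₂ _+_ (*-identityˡ (f zero))
  (trans (∑-cong (λ j → *-zeroˡ (f (suc j)))) (∑-zero n))) (+-identityʳ (f zero)))
∑-delta {suc n} (suc i) f = trans (∑-suc _) (trans (cong₂ _+_ (*-zeroˡ (f zero))
    (∑-delta i (λ j → f (suc j)))) (+-identityˡ _))

-- Serves the energy iterations: several edge functions share one partition, and a strict
-- improvement of one of them must lower their total.
∑-mono-gain : ∀ {n} {f g : Fin n → ℚ} {β} → (∀ j → f j ≤ g j) → ∀ i → f i + β ≤ g i → ∑ f + β ≤ ∑ g
∑-mono-gain {suc n} {f} {g} {β} p zero q = eq-≤ (trans (cong (_+ β) (∑-suc f))
    (lemma (f zero) (∑ (λ i → f (suc i))) β))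
  (≤-eq (+-mono-≤ q (∑-mono (λ i → p (suc i)))) (sym (∑-suc g)))
  where
  lemma : ∀ a b c → a + b + c ≡ a + c + b
  lemma = RingSolver.solve-∀ ℚ-ring
∑-mono-gain {suc n} {f} {g} {β} p (suc i) q =
    eq-≤ (trans (cong (_+ β) (∑-suc f)) (+-assoc (f zero) (∑ (λ i → f (suc i))) β))
  (≤-eq (+-mono-≤ (p zero) (∑-mono-gain (λ i → p (suc i)) i q)) (sym (∑-suc g)))

0<∑⇒∃ : ∀ {n} (f : Fin n → ℚ) → 0ℚ < ∑ f → ∃ λ i → 0ℚ < f i
0<∑⇒∃ {zero}  f p = contradiction (<-eq p (∑-empty f)) (<-irrefl refl)
0<∑⇒∃ {suc n} f p with 0ℚ <? f zero
... | yes q = zero , q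
... | no q with 0<∑⇒∃ (λ i → f (suc i))
                 (<-≤-trans (<-eq p (∑-suc f)) (≤-eq (+-monoˡ-≤ (∑ (λ i → f (suc i))) (≮⇒≥ q))
                     (+-identityˡ _)))
...   | i , r = suc i , r

0<diff : ∀ {a b} → a < b → 0ℚ < b - a
0<diff {a} {b} p = subst (λ z → z < b - a) (+-inverseʳ a) (+-monoˡ-< (- a) p)

<-by-diff : ∀ {a b} → 0ℚ < b - a → a < b
<-by-diff {a} {b} q = subst₂ _<_ (+-identityˡ a) (lemma b a) (+-monoˡ-< a q)
  where
  lemma : ∀ a b → a - b + b ≡ a
  lemma = RingSolver.solve-∀ ℚ-ring

-- The averaging argument behind most existence claims below: `f` weighs the obstructions, `g` the
-- objects sought.
∑-<⇒∃ : ∀ {n} (f g : Fin n → ℚ) → ∑ f < ∑ g → ∃ λ i → f i < g i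
∑-<⇒∃ f g p = proj₁ found , <-by-diff (proj₂ found)
  where
  found = 0<∑⇒∃ (λ i → g i - f i) (<-eq (0<diff p) (sym (∑-distrib-- g f)))

size : ∀ {n m} → (Fin n → Fin m) → Fin m → ℚ
size π a = ∑ λ x → 𝟙 (π x == a)

∑-fibres : ∀ {n m} (π : Fin n → Fin m) (f : Fin m → Fin n → ℚ) →
           ∑ (λ x → f (π x) x) ≡ ∑ λ a → ∑ λ x → 𝟙 (π x == a) * f a x
∑-fibres π f = trans (∑-cong (λ x → sym (∑-delta (π x) (λ a → f a x))))
    (∑-comm (λ x a → 𝟙 (π x == a) * f a x))

∑-by-cells : ∀ {n m} (π : Fin n → Fin m) (f : Fin m → ℚ) → ∑ (λ x → f (π x)) ≡ ∑ λ a → size π a * f a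
∑-by-cells π f = trans (∑-fibres π (λ a _ → f a)) (∑-cong (λ a →
    sym (*-distribʳ-∑ (f a) (λ x → 𝟙 (π x == a)))))

∑∑ : ∀ {m n} → (Fin m → Fin n → ℚ) → ℚ
∑∑ h = ∑ λ x → ∑ λ y → h x y

∑∑-cong : ∀ {m n} {f g : Fin m → Fin n → ℚ} → (∀ x y → f x y ≡ g x y) → ∑∑ f ≡ ∑∑ g
∑∑-cong p = ∑-cong (λ x → ∑-cong (p x))

∑∑-mono : ∀ {m n} {f g : Fin m → Fin n → ℚ} → (∀ x y → f x y ≤ g x y) → ∑∑ f ≤ ∑∑ g
∑∑-mono p = ∑-mono (λ x → ∑-mono (p x))

∑∑-distrib-+ : ∀ {m n} (f g : Fin m → Fin n → ℚ) → ∑∑ (λ x y → f x y + g x y) ≡ ∑∑ f + ∑∑ g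
∑∑-distrib-+ f g = trans (∑-cong (λ x → ∑-distrib-+ (f x) (g x))) (∑-distrib-+ _ _)

∑∑-distrib-- : ∀ {m n} (f g : Fin m → Fin n → ℚ) → ∑∑ (λ x y → f x y - g x y) ≡ ∑∑ f - ∑∑ g
∑∑-distrib-- f g = trans (∑-cong (λ x → ∑-distrib-- (f x) (g x))) (∑-distrib-- _ _)

*-distribˡ-∑∑ : ∀ {m n} c (f : Fin m → Fin n → ℚ) → c * ∑∑ f ≡ ∑∑ (λ x y → c * f x y)
*-distribˡ-∑∑ c f = trans (*-distribˡ-∑ c _) (∑-cong (λ x → *-distribˡ-∑ c (f x)))

∑∑-const : ∀ m n c → ∑∑ {m} {n} (λ _ _ → c) ≡ ℕ⇒ℚ m * ℕ⇒ℚ n * c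
∑∑-const m n c = trans (∑-cong (λ _ → ∑-const n c)) (trans (∑-const m _) (sym (*-assoc (ℕ⇒ℚ m) (ℕ⇒ℚ n) c)))

∑∑-nonNeg : ∀ {m n} {f : Fin m → Fin n → ℚ} → (∀ x y → 0ℚ ≤ f x y) → 0ℚ ≤ ∑∑ f
∑∑-nonNeg p = ∑-nonNeg (λ x → ∑-nonNeg (p x))

Unit : ℚ → Set
Unit a = 0ℚ ≤ a × a ≤ 1ℚ

Unit-𝟙 : ∀ b → Unit (𝟙 b)
Unit-𝟙 b = 0≤𝟙 b , 𝟙≤1 b

Unit-* : ∀ {a b} → Unit a → Unit b → Unit (a * b)
Unit-* (p , q) (r , s) = 0≤a*b p r , *-mono p 0≤1 q s

-- Cut norm

-- The cut norm, unnormalised and one-sided; the other sign is the same notion for `- h`, and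
-- `Uniform` combines the two.
CutBounded : ∀ {n} → (Fin n → Fin n → ℚ) → ℚ → Set
CutBounded {n} h β = ∀ (S T : Fin n → Bool) → ∑∑ (λ x y → h x y * (𝟙 (S x) * 𝟙 (T y))) ≤ β

∑-≤-positive-part : ∀ {n} (f φ : Fin n → ℚ) → (∀ x → Unit (φ x)) →
                    ∑ (λ x → φ x * f x) ≤ ∑ (λ x → 𝟙 (does (0ℚ <? f x)) * f x)
∑-≤-positive-part f φ unit = ∑-mono (λ x → pointwise (0ℚ <? f x) (unit x))
  where
  pointwise : ∀ {a b} (d : Dec (0ℚ < a)) → Unit b → b * a ≤ 𝟙 (does d) * a
  pointwise         (yes p) (0≤b , b≤1) = *-monoʳ (<⇒≤ p) b≤1
  pointwise {a} {b} (no p)  (0≤b , b≤1) = ≤-eq (*-monoˡ 0≤b (≮⇒≥ p)) (trans (*-zeroʳ b) (sym (*-zeroˡ a)))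

-- A bilinear form on [0,1]-valued weights is maximised at 0/1-valued ones.
cut-weights : ∀ {n} (h : Fin n → Fin n → ℚ) {β} → CutBounded h β →
              ∀ (φ ψ : Fin n → ℚ) → (∀ x → Unit (φ x)) → (∀ y → Unit (ψ y)) →
              ∑∑ (λ x y → h x y * (φ x * ψ y)) ≤ β
cut-weights {n} h {β} cut φ ψ uφ uψ = begin
  ∑∑ (λ x y → h x y * (φ x * ψ y))                   ≡⟨ by-rows φ ψ ⟩
  ∑ (λ x → φ x * ∑ (λ y → h x y * ψ y))              ≤⟨ ∑-≤-positive-part _ φ uφ ⟩
  ∑ (λ x → 𝟙 (S x) * ∑ (λ y → h x y * ψ y))          ≡⟨ by-rows (λ x → 𝟙 (S x)) ψ ⟨
  ∑∑ (λ x y → h x y * (𝟙 (S x) * ψ y))               ≡⟨ by-columns (λ x → 𝟙 (S x)) ψ ⟩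
  ∑ (λ y → ψ y * ∑ (λ x → h x y * 𝟙 (S x)))          ≤⟨ ∑-≤-positive-part _ ψ uψ ⟩
  ∑ (λ y → 𝟙 (T′ y) * ∑ (λ x → h x y * 𝟙 (S x)))     ≡⟨ by-columns (λ x → 𝟙 (S x)) (λ y → 𝟙 (T′ y)) ⟨
  ∑∑ (λ x y → h x y * (𝟙 (S x) * 𝟙 (T′ y)))          ≤⟨ cut S T′ ⟩
  β                                                  ∎
  where
  open ≤-Reasoning
  S T′ : Fin n → Bool
  S x  = does (0ℚ <? ∑ (λ y → h x y * ψ y))
  T′ y = does (0ℚ <? ∑ (λ x → h x y * 𝟙 (S x)))
  lemma : ∀ a b c → a * (b * c) ≡ b * (a * c)
  lemma = RingSolver.solve-∀ ℚ-ring
  lemma′ : ∀ a b c → a * (b * c) ≡ c * (a * b)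
  lemma′ = RingSolver.solve-∀ ℚ-ring
  by-rows : ∀ (φ ψ : Fin n → ℚ) → ∑∑ (λ x y → h x y * (φ x * ψ y)) ≡ ∑ (λ x → φ x * ∑ (λ y → h x y * ψ y))
  by-rows φ ψ = ∑-cong (λ x → trans (∑-cong (λ y → lemma (h x y) (φ x) (ψ y))) (sym (*-distribˡ-∑ (φ x) _)))
  by-columns : ∀ (φ ψ : Fin n → ℚ) → ∑∑ (λ x y → h x y * (φ x * ψ y)) ≡ ∑ (λ y → ψ y * ∑ (λ x → h x y * φ x))
  by-columns φ ψ = trans (∑-comm _)
    (∑-cong (λ y → trans (∑-cong (λ x → lemma′ (h x y) (φ x) (ψ y))) (sym (*-distribˡ-∑ (ψ y) _))))

-- Decided by search through all pairs of subsets, so that a failure delivers the sets by which the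
-- partition is refined next.
cut? : ∀ {n} (h : Fin n → Fin n → ℚ) β → CutBounded h β ⊎
       ∃₂ λ (S T : Fin n → Bool) → β < ∑∑ (λ x y → h x y * (𝟙 (S x) * 𝟙 (T y)))
cut? {n} h β with anySubset? (λ S → anySubset? (λ T →
    β <? ∑∑ (λ x y → h x y * (𝟙 (lookup S x) * 𝟙 (lookup T y)))))
... | yes (S , T , p) = inj₂ (lookup S , lookup T , p)
... | no ¬p = inj₁ λ S T → ≮⇒≥ λ p → ¬p (tabulate S , tabulate T , <-eq p (∑∑-cong λ x y →
        cong₂ (λ a b → h x y * (𝟙 a * 𝟙 b)) (sym (lookup∘tabulate S x)) (sym (lookup∘tabulate T y))))

clamp : ℚ → ℚ
clamp a = 0ℚ ⊔ (1ℚ ⊓ a)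

clamp-Unit : ∀ a → Unit (clamp a)
clamp-Unit a = p≤p⊔q 0ℚ (1ℚ ⊓ a) , ⊔-lub 0≤1 (p⊓q≤p 1ℚ a)

-- Clamping is the nearest-point projection onto [0,1], and `f` lies there. So a corrected
-- approximant can be cut back to [0,1], as the counting of triangles demands, at no cost in energy.
clamp-contracts : ∀ {f} a → Unit f → (f - clamp a) * (f - clamp a) ≤ (f - a) * (f - a)
clamp-contracts {f} a (0≤f , f≤1) with ≤-total 0ℚ a | ≤-total 1ℚ a
... | inj₁ 0≤a | inj₂ a≤1 = ≤-reflexive (cong (λ z → (f - z) * (f - z))
    (trans (cong (0ℚ ⊔_) (p≥q⇒p⊓q≡q a≤1)) (p≤q⇒p⊔q≡q 0≤a)))
... | inj₂ a≤0 | inj₂ a≤1 = eq-≤ (cong (λ z → (f - z) * (f - z))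
    (trans (cong (0ℚ ⊔_) (p≥q⇒p⊓q≡q a≤1)) (p≥q⇒p⊔q≡p a≤0)))
    (≤-by-diff (0≤a+b (0≤a*b 0≤f (0≤a+b -a -a)) (0≤a² a)) (lemma f a))
  where
  -a : 0ℚ ≤ - a
  -a = neg-antimono-≤ a≤0
  lemma : ∀ f a → (f - a) * (f - a) - (f - 0ℚ) * (f - 0ℚ) ≡ f * (- a + - a) + a * a
  lemma = RingSolver.solve-∀ ℚ-ring
... | _ | inj₁ 1≤a = eq-≤ (cong (λ z → (f - z) * (f - z)) (trans (cong (0ℚ ⊔_) (p≤q⇒p⊓q≡p 1≤a))
    (p≤q⇒p⊔q≡q 0≤1)))
    (≤-by-diff (0≤a+b (0≤a*b (diff-nonNeg 1≤a) (0≤a+b (diff-nonNeg f≤1) (diff-nonNeg f≤1))) (0≤a² (a - 1ℚ)))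
        (lemma f a))
  where
  lemma : ∀ f a → (f - a) * (f - a) - (f - 1ℚ) * (f - 1ℚ) ≡
      (a - 1ℚ) * ((1ℚ - f) + (1ℚ - f)) + (a - 1ℚ) * (a - 1ℚ)
  lemma = RingSolver.solve-∀ ℚ-ring

energy : ∀ {n} → (F g : Fin n → Fin n → ℚ) → ℚ
energy F g = ∑∑ λ x y → (F x y - g x y) * (F x y - g x y)

0≤energy : ∀ {n} (F g : Fin n → Fin n → ℚ) → 0ℚ ≤ energy F g
0≤energy F g = ∑∑-nonNeg (λ x y → 0≤a² (F x y - g x y))

-- Clamping aside, adding `s` times a rectangle changes the energy by `-2sX + s²|S||T|`, where X is
-- the sum of `F - g` over the rectangle; the hypotheses make this at most `-2β + β`.
energy-decrement : ∀ {n} (F g : Fin n → Fin n → ℚ) → (∀ x y → Unit (F x y)) → ∀ (S T : Fin n → Bool) s β →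
  β ≤ s * ∑∑ (λ x y → (F x y - g x y) * (𝟙 (S x) * 𝟙 (T y))) → ℕ⇒ℚ n * ℕ⇒ℚ n * (s * s) ≤ β →
  energy F (λ x y → clamp (g x y + s * (𝟙 (S x) * 𝟙 (T y)))) + β ≤ energy F g
energy-decrement {n} F g uF S T s β β≤sX s²≤β = begin
  energy F (λ x y → clamp (g x y + s * b x y)) + β
    ≤⟨ +-monoˡ-≤ β (∑∑-mono (λ x y → ≤-trans (clamp-contracts _ (uF x y))
        (expand (F x y) (g x y) (b x y) (Unit-* (Unit-𝟙 (S x)) (Unit-𝟙 (T y)))))) ⟩
  ∑∑ (λ x y → (F x y - g x y) * (F x y - g x y) - (s + s) * ((F x y - g x y) * b x y) + s * s) + β
    ≡⟨ cong (_+ β) (trans (∑∑-distrib-+ _ _) (cong₂ _+_ (trans (∑∑-distrib-- _ _)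
        (cong (λ z → energy F g - z) (sym (*-distribˡ-∑∑ (s + s) _)))) (∑∑-const n n (s * s)))) ⟩
  energy F g - (s + s) * X + ℕ⇒ℚ n * ℕ⇒ℚ n * (s * s) + β
    ≤⟨ ≤-by-diff (0≤a+b (0≤a+b (diff-nonNeg β≤sX) (diff-nonNeg β≤sX)) (diff-nonNeg s²≤β))
        (collect (energy F g) s X (ℕ⇒ℚ n * ℕ⇒ℚ n * (s * s)) β) ⟩
  energy F g ∎
  where
  open ≤-Reasoning
  b : Fin n → Fin n → ℚ
  b x y = 𝟙 (S x) * 𝟙 (T y)
  X = ∑∑ (λ x y → (F x y - g x y) * b x y)
  collect : ∀ e s X m β → e - (e - (s + s) * X + m + β) ≡ (s * X - β) + (s * X - β) + (β - m)
  collect = RingSolver.solve-∀ ℚ-ring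
  expand : ∀ f g b → Unit b → (f - (g + s * b)) * (f - (g + s * b)) ≤
      (f - g) * (f - g) - (s + s) * ((f - g) * b) + s * s
  expand f g b (0≤b , b≤1) = ≤-by-diff (0≤a*b (0≤a² s) (diff-nonNeg
      (≤-eq (*-mono 0≤b 0≤1 b≤1 b≤1) (*-identityˡ 1ℚ)))) (lemma f g b s)
    where
    lemma : ∀ f g b s → (f - g) * (f - g) - (s + s) * ((f - g) * b) + s * s - (f - (g + s * b)) *
        (f - (g + s * b)) ≡ s * s * (1ℚ - b * b)
    lemma = RingSolver.solve-∀ ℚ-ring

-- Weak regularity

∀⊎∃ : ∀ {r} {P Q : Fin r → Set} → (∀ i → P i ⊎ Q i) → (∀ i → P i) ⊎ ∃ Q
∀⊎∃ {zero}  f = inj₁ λ ()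
∀⊎∃ {suc r} f with f zero | ∀⊎∃ (λ i → f (suc i))
... | inj₂ q | _            = inj₂ (zero , q)
... | inj₁ p | inj₂ (i , q) = inj₂ (suc i , q)
... | inj₁ p | inj₁ ps      = inj₁ λ { zero → p ; (suc i) → ps i }

bit : Bool → Fin 2
bit false = zero
bit true  = suc zero

unbit : Fin 2 → Bool
unbit zero    = false
unbit (suc _) = true

unbit-bit : ∀ b → unbit (bit b) ≡ b
unbit-bit false = refl
unbit-bit true  = refl

opaque
  quadruple : ℕ → ℕ
  quadruple M = M ℕ.* 2 ℕ.* 2

  split : ∀ {M} → Fin M → Bool → Bool → Fin (quadruple M)
  split a s t = combine (combine a (bit s)) (bit t)

  parent : ∀ {M} → Fin (quadruple M) → Fin M
  parent {M} a = proj₁ (remQuot {M} 2 (proj₁ (remQuot {M ℕ.* 2} 2 a)))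

  bit₁ bit₂ : ∀ {M} → Fin (quadruple M) → Bool
  bit₁ {M} a = unbit (proj₂ (remQuot {M} 2 (proj₁ (remQuot {M ℕ.* 2} 2 a))))
  bit₂ {M} a = unbit (proj₂ (remQuot {M ℕ.* 2} 2 a))

  parent-split : ∀ {M} (a : Fin M) s t → parent (split a s t) ≡ a
  parent-split {M} a s t = trans (cong (λ z → proj₁ (remQuot {M} 2 (proj₁ z)))
      (remQuot-combine {M ℕ.* 2} {2} (combine a (bit s)) (bit t)))
    (cong proj₁ (remQuot-combine {M} {2} a (bit s)))

  bit₁-split : ∀ {M} (a : Fin M) s t → bit₁ (split a s t) ≡ s
  bit₁-split {M} a s t = trans (cong (λ z → unbit (proj₂ (remQuot {M} 2 (proj₁ z))))
      (remQuot-combine {M ℕ.* 2} {2} (combine a (bit s)) (bit t)))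
    (trans (cong (λ z → unbit (proj₂ z)) (remQuot-combine {M} {2} a (bit s))) (unbit-bit s))

  bit₂-split : ∀ {M} (a : Fin M) s t → bit₂ (split a s t) ≡ t
  bit₂-split {M} a s t = trans (cong (λ z → unbit (proj₂ z)) (remQuot-combine {M ℕ.* 2} {2}
      (combine a (bit s)) (bit t))) (unbit-bit t)

cells : ℕ → ℕ → ℕ
cells zero    M = M
cells (suc j) M = cells j (quadruple M)

lift : ∀ {n M} → (Fin n → Fin M) → (Fin M → Fin M → ℚ) → Fin n → Fin n → ℚ
lift π g x y = g (π x) (π y)

energy-cong : ∀ {n} (F : Fin n → Fin n → ℚ) {g h} → (∀ x y → g x y ≡ h x y) → energy F g ≡ energy F h
energy-cong F p = ∑∑-cong (λ x y → cong (λ z → (F x y - z) * (F x y - z)) (p x y))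

Uniform : ∀ {n} → (F g : Fin n → Fin n → ℚ) → ℚ → Set
Uniform F g β = CutBounded (λ x y → F x y - g x y) β × CutBounded (λ x y → g x y - F x y) β

Uniform-cong : ∀ {n} (F : Fin n → Fin n → ℚ) {g h β} → (∀ x y → g x y ≡ h x y) → Uniform F g β → Uniform F h β
Uniform-cong F p (cut , cut′) =
  (λ S T → eq-≤ (∑∑-cong λ x y → cong (λ z → (F x y - z) * (𝟙 (S x) * 𝟙 (T y))) (sym (p x y))) (cut S T)) ,
  (λ S T → eq-≤ (∑∑-cong λ x y → cong (λ z → (z - F x y) * (𝟙 (S x) * 𝟙 (T y))) (sym (p x y))) (cut′ S T))

spend : ∀ j {e e′ g} → e + g ≤ e′ → e′ ≤ ℕ⇒ℚ (suc j) * g → e ≤ ℕ⇒ℚ j * g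
spend j {e} {e′} {g} p q = ≤-by-diff (0≤a+b (diff-nonNeg p) (diff-nonNeg (≤-eq q (cong (_* g) (ℕ⇒ℚ-suc j)))))
    (lemma (ℕ⇒ℚ j) e e′ g)
  where
  lemma : ∀ j e e′ g → j * g - e ≡ (e′ - (e + g)) + ((1ℚ + j) * g - e′)
  lemma = RingSolver.solve-∀ ℚ-ring

-- One partition regularises `r` edge functions at once: three for triangles, one for almost
-- periods.
module Regularity {n r : ℕ} (F : Fin r → Fin n → Fin n → ℚ) (F-Unit : ∀ i x y → Unit (F i x y)) where

  Approximant : ℕ → Set
  Approximant M = Fin r → Fin M → Fin M → ℚ

  AllUnit : ∀ {M} → Approximant M → Set
  AllUnit G = ∀ i a b → Unit (G i a b)

  energyAt : ∀ {M} → (Fin n → Fin M) → Approximant M → Fin r → ℚ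
  energyAt π G i = energy (F i) (lift π (G i))

  totalEnergy : ∀ {M} → (Fin n → Fin M) → Approximant M → ℚ
  totalEnergy π G = ∑ (energyAt π G)

  -- `energy-≤` is demanded for each `i`, not only for the total, because the midpoint argument
  -- compares the two approximants of a single edge function.
  record Refinement {M} (π : Fin n → Fin M) (G : Approximant M) (M′ : ℕ) : Set where
    field
      π′        : Fin n → Fin M′
      coarsen   : Fin M′ → Fin M
      π≡coarsen : ∀ x → coarsen (π′ x) ≡ π x
      G′        : Approximant M′
      G′-Unit   : AllUnit G′
      energy-≤  : ∀ i → energyAt π′ G′ i ≤ energyAt π G i

  open Refinement

  refine-trans : ∀ {M M₁ M₂} {π : Fin n → Fin M} {G} (R : Refinement π G M₁) →
                 Refinement (π′ R) (G′ R) M₂ → Refinement π G M₂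
  refine-trans R R′ = record
    { π′ = π′ R′ ; coarsen = λ a → coarsen R (coarsen R′ a)
    ; π≡coarsen = λ x → trans (cong (coarsen R) (π≡coarsen R′ x)) (π≡coarsen R x)
    ; G′ = G′ R′ ; G′-Unit = G′-Unit R′ ; energy-≤ = λ i → ≤-trans (energy-≤ R′ i) (energy-≤ R i) }

  -- All edge functions move to the split partition, but only those with `s i` nonzero have their
  -- approximant corrected.
  module Split {M} (π : Fin n → Fin M) (G : Approximant M) (G-Unit : AllUnit G)
               (S T : Fin n → Bool) (s : Fin r → ℚ) where
    πₛ : Fin n → Fin (quadruple M)
    πₛ x = split (π x) (S x) (T x)

    Gₛ : Approximant (quadruple M)
    Gₛ i a b = clamp (G i (parent a) (parent b) + s i * (𝟙 (bit₁ a) * 𝟙 (bit₂ b)))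

    lift-Gₛ : ∀ i x y → lift πₛ (Gₛ i) x y ≡ clamp (lift π (G i) x y + s i * (𝟙 (S x) * 𝟙 (T y)))
    lift-Gₛ i x y = cong clamp (cong₂ _+_
      (cong₂ (G i) (parent-split (π x) (S x) (T x)) (parent-split (π y) (S y) (T y)))
      (cong (s i *_) (cong₂ (λ b c → 𝟙 b * 𝟙 c) (bit₁-split (π x) (S x) (T x))
          (bit₂-split (π y) (S y) (T y)))))

    unchanged : ∀ i → s i ≡ 0ℚ → ∀ x y → lift πₛ (Gₛ i) x y ≡ lift π (G i) x y
    unchanged i s≡0 x y = trans (lift-Gₛ i x y) (trans (cong clamp
        (trans (cong (λ z → lift π (G i) x y + z * (𝟙 (S x) * 𝟙 (T y))) s≡0)
        (lemma (lift π (G i) x y) (𝟙 (S x) * 𝟙 (T y)))))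
      (clamp-id (G-Unit i (π x) (π y))))
      where
      lemma : ∀ a b → a + 0ℚ * b ≡ a
      lemma = RingSolver.solve-∀ ℚ-ring
      clamp-id : ∀ {a} → Unit a → clamp a ≡ a
      clamp-id (0≤a , a≤1) = trans (cong (0ℚ ⊔_) (p≥q⇒p⊓q≡q a≤1)) (p≤q⇒p⊔q≡q 0≤a)

    refinement : (∀ i → energyAt πₛ Gₛ i ≤ energyAt π G i) → Refinement π G (quadruple M)
    refinement p = record { π′ = πₛ ; coarsen = parent ; π≡coarsen = λ x → parent-split (π x) (S x) (T x)
                          ; G′ = Gₛ ; G′-Unit = λ i a b →
                              clamp-Unit (G i (parent a) (parent b) + s i * (𝟙 (bit₁ a) * 𝟙 (bit₂ b))) ;
                              energy-≤ = p }

  -- Splitting by empty sets with zero correction does not alter the approximants on vertices. It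
  -- makes the final number of cells a function of the fuel alone, whenever the iteration stops.
  pad : ∀ j {M} (π : Fin n → Fin M) (G : Approximant M) → AllUnit G →
        Σ (Refinement π G (cells j M)) λ R → ∀ i x y → lift (π′ R) (G′ R i) x y ≡ lift π (G i) x y
  pad zero    π G G-Unit = record { π′ = π ; coarsen = λ a → a ; π≡coarsen = λ _ → refl ; G′ = G ; G′-Unit =
      G-Unit
                                  ; energy-≤ = λ _ → ≤-refl } , λ _ _ _ → refl
  pad (suc j) π G G-Unit = refine-trans first (proj₁ rest) , λ i x y →
      trans (proj₂ rest i x y) (unchanged i refl x y)
    where
    open Split π G G-Unit (λ _ → false) (λ _ → false) (λ _ → 0ℚ)
    first = refinement (λ i → ≤-reflexive (energy-cong (F i) (unchanged i refl)))
    rest  = pad j πₛ Gₛ (G′-Unit first)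

  module Weak (η : ℚ) (0<η : 0ℚ < η) (0<n : 0ℚ < ℕ⇒ℚ n) where
    N² gain bound : ℚ
    N²    = ℕ⇒ℚ n * ℕ⇒ℚ n
    gain  = N² * (η * η)
    bound = N² * η

    0<gain : 0ℚ < gain
    0<gain = 0<a*b (0<a*b 0<n 0<n) (0<a*b 0<η 0<η)

    Improvable : ∀ {M} → (Fin n → Fin M) → Approximant M → Fin r → Set
    Improvable π G i = ∃₂ λ (S T : Fin n → Bool) → ∃ λ s →
      gain ≤ s * ∑∑ (λ x y → (F i x y - lift π (G i) x y) * (𝟙 (S x) * 𝟙 (T y))) × N² * (s * s) ≤ gain

    uniform? : ∀ {M} (π : Fin n → Fin M) (G : Approximant M) i →
               Uniform (F i) (lift π (G i)) bound ⊎ Improvable π G i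
    uniform? π G i = decide (cut? (λ x y → F i x y - lift π (G i) x y) bound)
        (cut? (λ x y → lift π (G i) x y - F i x y) bound)
      where
      lemma : ∀ m a → m * (a * a) ≡ a * (m * a)
      lemma = RingSolver.solve-∀ ℚ-ring
      flip : ∀ f g b a → a * ((g - f) * b) ≡ (- a) * ((f - g) * b)
      flip = RingSolver.solve-∀ ℚ-ring
      square : ∀ a → (- a) * (- a) ≡ a * a
      square = RingSolver.solve-∀ ℚ-ring
      Violation : (Fin n → Fin n → ℚ) → Set
      Violation h = ∃₂ λ (S T : Fin n → Bool) → bound < ∑∑ (λ x y → h x y * (𝟙 (S x) * 𝟙 (T y)))
      decide : CutBounded (λ x y → F i x y - lift π (G i) x y) bound ⊎ Violation
          (λ x y → F i x y - lift π (G i) x y) →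
               CutBounded (λ x y → lift π (G i) x y - F i x y) bound ⊎ Violation
                   (λ x y → lift π (G i) x y - F i x y) →
               Uniform (F i) (lift π (G i)) bound ⊎ Improvable π G i
      decide (inj₁ p) (inj₁ q) = inj₁ (p , q)
      decide (inj₂ (S , T , p)) _ = inj₂ (S , T , η , eq-≤ (lemma N² η) (*-monoˡ (<⇒≤ 0<η) (<⇒≤ p)) , ≤-refl)
      -- A rectangle on which the approximant is too large calls for the opposite correction.
      decide (inj₁ _) (inj₂ (S , T , p)) = inj₂ (S , T , - η ,
          eq-≤ (lemma N² η) (≤-eq (*-monoˡ (<⇒≤ 0<η) (<⇒≤ p)) (trans (*-distribˡ-∑∑ η _)
            (trans (∑∑-cong (λ x y → flip (F i x y) (lift π (G i) x y) (𝟙 (S x) * 𝟙 (T y)) η))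
                (sym (*-distribˡ-∑∑ (- η) _))))) ,
          ≤-reflexive (cong (N² *_) (square η)))

    improve : ∀ {M} (π : Fin n → Fin M) (G : Approximant M) → AllUnit G → ∀ i → Improvable π G i →
              Σ (Refinement π G (quadruple M)) λ R → totalEnergy (π′ R) (G′ R) + gain ≤ totalEnergy π G
    improve π G G-Unit i (S , T , s , p , q) = refinement mono , ∑-mono-gain mono i gains
      where
      sᵢ : Fin r → ℚ
      sᵢ k = if does (k Fin.≟ i) then s else 0ℚ
      open Split π G G-Unit S T sᵢ
      sᵢ-self : sᵢ i ≡ s
      sᵢ-self = cong (λ b → if b then s else 0ℚ) (dec-true (i Fin.≟ i) refl)
      sᵢ-other : ∀ {k} → ¬ k ≡ i → sᵢ k ≡ 0ℚ
      sᵢ-other {k} k≢i = cong (λ b → if b then s else 0ℚ) (dec-false (k Fin.≟ i) k≢i)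
      gains : energyAt πₛ Gₛ i + gain ≤ energyAt π G i
      gains = eq-≤ (cong (_+ gain) (energy-cong (F i) (λ x y → trans (lift-Gₛ i x y)
                (cong (λ z → clamp (lift π (G i) x y + z * (𝟙 (S x) * 𝟙 (T y)))) sᵢ-self))))
              (energy-decrement (F i) (lift π (G i)) (F-Unit i) S T s gain p q)
      mono′ : ∀ k → Dec (k ≡ i) → energyAt πₛ Gₛ k ≤ energyAt π G k
      mono′ k (yes refl) = ≤-trans (eq-≤ (sym (+-identityʳ _)) (+-monoʳ-≤ (energyAt πₛ Gₛ k) (<⇒≤ 0<gain)))
          gains
      mono′ k (no k≢i)   = ≤-reflexive (energy-cong (F k) (unchanged k (sᵢ-other k≢i)))
      mono : ∀ k → energyAt πₛ Gₛ k ≤ energyAt π G k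
      mono k = mono′ k (k Fin.≟ i)

    0≤totalEnergy : ∀ {M} (π : Fin n → Fin M) G → 0ℚ ≤ totalEnergy π G
    0≤totalEnergy π G = ∑-nonNeg (λ i → 0≤energy (F i) (lift π (G i)))

    -- Frieze-Kannan iteration: each violated rectangle costs `gain` of the total energy, which
    -- stays nonnegative. Partition and approximant at the start are arbitrary, since removal
    -- refines repeatedly what it already has.
    weak-regularity : ∀ j {M} (π : Fin n → Fin M) (G : Approximant M) → AllUnit G → totalEnergy π G ≤
        ℕ⇒ℚ j * gain →
      Σ (Refinement π G (cells j M)) λ R → ∀ i → Uniform (F i) (lift (π′ R) (G′ R i)) bound
    weak-regularity-step : ∀ j {M} (π : Fin n → Fin M) (G : Approximant M) → AllUnit G → totalEnergy π G ≤
        ℕ⇒ℚ j * gain →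
      (∀ i → Uniform (F i) (lift π (G i)) bound) ⊎ ∃ (Improvable π G) →
      Σ (Refinement π G (cells j M)) λ R → ∀ i → Uniform (F i) (lift (π′ R) (G′ R i)) bound

    weak-regularity j π G G-Unit E≤ = weak-regularity-step j π G G-Unit E≤ (∀⊎∃ (uniform? π G))

    weak-regularity-step j π G G-Unit E≤ (inj₁ uniform) =
      proj₁ padded , λ i → Uniform-cong (F i) (λ x y → sym (proj₂ padded i x y)) (uniform i)
      where padded = pad j π G G-Unit
    weak-regularity-step zero π G G-Unit E≤ (inj₂ (i , improvable)) = contradiction
      (<-≤-trans (<-≤-trans 0<gain (eq-≤ (sym (+-identityˡ gain))
          (+-monoˡ-≤ gain (0≤totalEnergy (π′ R) (G′ R)))))
        (≤-trans (proj₂ improved) (≤-eq E≤ (*-zeroˡ gain)))) (<-irrefl refl)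
      where
      improved = improve π G G-Unit i improvable
      R        = proj₁ improved
    weak-regularity-step (suc j) π G G-Unit E≤ (inj₂ (i , improvable)) = refine-trans R (proj₁ rest) ,
        proj₂ rest
      where
      improved = improve π G G-Unit i improvable
      R        = proj₁ improved
      rest = weak-regularity j (π′ R) (G′ R) (G′-Unit R) (spend j (proj₂ improved) E≤)

-- Triangle removal

does-true : ∀ {P : Set} (d : Dec P) → does d ≡ true → P
does-true (yes p) _ = p

does-false : ∀ {P : Set} (d : Dec P) → does d ≡ false → ¬ P
does-false (no p) _ = p

∑∑-cells : ∀ {n M} (π : Fin n → Fin M) (f : Fin n → Fin n → ℚ) →
           ∑∑ f ≡ ∑∑ λ a b → ∑∑ λ x y → 𝟙 (π x == a) * 𝟙 (π y == b) * f x y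
∑∑-cells π f = begin
  ∑∑ f                                                                   ≡⟨ ∑-fibres π (λ _ x → ∑ (f x)) ⟩
  ∑∑ (λ a x → 𝟙 (π x == a) * ∑ (f x))                                    ≡⟨
      ∑∑-cong (λ a x → cong (𝟙 (π x == a) *_) (∑-fibres π (λ _ y → f x y))) ⟩
  ∑∑ (λ a x → 𝟙 (π x == a) * ∑∑ (λ b y → 𝟙 (π y == b) * f x y))          ≡⟨
      ∑∑-cong (λ a x → *-distribˡ-∑∑ (𝟙 (π x == a)) _) ⟩
  ∑∑ (λ a x → ∑∑ (λ b y → 𝟙 (π x == a) * (𝟙 (π y == b) * f x y)))        ≡⟨ ∑-cong (λ a → ∑-comm _) ⟩
  ∑∑ (λ a b → ∑∑ (λ x y → 𝟙 (π x == a) * (𝟙 (π y == b) * f x y)))        ≡⟨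
      ∑∑-cong (λ a b → ∑∑-cong (λ x y → sym (*-assoc (𝟙 (π x == a)) (𝟙 (π y == b)) (f x y)))) ⟩
  ∑∑ (λ a b → ∑∑ (λ x y → 𝟙 (π x == a) * 𝟙 (π y == b) * f x y))          ∎
  where open ≡-Reasoning

∑∑-by-cells : ∀ {n M} (π : Fin n → Fin M) (f : Fin M → Fin M → ℚ) →
              ∑∑ (λ x y → f (π x) (π y)) ≡ ∑∑ λ a b → size π a * size π b * f a b
∑∑-by-cells π f = trans (∑-cong (λ x → ∑-by-cells π (f (π x))))
  (trans (∑-by-cells π (λ a → ∑ (λ b → size π b * f a b)))
    (∑-cong (λ a → trans (*-distribˡ-∑ (size π a) _) (∑-cong (λ b →
        sym (*-assoc (size π a) (size π b) (f a b)))))))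

size-nonNeg : ∀ {n M} (π : Fin n → Fin M) a → 0ℚ ≤ size π a
size-nonNeg π a = ∑-nonNeg (λ x → 0≤𝟙 (π x == a))

module Cells {n M : ℕ} (π : Fin n → Fin M) (t : ℚ) where

  lowCount : (Fin n → Fin n → ℚ) → Fin M → Fin M → ℚ
  lowCount g′ a b = ∑∑ λ x y → 𝟙 (π x == a) * 𝟙 (π y == b) * 𝟙 (does (g′ x y <? t))

  -- More than an eighth of the pairs have `g′` below `t`. Three pairs of cells that are not bad
  -- thus keep at least `1 - 3/8` of their vertex triples.
  bad : (Fin n → Fin n → ℚ) → Fin M → Fin M → Bool
  bad g′ a b = does (size π a * size π b <? ℕ⇒ℚ 8 * lowCount g′ a b)

  module BadEdges (ν : ℚ) (0<t : 0ℚ < t) (tν≡1 : t * ν ≡ 1ℚ) (0≤ν : 0ℚ ≤ ν)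
                  (F g′ : Fin n → Fin n → ℚ) (F-Unit : ∀ x y → Unit (F x y)) (G : Fin M → Fin M → ℚ)
                  (β k : ℚ) (cut : CutBounded (λ x y → F x y - g′ x y) β)
                  (close : energy (lift π G) g′ ≤ k) where

    -- Where `G` is below `2t` there are few edges anyway; where it is not, badness forces `g′` away
    -- from `G`.
    low high∧bad : Fin M → Fin M → Bool
    low a b = does (G a b <? t + t)
    high∧bad a b = not (low a b) ∧ bad g′ a b

    d : Fin n → Fin n → ℚ
    d x y = lift π G x y - g′ x y

    -- The low pairs form a union of `M` rectangles, one for each cell `a` of the first vertex, and
    -- each of them costs `β`.
    ∑∑-cut-low : ∑∑ (λ x y → (F x y - g′ x y) * 𝟙 (low (π x) (π y))) ≤ ℕ⇒ℚ M * β
    ∑∑-cut-low = eq-≤ (trans (∑-fibres π (λ a x → ∑ λ y → (F x y - g′ x y) * 𝟙 (low a (π y))))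
        (∑-cong (λ a → ∑-cong (λ x → trans (*-distribˡ-∑ (𝟙 (π x == a)) _)
          (∑-cong (λ y → lemma (𝟙 (π x == a)) (F x y - g′ x y) (𝟙 (low a (π y)))))))))
      (∑-≤-const (λ a → cut (λ x → π x == a) (λ y → low a (π y))))
      where
      lemma : ∀ p h q → p * (h * q) ≡ h * (p * q)
      lemma = RingSolver.solve-∀ ℚ-ring

    -- On a high pair of cells every point with `g′ < t` has `d > t`, that is `ν²d² > 1`; in a bad
    -- pair such points make up more than an eighth.
    cell-bound : ∀ a b → size π a * size π b * 𝟙 (high∧bad a b) ≤
        ℕ⇒ℚ 8 * (ν * ν) * ∑∑ (λ x y → 𝟙 (π x == a) * 𝟙 (π y == b) * (d x y * d x y))
    cell-bound a b = by-cases (G a b <? t + t) (size π a * size π b <? ℕ⇒ℚ 8 * lowCount g′ a b)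
      where
      R = ∑∑ (λ x y → 𝟙 (π x == a) * 𝟙 (π y == b) * (d x y * d x y))
      0≤R : 0ℚ ≤ ℕ⇒ℚ 8 * (ν * ν) * R
      0≤R = 0≤a*b (0≤a*b (0≤ℕ⇒ℚ 8) (0≤a² ν)) (∑∑-nonNeg (λ x y →
          0≤a*b (0≤a*b (0≤𝟙 (π x == a)) (0≤𝟙 (π y == b))) (0≤a² (d x y))))
      1≤νd : ∀ {g g′} → t + t ≤ g → g′ < t → 1ℚ ≤ ν * ν * ((g - g′) * (g - g′))
      1≤νd {g} {g′} p q = ≤-eq (*-mono 0≤1 (≤-trans 0≤1 step) step step) (lemma′ ν (g - g′))
        where
        lemma : ∀ t g g′ → g - g′ - t ≡ (g - (t + t)) + (t - g′)
        lemma = RingSolver.solve-∀ ℚ-ring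
        lemma′ : ∀ a b → a * b * (a * b) ≡ a * a * (b * b)
        lemma′ = RingSolver.solve-∀ ℚ-ring
        step : 1ℚ ≤ ν * (g - g′)
        step = eq-≤ (trans (sym tν≡1) (*-comm t ν)) (*-monoˡ 0≤ν
            (≤-by-diff (0≤a+b (diff-nonNeg p) (diff-nonNeg (<⇒≤ q))) (lemma t g g′)))
      pointwise : t + t ≤ G a b → ∀ x y → 𝟙 (π x == a) * 𝟙 (π y == b) * 𝟙 (does (g′ x y <? t)) ≤
          ν * ν * (𝟙 (π x == a) * 𝟙 (π y == b) * (d x y * d x y))
      pointwise p x y = cases (π x Fin.≟ a) (π y Fin.≟ b) (g′ x y <? t)
        where
        0≤rhs : ∀ p q → 0ℚ ≤ ν * ν * (𝟙 p * 𝟙 q * (d x y * d x y))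
        0≤rhs p q = 0≤a*b (0≤a² ν) (0≤a*b (0≤a*b (0≤𝟙 p) (0≤𝟙 q)) (0≤a² (d x y)))
        cases : (p : Dec (π x ≡ a)) (q : Dec (π y ≡ b)) (r : Dec (g′ x y < t)) →
                𝟙 (does p) * 𝟙 (does q) * 𝟙 (does r) ≤ ν * ν * (𝟙 (does p) * 𝟙 (does q) * (d x y * d x y))
        cases (yes refl) (yes refl) (yes r) =
            ≤-eq (1≤νd p r) (cong (ν * ν *_) (sym (*-identityˡ (d x y * d x y))))
        cases p q (no r) = eq-≤ (*-zeroʳ (𝟙 (does p) * 𝟙 (does q))) (0≤rhs (does p) (does q))
        cases p (no q) (yes r) = eq-≤ (trans (cong (_* 1ℚ) (*-zeroʳ (𝟙 (does p)))) (*-zeroˡ 1ℚ))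
            (0≤rhs (does p) false)
        cases (no p) (yes q) (yes r) = 0≤rhs false true
      by-cases : (p : Dec (G a b < t + t)) (q : Dec (size π a * size π b < ℕ⇒ℚ 8 * lowCount g′ a b)) →
                 size π a * size π b * 𝟙 (not (does p) ∧ does q) ≤ ℕ⇒ℚ 8 * (ν * ν) * R
      by-cases (yes p) q       = eq-≤ (*-zeroʳ (size π a * size π b)) 0≤R
      by-cases (no p)  (no q)  = eq-≤ (*-zeroʳ (size π a * size π b)) 0≤R
      by-cases (no p)  (yes q) = begin
        size π a * size π b * 1ℚ    ≡⟨ *-identityʳ _ ⟩
        size π a * size π b         <⟨ q ⟩
        ℕ⇒ℚ 8 * lowCount g′ a b     ≤⟨ *-monoˡ (0≤ℕ⇒ℚ 8) (≤-eq (∑∑-mono (pointwise (≮⇒≥ p)))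
            (sym (*-distribˡ-∑∑ (ν * ν) _))) ⟩
        ℕ⇒ℚ 8 * (ν * ν * R)         ≡⟨ *-assoc (ℕ⇒ℚ 8) (ν * ν) R ⟨
        ℕ⇒ℚ 8 * (ν * ν) * R         ∎
        where open ≤-Reasoning

    ∑∑-high∧bad : ∑∑ (λ x y → 𝟙 (high∧bad (π x) (π y))) ≤ ℕ⇒ℚ 8 * (ν * ν) * k
    ∑∑-high∧bad = begin
      ∑∑ (λ x y → 𝟙 (high∧bad (π x) (π y)))                                      ≡⟨
          ∑∑-by-cells π (λ a b → 𝟙 (high∧bad a b)) ⟩
      ∑∑ (λ a b → size π a * size π b * 𝟙 (high∧bad a b))                        ≤⟨ ∑∑-mono cell-bound ⟩
      ∑∑ (λ a b → c * ∑∑ (λ x y → 𝟙 (π x == a) * 𝟙 (π y == b) * (d x y * d x y))) ≡⟨ *-distribˡ-∑∑ c _ ⟨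
      c * ∑∑ (λ a b → ∑∑ (λ x y → 𝟙 (π x == a) * 𝟙 (π y == b) * (d x y * d x y))) ≡⟨
          cong (c *_) (∑∑-cells π (λ x y → d x y * d x y)) ⟨
      c * energy (lift π G) g′                                                   ≤⟨
          *-monoˡ (0≤a*b (0≤ℕ⇒ℚ 8) (0≤a² ν)) close ⟩
      c * k                                                                      ∎
      where
      open ≤-Reasoning
      c = ℕ⇒ℚ 8 * (ν * ν)

    -- On low pairs write `F` as `(F - g′) + (g′ - G) + G`: the three parts are controlled by the
    -- cut norm, by AM-GM and by `2t`. On pairs that are high and bad, `F ≤ 1` suffices.
    ∑∑-bad-edges : ∑∑ (λ x y → F x y * 𝟙 (bad g′ (π x) (π y))) ≤
      ℕ⇒ℚ M * β + (ν * k + ℕ⇒ℚ n * ℕ⇒ℚ n * (t + t + t)) + ℕ⇒ℚ 8 * (ν * ν) * k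
    ∑∑-bad-edges = begin
      ∑∑ (λ x y → F x y * 𝟙 (bad g′ (π x) (π y)))
        ≤⟨ ∑∑-mono pointwise ⟩
      ∑∑ (λ x y → (F x y - g′ x y) * 𝟙 (low (π x) (π y)) + (ν * (d x y * d x y) + (t + t + t)) + 𝟙
          (high∧bad (π x) (π y)))
        ≡⟨ trans (∑∑-distrib-+ _ _) (cong (_+ ∑∑ (λ x y → 𝟙 (high∧bad (π x) (π y))))
            (trans (∑∑-distrib-+ _ _) (cong (_+_ (∑∑ (λ x y → (F x y - g′ x y) * 𝟙 (low (π x) (π y)))))
            (trans (∑∑-distrib-+ _ _) (cong₂ _+_ (sym (*-distribˡ-∑∑ ν _)) (∑∑-const n n (t + t + t))))))) ⟩
      ∑∑ (λ x y → (F x y - g′ x y) * 𝟙 (low (π x) (π y))) + (ν * energy (lift π G) g′ + ℕ⇒ℚ n * ℕ⇒ℚ n *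
          (t + t + t)) + ∑∑ (λ x y → 𝟙 (high∧bad (π x) (π y)))
        ≤⟨ +-mono-≤ (+-mono-≤ ∑∑-cut-low (+-monoˡ-≤ (ℕ⇒ℚ n * ℕ⇒ℚ n * (t + t + t)) (*-monoˡ 0≤ν close)))
            ∑∑-high∧bad ⟩
      ℕ⇒ℚ M * β + (ν * k + ℕ⇒ℚ n * ℕ⇒ℚ n * (t + t + t)) + ℕ⇒ℚ 8 * (ν * ν) * k ∎
      where
      open ≤-Reasoning
      0≤t = <⇒≤ 0<t
      -- Multiply `e² - te + t² ≥ 0` by `ν = 1/t`.
      am-gm : ∀ e → e ≤ ν * (e * e) + t
      am-gm e = ≤-by-diff (0≤a*b 0≤ν (≤-eq (0≤a*b (nonNegative⁻¹ ½)
          (0≤a+b (0≤a+b (0≤a² (e - t)) (0≤a² e)) (0≤a² t))) (half e t)))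
        (trans (cong₂ (λ p q → ν * (e * e) + p - q) (trans (sym (*-identityˡ t)) (cong (_* t) (sym tν≡1)))
            (trans (sym (*-identityˡ e)) (cong (_* e) (sym tν≡1)))) (lemma e t ν))
        where
        half : ∀ e t → ½ * ((e - t) * (e - t) + e * e + t * t) ≡ e * e - t * e + t * t
        half = RingSolver.solve-∀ ℚ-ring
        lemma : ∀ e t ν → ν * (e * e) + t * ν * t - t * ν * e ≡ ν * (e * e - t * e + t * t)
        lemma = RingSolver.solve-∀ ℚ-ring
      cases : ∀ {f g g′} → Unit f → (p : Dec (g < t + t)) → ∀ q →
              f * 𝟙 q ≤ (f - g′) * 𝟙 (does p) + (ν * ((g - g′) * (g - g′)) + (t + t + t)) + 𝟙
                  (not (does p) ∧ q)
      cases {f} {g} {g′} (0≤f , f≤1) (yes p) q = begin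
        f * 𝟙 q                     ≤⟨ ≤-eq (*-monoˡ 0≤f (𝟙≤1 q)) (*-identityʳ f) ⟩
        f                           ≤⟨ ≤-by-diff (0≤a+b (diff-nonNeg (am-gm (g′ - g))) (diff-nonNeg (<⇒≤ p)))
            (lemma f g g′ t ν) ⟩
        (f - g′) * 1ℚ + (ν * ((g - g′) * (g - g′)) + (t + t + t)) + 0ℚ ∎
        where
        lemma : ∀ f g g′ t ν → (f - g′) * 1ℚ + (ν * ((g - g′) * (g - g′)) + (t + t + t)) + 0ℚ - f ≡
            (ν * ((g′ - g) * (g′ - g)) + t - (g′ - g)) + (t + t - g)
        lemma = RingSolver.solve-∀ ℚ-ring
      cases {f} {g} {g′} (0≤f , f≤1) (no p) q = begin
        f * 𝟙 q                     ≤⟨ ≤-eq (*-monoʳ (0≤𝟙 q) f≤1) (*-identityˡ (𝟙 q)) ⟩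
        𝟙 q                         ≤⟨ ≤-by-diff (0≤a+b (0≤a*b 0≤ν (0≤a² (g - g′)))
            (0≤a+b (0≤a+b 0≤t 0≤t) 0≤t)) (lemma f g g′ t ν (𝟙 q)) ⟩
        (f - g′) * 0ℚ + (ν * ((g - g′) * (g - g′)) + (t + t + t)) + 𝟙 q ∎
        where
        lemma : ∀ f g g′ t ν q → (f - g′) * 0ℚ + (ν * ((g - g′) * (g - g′)) + (t + t + t)) + q - q ≡
            ν * ((g - g′) * (g - g′)) + (t + t + t)
        lemma = RingSolver.solve-∀ ℚ-ring
      pointwise : ∀ x y → F x y * 𝟙 (bad g′ (π x) (π y)) ≤
        (F x y - g′ x y) * 𝟙 (low (π x) (π y)) + (ν * (d x y * d x y) + (t + t + t)) + 𝟙
            (high∧bad (π x) (π y))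
      pointwise x y = cases (F-Unit x y) (G (π x) (π y) <? t + t) (bad g′ (π x) (π y))

∑₃ : ∀ {n} → (Fin n → Fin n → Fin n → ℚ) → ℚ
∑₃ f = ∑ λ u → ∑∑ (f u)

∑₃-cong : ∀ {n} {f g : Fin n → Fin n → Fin n → ℚ} → (∀ u v w → f u v w ≡ g u v w) → ∑₃ f ≡ ∑₃ g
∑₃-cong p = ∑-cong (λ u → ∑∑-cong (p u))

∑₃-mono : ∀ {n} {f g : Fin n → Fin n → Fin n → ℚ} → (∀ u v w → f u v w ≤ g u v w) → ∑₃ f ≤ ∑₃ g
∑₃-mono p = ∑-mono (λ u → ∑∑-mono (p u))

∑₃-distrib-- : ∀ {n} (f g : Fin n → Fin n → Fin n → ℚ) → ∑₃ (λ u v w → f u v w - g u v w) ≡ ∑₃ f - ∑₃ g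
∑₃-distrib-- f g = trans (∑-cong (λ u → ∑∑-distrib-- (f u) (g u))) (∑-distrib-- _ _)

*-distribˡ-∑₃ : ∀ {n} c (f : Fin n → Fin n → Fin n → ℚ) → c * ∑₃ f ≡ ∑₃ (λ u v w → c * f u v w)
*-distribˡ-∑₃ c f = trans (*-distribˡ-∑ c _) (∑-cong (λ u → *-distribˡ-∑∑ c (f u)))

∑₃-swap₁₂ : ∀ {n} (f : Fin n → Fin n → Fin n → ℚ) → ∑₃ f ≡ ∑₃ (λ v u w → f u v w)
∑₃-swap₁₂ f = ∑-comm _

∑₃-rotate : ∀ {n} (f : Fin n → Fin n → Fin n → ℚ) → ∑₃ f ≡ ∑₃ (λ w u v → f u v w)
∑₃-rotate f = trans (∑-cong (λ u → ∑-comm (f u))) (∑-comm _)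

∑₃-separate : ∀ {n} (a : Fin n → ℚ) (b : Fin n → Fin n → ℚ) → ∑₃ (λ u v w → a u * b v w) ≡ ∑ a * ∑∑ b
∑₃-separate a b = trans (∑-cong (λ u → sym (*-distribˡ-∑∑ (a u) b))) (sym (*-distribʳ-∑ (∑∑ b) a))

∑∑-separate : ∀ {n} (a b : Fin n → ℚ) → ∑∑ (λ x y → a x * b y) ≡ ∑ a * ∑ b
∑∑-separate a b = trans (∑-cong (λ x → sym (*-distribˡ-∑ (a x) b))) (sym (*-distribʳ-∑ (∑ b) a))

-- Replacing one edge function at a time costs β per value of the opposite vertex.
triangle-counting : ∀ {n} {β} (F₁ F₂ F₃ g₁ g₂ g₃ : Fin n → Fin n → ℚ) →
  (∀ x y → Unit (F₂ x y)) → (∀ x y → Unit (F₃ x y)) → (∀ x y → Unit (g₁ x y)) → (∀ x y → Unit (g₂ x y)) →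
  CutBounded (λ x y → g₁ x y - F₁ x y) β → CutBounded (λ x y → g₂ x y - F₂ x y) β →
      CutBounded (λ x y → g₃ x y - F₃ x y) β →
  ∀ (a b c : Fin n → ℚ) → (∀ x → Unit (a x)) → (∀ x → Unit (b x)) → (∀ x → Unit (c x)) →
  ∑₃ (λ u v w → a u * (b v * c w) * (g₁ v w * (g₂ u w * g₃ u v))) ≤
  ∑₃ (λ u v w → a u * (b v * c w) * (F₁ v w * (F₂ u w * F₃ u v))) + (ℕ⇒ℚ n * β + ℕ⇒ℚ n * β + ℕ⇒ℚ n * β)
triangle-counting {n} {β} F₁ F₂ F₃ g₁ g₂ g₃ U₂ U₃ V₁ V₂ cut₁ cut₂ cut₃ a b c Ua Ub Uc =
  ≤-by-diff (0≤a+b (0≤a+b (diff-nonNeg step₁) (diff-nonNeg step₂)) (diff-nonNeg step₃))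
      (collect X₀ X₁ X₂ X₃ (ℕ⇒ℚ n * β))
  where
  W : Fin n → Fin n → Fin n → ℚ
  W u v w = a u * (b v * c w)
  X₀ = ∑₃ (λ u v w → W u v w * (F₁ v w * (F₂ u w * F₃ u v)))
  X₁ = ∑₃ (λ u v w → W u v w * (g₁ v w * (F₂ u w * F₃ u v)))
  X₂ = ∑₃ (λ u v w → W u v w * (g₁ v w * (g₂ u w * F₃ u v)))
  X₃ = ∑₃ (λ u v w → W u v w * (g₁ v w * (g₂ u w * g₃ u v)))
  collect : ∀ a b c d m → a + (m + m + m) - d ≡ (m - (b - a)) + (m - (c - b)) + (m - (d - c))
  collect = RingSolver.solve-∀ ℚ-ring
  rearrange₁ : ∀ a b c f g p q → a * (b * c) * (g * (p * q)) - a * (b * c) * (f * (p * q)) ≡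
      (g - f) * ((a * (b * q)) * (c * p))
  rearrange₁ = RingSolver.solve-∀ ℚ-ring
  rearrange₂ : ∀ a b c f g p q → a * (b * c) * (p * (g * q)) - a * (b * c) * (p * (f * q)) ≡
      (g - f) * ((a * q) * (b * (c * p)))
  rearrange₂ = RingSolver.solve-∀ ℚ-ring
  rearrange₃ : ∀ a b c f g p q → a * (b * c) * (p * (q * g)) - a * (b * c) * (p * (q * f)) ≡
      (g - f) * ((a * (c * q)) * (b * p))
  rearrange₃ = RingSolver.solve-∀ ℚ-ring
  step₁ : X₁ - X₀ ≤ ℕ⇒ℚ n * β
  step₁ = eq-≤ (trans (sym (∑₃-distrib-- _ _)) (∑₃-cong (λ u v w →
      rearrange₁ (a u) (b v) (c w) (F₁ v w) (g₁ v w) (F₂ u w) (F₃ u v))))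
    (∑-≤-const (λ u → cut-weights (λ x y → g₁ x y - F₁ x y) cut₁ (λ v → a u * (b v * F₃ u v))
        (λ w → c w * F₂ u w)
      (λ v → Unit-* (Ua u) (Unit-* (Ub v) (U₃ u v))) (λ w → Unit-* (Uc w) (U₂ u w))))
  step₂ : X₂ - X₁ ≤ ℕ⇒ℚ n * β
  step₂ = eq-≤ (trans (sym (∑₃-distrib-- _ _)) (trans (∑₃-swap₁₂ _)
      (∑₃-cong (λ v u w → rearrange₂ (a u) (b v) (c w) (F₂ u w) (g₂ u w) (g₁ v w) (F₃ u v)))))
    (∑-≤-const (λ v → cut-weights (λ x y → g₂ x y - F₂ x y) cut₂ (λ u → a u * F₃ u v)
        (λ w → b v * (c w * g₁ v w))
      (λ u → Unit-* (Ua u) (U₃ u v)) (λ w → Unit-* (Ub v) (Unit-* (Uc w) (V₁ v w)))))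
  step₃ : X₃ - X₂ ≤ ℕ⇒ℚ n * β
  step₃ = eq-≤ (trans (sym (∑₃-distrib-- _ _)) (trans (∑₃-rotate _)
      (∑₃-cong (λ w u v → rearrange₃ (a u) (b v) (c w) (F₃ u v) (g₃ u v) (g₁ v w) (g₂ u w)))))
    (∑-≤-const (λ w → cut-weights (λ x y → g₃ x y - F₃ x y) cut₃ (λ u → a u * (c w * g₂ u w))
        (λ v → b v * g₁ v w)
      (λ u → Unit-* (Ua u) (Unit-* (Uc w) (V₂ u w))) (λ v → Unit-* (Ub v) (V₁ v w))))

module _ {n M : ℕ} (π : Fin n → Fin M) (t : ℚ) (0≤t : 0ℚ ≤ t) where
  open Cells π t

  -- Union bound: discard the vertex triples with some side below `t`; each of the others weighs at
  -- least `t³`.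
  dense-cells : (g₁ g₂ g₃ : Fin n → Fin n → ℚ) → (∀ x y → 0ℚ ≤ g₁ x y) → (∀ x y → 0ℚ ≤ g₂ x y) →
      (∀ x y → 0ℚ ≤ g₃ x y) →
    ∀ a b c →
    t * t * t * (size π a * (size π b * size π c) - size π a * lowCount g₁ b c - size π b * lowCount g₂ a c -
        size π c * lowCount g₃ a b) ≤
    ∑₃ (λ u v w → 𝟙 (π u == a) * (𝟙 (π v == b) * 𝟙 (π w == c)) * (g₁ v w * (g₂ u w * g₃ u v)))
  dense-cells g₁ g₂ g₃ p₁ p₂ p₃ a b c = eq-≤ (sym total) (∑₃-mono pointwise)
    where
    α β γ : Fin n → ℚ
    α u = 𝟙 (π u == a)
    β v = 𝟙 (π v == b)
    γ w = 𝟙 (π w == c)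
    b₁ b₂ b₃ : Fin n → Fin n → ℚ
    b₁ x y = 𝟙 (does (g₁ x y <? t))
    b₂ x y = 𝟙 (does (g₂ x y <? t))
    b₃ x y = 𝟙 (does (g₃ x y <? t))
    f₀ f₁ f₂ f₃ : Fin n → Fin n → Fin n → ℚ
    f₀ u v w = α u * (β v * γ w)
    f₁ u v w = α u * (β v * γ w * b₁ v w)
    f₂ u v w = β v * (α u * γ w * b₂ u w)
    f₃ u v w = γ w * (α u * β v * b₃ u v)
    total : ∑₃ (λ u v w → t * t * t * (f₀ u v w - f₁ u v w - f₂ u v w - f₃ u v w)) ≡
            t * t * t * (size π a * (size π b * size π c) - size π a * lowCount g₁ b c - size π b * lowCount
                g₂ a c - size π c * lowCount g₃ a b)
    total = trans (sym (*-distribˡ-∑₃ (t * t * t) _)) (cong (t * t * t *_)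
      (trans (∑₃-distrib-- _ f₃) (cong₂ _-_
        (trans (∑₃-distrib-- _ f₂) (cong₂ _-_
          (trans (∑₃-distrib-- f₀ f₁) (cong₂ _-_
            (trans (∑₃-separate α (λ v w → β v * γ w)) (cong (size π a *_) (∑∑-separate β γ)))
            (∑₃-separate α _)))
          (trans (∑₃-swap₁₂ f₂) (∑₃-separate β _))))
        (trans (∑₃-rotate f₃) (∑₃-separate γ _)))))
    0≤t³ : 0ℚ ≤ t * t * t
    0≤t³ = 0≤a*b (0≤a² t) 0≤t
    0≤g : ∀ u v w → 0ℚ ≤ g₁ v w * (g₂ u w * g₃ u v)
    0≤g u v w = 0≤a*b (p₁ v w) (0≤a*b (p₂ u w) (p₃ u v))
    cube : ∀ u v w (d₁ : Dec (g₁ v w < t)) (d₂ : Dec (g₂ u w < t)) (d₃ : Dec (g₃ u v < t)) →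
           t * t * t * (1ℚ - 𝟙 (does d₁) - 𝟙 (does d₂) - 𝟙 (does d₃)) ≤ g₁ v w * (g₂ u w * g₃ u v)
    cube u v w (no q₁) (no q₂) (no q₃) = eq-≤ (lemma t)
      (*-mono 0≤t (0≤a*b (p₂ u w) (p₃ u v)) (≮⇒≥ q₁) (*-mono 0≤t (p₃ u v) (≮⇒≥ q₂) (≮⇒≥ q₃)))
      where
      lemma : ∀ t → t * t * t * 1ℚ ≡ t * (t * t)
      lemma = RingSolver.solve-∀ ℚ-ring
    cube u v w (yes _) d₂ d₃ = ≤-trans (≤-by-diff (0≤a*b 0≤t³ (0≤a+b (0≤𝟙 (does d₂)) (0≤𝟙 (does d₃))))
        (lemma (t * t * t) (𝟙 (does d₂)) (𝟙 (does d₃)))) (0≤g u v w)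
      where
      lemma : ∀ s x y → 0ℚ - s * (1ℚ - 1ℚ - x - y) ≡ s * (x + y)
      lemma = RingSolver.solve-∀ ℚ-ring
    cube u v w (no _) (yes _) d₃ = ≤-trans (≤-by-diff (0≤a*b 0≤t³ (0≤𝟙 (does d₃)))
        (lemma (t * t * t) (𝟙 (does d₃)))) (0≤g u v w)
      where
      lemma : ∀ s y → 0ℚ - s * (1ℚ - 0ℚ - 1ℚ - y) ≡ s * y
      lemma = RingSolver.solve-∀ ℚ-ring
    cube u v w (no _) (no _) (yes _) = eq-≤ (*-zeroʳ (t * t * t)) (0≤g u v w)
    pointwise : ∀ u v w → t * t * t * (f₀ u v w - f₁ u v w - f₂ u v w - f₃ u v w) ≤
        α u * (β v * γ w) * (g₁ v w * (g₂ u w * g₃ u v))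
    pointwise u v w = eq-≤ (lemma (t * t * t) (α u) (β v) (γ w) (b₁ v w) (b₂ u w) (b₃ u v))
      (*-monoˡ (0≤a*b (0≤𝟙 (π u == a)) (0≤a*b (0≤𝟙 (π v == b)) (0≤𝟙 (π w == c))))
          (cube u v w (g₁ v w <? t) (g₂ u w <? t) (g₃ u v <? t)))
      where
      lemma : ∀ s a b c x y z → s * (a * (b * c) - a * (b * c * x) - b * (a * c * y) - c * (a * b * z)) ≡
          a * (b * c) * (s * (1ℚ - x - y - z))
      lemma = RingSolver.solve-∀ ℚ-ring

opaque
  inv : ℕ → ℚ
  inv m = (1/ ℕ⇒ℚ (suc m)) ⦃ >-nonZero (0<ℕ⇒ℚ (suc m)) ⦄

  inv-cancel : ∀ m → inv m * ℕ⇒ℚ (suc m) ≡ 1ℚ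
  inv-cancel m = *-inverseˡ (ℕ⇒ℚ (suc m)) ⦃ >-nonZero (0<ℕ⇒ℚ (suc m)) ⦄

  0<inv : ∀ m → 0ℚ < inv m
  0<inv m = positive⁻¹ (inv m) ⦃ 1/pos⇒pos (ℕ⇒ℚ (suc m)) ⦃ positive (0<ℕ⇒ℚ (suc m)) ⦄ ⦄

m*inv≤1 : ∀ m → ℕ⇒ℚ m * inv m ≤ 1ℚ
m*inv≤1 m = ≤-eq (*-monoʳ (<⇒≤ (0<inv m)) (ℕ⇒ℚ-mono (ℕ.n≤1+n m)))
    (trans (*-comm (ℕ⇒ℚ (suc m)) (inv m)) (inv-cancel m))

inv≤1 : ∀ m → inv m ≤ 1ℚ
inv≤1 m = eq-≤ (sym (*-identityʳ (inv m))) (≤-eq (*-monoˡ (<⇒≤ (0<inv m))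
    (ℕ⇒ℚ-mono {1} {suc m} (ℕ.s≤s ℕ.z≤n))) (inv-cancel m))

0<⊓ : ∀ {a b} → 0ℚ < a → 0ℚ < b → 0ℚ < a ⊓ b
0<⊓ {a} {b} p q = pick (⊓-sel a b)
  where
  pick : a ⊓ b ≡ a ⊎ a ⊓ b ≡ b → 0ℚ < a ⊓ b
  pick (inj₁ e) = <-eq p (sym e)
  pick (inj₂ e) = <-eq q (sym e)

energy≤ : ∀ {n} (F g : Fin n → Fin n → ℚ) → (∀ x y → Unit (F x y)) → (∀ x y → Unit (g x y)) → energy F g ≤
    ℕ⇒ℚ n * ℕ⇒ℚ n
energy≤ {n} F g UF Ug = ≤-eq (≤-eq (∑∑-mono (λ x y → pointwise (UF x y) (Ug x y))) (∑∑-const n n 1ℚ))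
    (*-identityʳ _)
  where
  pointwise : ∀ {a b} → Unit a → Unit b → (a - b) * (a - b) ≤ 1ℚ
  pointwise {a} {b} (0≤a , a≤1) (0≤b , b≤1) = ≤-by-diff
    (0≤a*b (0≤a+b (diff-nonNeg a≤1) 0≤b) (0≤a+b (diff-nonNeg b≤1) 0≤a)) (lemma a b)
    where
    lemma : ∀ a b → 1ℚ - (a - b) * (a - b) ≡ ((1ℚ - a) + b) * ((1ℚ - b) + a)
    lemma = RingSolver.solve-∀ ℚ-ring

-- Strong regularity and the removal argument

module TriangleRemoval (q : ℕ) where
  -- `t` is the inverse of a natural number, which makes `ν = 1/t` explicit. With `κ = t³/16` the L²
  -- terms of the bad-edge bound become `νκ = t²/16` and `8ν²κ = t/2`.
  t ν κ : ℚ
  t = inv q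
  ν = ℕ⇒ℚ (suc q)
  κ = t * t * t * (+ 1 / 16)

  0<t : 0ℚ < t
  0<t = 0<inv q

  0≤t : 0ℚ ≤ t
  0≤t = <⇒≤ 0<t

  0<t³ : 0ℚ < t * t * t
  0<t³ = 0<a*b (0<a*b 0<t 0<t) 0<t

  0<κ/4 : 0ℚ < κ * (+ 1 / 4)
  0<κ/4 = 0<a*b (0<a*b 0<t³ (positive⁻¹ (+ 1 / 16))) (positive⁻¹ (+ 1 / 4))

  -- For a partition into M cells: `τ` is the relative size below which a cell is small, and all
  -- small cells together hold at most a share `t`. `s` is `t³` times the relative volume of three
  -- cells of that size. `η` controls the bad edges (`Mη ≤ t`) and the counting error (`3η ≤ s/8`).
  -- `δ` is `(5/8 - 1/8)s`.
  τ s η δ : ℕ → ℚ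
  τ M = t * inv M
  s M = t * t * t * (τ M * τ M * τ M)
  η M = τ M ⊓ (s M * (+ 1 / 24))
  δ M = ½ * s M

  0<τ : ∀ M → 0ℚ < τ M
  0<τ M = 0<a*b 0<t (0<inv M)

  0<s : ∀ M → 0ℚ < s M
  0<s M = 0<a*b 0<t³ (0<a*b (0<a*b (0<τ M) (0<τ M)) (0<τ M))

  0<η : ∀ M → 0ℚ < η M
  0<η M = 0<⊓ (0<τ M) (0<a*b (0<s M) (positive⁻¹ (+ 1 / 24)))

  M*τ≤t : ∀ M → ℕ⇒ℚ M * τ M ≤ t
  M*τ≤t M = eq-≤ (lemma (ℕ⇒ℚ M) t (inv M)) (≤-eq (*-monoˡ 0≤t (m*inv≤1 M)) (*-identityʳ t))
    where
    lemma : ∀ m t i → m * (t * i) ≡ t * (m * i)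
    lemma = RingSolver.solve-∀ ℚ-ring

  -- The 3 is the largest possible total energy in units of `N²`: three edge functions, all values
  -- in [0,1].
  weakFuel : ℕ → ℕ
  weakFuel M = proj₁ (archimedean′ (ℕ⇒ℚ 3) (0<a*b (0<η M) (0<η M)))

  fuel : ℕ
  fuel = proj₁ (archimedean′ (ℕ⇒ℚ 3) 0<κ/4)

  -- The iteration may stop in any round, but the number of cells in each round is known in advance;
  -- the minimum over the rounds is a bound free of the graph.
  δmin : ℕ → ℕ → ℚ
  δmin zero    M = δ M
  δmin (suc j) M = δ M ⊓ δmin j (cells (weakFuel M) M)

  0<δmin : ∀ j M → 0ℚ < δmin j M
  0<δmin zero    M = 0<a*b (positive⁻¹ ½) (0<s M)
  0<δmin (suc j) M = 0<⊓ (0<a*b (positive⁻¹ ½) (0<s M)) (0<δmin j _)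

  δmin≤δ : ∀ j M → δmin j M ≤ δ M
  δmin≤δ zero    M = ≤-refl
  δmin≤δ (suc j) M = p⊓q≤p (δ M) (δmin j (cells (weakFuel M) M))

  -- The vertex set is three copies of `Fin n`, and the marked triangles are `u, v, third u v`. The
  -- `reindex` hypotheses express that they are edge-disjoint: as (u, v) varies, each of the other
  -- two sides runs through all pairs exactly once.
  module Graph {n : ℕ} (0<n : 0ℚ < ℕ⇒ℚ n) (E : Fin 3 → Fin n → Fin n → Bool) (third : Fin n → Fin n → Fin n)
    (edge₁ : ∀ u v → E (suc (suc zero)) u v ≡ true → E zero v (third u v) ≡ true)
    (edge₂ : ∀ u v → E (suc (suc zero)) u v ≡ true → E (suc zero) u (third u v) ≡ true)
    (reindex₁ : ∀ f → ∑∑ (λ u v → f v (third u v)) ≡ ∑∑ f)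
    (reindex₂ : ∀ f → ∑∑ (λ u v → f u (third u v)) ≡ ∑∑ f)
    (many : ℕ⇒ℚ n * ℕ⇒ℚ n * (ℕ⇒ℚ 32 * t) ≤ ∑∑ (λ u v → 𝟙 (E (suc (suc zero)) u v))) where

    N N² : ℚ
    N  = ℕ⇒ℚ n
    N² = N * N

    0≤N² : 0ℚ ≤ N²
    0≤N² = 0≤a² N

    F : Fin 3 → Fin n → Fin n → ℚ
    F i x y = 𝟙 (E i x y)

    F-Unit : ∀ i x y → Unit (F i x y)
    F-Unit i x y = Unit-𝟙 (E i x y)

    open Regularity F F-Unit
    open Refinement

    F₁ F₂ F₃ : Fin n → Fin n → ℚ
    F₁ = F zero
    F₂ = F (suc zero)
    F₃ = F (suc (suc zero))

    triangles : ℚ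
    triangles = ∑₃ λ u v w → F₁ v w * (F₂ u w * F₃ u v)

    -- The error `N²η(M)` must be small against products of cells of the coarse partition `π`, so
    -- the uniform approximant `g` lives on a refinement. Cells are still judged on `π`, and L²
    -- closeness to the coarse `G` mediates between the two.
    module Good {M M′} (π : Fin n → Fin M) (G : Approximant M) (R : Refinement π G M′)
                (uniform : ∀ i → Uniform (F i) (lift (π′ R) (G′ R i)) (N² * η M))
                (close : ∀ i → energy (lift π (G i)) (lift (π′ R) (G′ R i)) ≤ N² * κ) where
      open Cells π t

      g : Fin 3 → Fin n → Fin n → ℚ
      g i = lift (π′ R) (G′ R i)

      g-Unit : ∀ i x y → Unit (g i x y)
      g-Unit i x y = G′-Unit R i (π′ R x) (π′ R y)

      σ : ℚ
      σ = τ M * N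

      0≤σ : 0ℚ ≤ σ
      0≤σ = 0≤a*b (<⇒≤ (0<τ M)) (<⇒≤ 0<n)

      small : Fin n → Bool
      small x = does (size π (π x) <? σ)

      ∑-small : ∑ (λ x → 𝟙 (small x)) ≤ N * t
      ∑-small = begin
        ∑ (λ x → 𝟙 (small x))                              ≡⟨ ∑-by-cells π (λ a → 𝟙 (does (size π a <? σ))) ⟩
        ∑ (λ a → size π a * 𝟙 (does (size π a <? σ)))      ≤⟨ ∑-≤-const (λ a → pointwise (size π a <? σ)) ⟩
        ℕ⇒ℚ M * (τ M * N)                                  ≡⟨ lemma (ℕ⇒ℚ M) (τ M) N ⟩
        N * (ℕ⇒ℚ M * τ M)                                  ≤⟨ *-monoˡ (<⇒≤ 0<n) (M*τ≤t M) ⟩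
        N * t                                              ∎
        where
        open ≤-Reasoning
        lemma : ∀ m a n → m * (a * n) ≡ n * (m * a)
        lemma = RingSolver.solve-∀ ℚ-ring
        pointwise : ∀ {a} (d : Dec (a < σ)) → a * 𝟙 (does d) ≤ σ
        pointwise {a} (yes p) = eq-≤ (*-identityʳ a) (<⇒≤ p)
        pointwise {a} (no _)  = eq-≤ (*-zeroʳ a) 0≤σ

      badEdge : Fin 3 → Fin n → Fin n → ℚ
      badEdge i x y = F i x y * 𝟙 (bad (g i) (π x) (π y))

      -- In units of `N²` the terms are at most `t`, `t²/16`, `3t` and `t/2`; hence the 5.
      ∑∑-badEdge : ∀ i → ∑∑ (badEdge i) ≤ N² * (ℕ⇒ℚ 5 * t)
      ∑∑-badEdge i = ≤-trans (BadEdges.∑∑-bad-edges ν 0<t (inv-cancel q) (0≤ℕ⇒ℚ (suc q)) (F i) (g i)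
          (F-Unit i) (G i) (N² * η M) (N² * κ) (proj₁ (uniform i)) (close i))
        (begin
        ℕ⇒ℚ M * (N² * η M) + (ν * (N² * κ) + N² * (t + t + t)) + ℕ⇒ℚ 8 * (ν * ν) * (N² * κ)
          ≡⟨ lemma (ℕ⇒ℚ M) N² (η M) t ν ⟩
        N² * (ℕ⇒ℚ M * η M + t * ν * (t * t) * (+ 1 / 16) + (t + t + t) + t * ν * (t * ν) * t * ½)
          ≡⟨ cong (λ z → N² * (ℕ⇒ℚ M * η M + z * (t * t) * (+ 1 / 16) + (t + t + t) + z * z * t * ½))
              (inv-cancel q) ⟩
        N² * (ℕ⇒ℚ M * η M + 1ℚ * (t * t) * (+ 1 / 16) + (t + t + t) + 1ℚ * 1ℚ * t * ½)
          ≤⟨ *-monoˡ 0≤N² (≤-by-diff (0≤a+b (0≤a+b (diff-nonNeg Mη≤t)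
              (0≤a*b (nonNegative⁻¹ (+ 1 / 16)) (0≤a*b 0≤t (diff-nonNeg (inv≤1 q)))))
              (0≤a*b (nonNegative⁻¹ (+ 7 / 16)) 0≤t)) (collect (ℕ⇒ℚ M * η M) t)) ⟩
        N² * (ℕ⇒ℚ 5 * t) ∎)
        where
        open ≤-Reasoning
        Mη≤t : ℕ⇒ℚ M * η M ≤ t
        Mη≤t = ≤-trans (*-monoˡ (0≤ℕ⇒ℚ M) (p⊓q≤p (τ M) (s M * (+ 1 / 24)))) (M*τ≤t M)
        lemma : ∀ m N² η t ν → m * (N² * η) + (ν * (N² * (t * t * t * (+ 1 / 16))) + N² * (t + t + t)) +
            (+ 8 / 1) * (ν * ν) * (N² * (t * t * t * (+ 1 / 16))) ≡
                N² * (m * η + t * ν * (t * t) * (+ 1 / 16) + (t + t + t) + t * ν * (t * ν) * t * ½)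
        lemma = RingSolver.solve-∀ ℚ-ring
        collect : ∀ m t → (+ 5 / 1) * t - (m + 1ℚ * (t * t) * (+ 1 / 16) + (t + t + t) + 1ℚ * 1ℚ * t * ½) ≡
            (t - m) + (+ 1 / 16) * (t * (1ℚ - t)) + (+ 7 / 16) * t
        collect = RingSolver.solve-∀ ℚ-ring

      -- The reasons for discarding a marked triangle: small cells at its three vertices, costing
      -- `3t` in total, and bad pairs at its three sides, costing `15t`. Against these 18 the 32 of
      -- `many` leaves room.
      removed : Fin n → Fin n → ℚ
      removed u v = 𝟙 (small u) + 𝟙 (small v) + 𝟙 (small (third u v)) +
        (badEdge zero v (third u v) + badEdge (suc zero) u (third u v) + badEdge (suc (suc zero)) u v)

      ∑∑-removed : ∑∑ removed ≤ N² * (ℕ⇒ℚ 18 * t)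
      ∑∑-removed = begin
        ∑∑ removed
          ≡⟨ trans (∑∑-distrib-+ _ _) (cong₂ _+_ (trans (∑∑-distrib-+ _ _)
              (cong₂ _+_ (trans (∑∑-distrib-+ _ _) (cong₂ _+_ sum-u sum-v))
              (trans (reindex₁ (λ _ w → 𝟙 (small w))) sum-v)))
               (trans (∑∑-distrib-+ _ _) (cong₂ _+_ (trans (∑∑-distrib-+ _ _)
                   (cong₂ _+_ (reindex₁ (badEdge zero)) (reindex₂ (badEdge (suc zero))))) refl))) ⟩
        N * S + N * S + N * S + (∑∑ (badEdge zero) + ∑∑ (badEdge (suc zero)) + ∑∑ (badEdge (suc (suc zero))))
          ≤⟨ +-mono-≤ (+-mono-≤ (+-mono-≤ bound bound) bound)
              (+-mono-≤ (+-mono-≤ (∑∑-badEdge zero) (∑∑-badEdge (suc zero))) (∑∑-badEdge (suc (suc zero)))) ⟩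
        N * (N * t) + N * (N * t) + N * (N * t) + (N² * (ℕ⇒ℚ 5 * t) + N² * (ℕ⇒ℚ 5 * t) + N² * (ℕ⇒ℚ 5 * t))
          ≡⟨ lemma N t ⟩
        N² * (ℕ⇒ℚ 18 * t) ∎
        where
        open ≤-Reasoning
        S = ∑ (λ x → 𝟙 (small x))
        sum-u : ∑∑ {n} {n} (λ u v → 𝟙 (small u)) ≡ N * S
        sum-u = trans (∑-cong (λ u → ∑-const n (𝟙 (small u)))) (sym (*-distribˡ-∑ N _))
        sum-v : ∑∑ {n} {n} (λ u v → 𝟙 (small v)) ≡ N * S
        sum-v = ∑-const n S
        bound : N * S ≤ N * (N * t)
        bound = *-monoˡ (<⇒≤ 0<n) ∑-small
        lemma : ∀ n t → n * (n * t) + n * (n * t) + n * (n * t) +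
            (n * n * ((+ 5 / 1) * t) + n * n * ((+ 5 / 1) * t) + n * n * ((+ 5 / 1) * t)) ≡
            n * n * ((+ 18 / 1) * t)
        lemma = RingSolver.solve-∀ ℚ-ring

      removed<many : ∑∑ removed < ∑∑ F₃
      removed<many = ≤-<-trans ∑∑-removed (<-≤-trans (<-by-diff
          (<-eq (0<a*b (0<a*b 0<n 0<n) (0<a*b (positive⁻¹ (+ 14 / 1)) 0<t)) (sym (lemma N² t)))) many)
        where
        lemma : ∀ m t → m * ((+ 32 / 1) * t) - m * ((+ 18 / 1) * t) ≡ m * ((+ 14 / 1) * t)
        lemma = RingSolver.solve-∀ ℚ-ring

      survivor : ∃₂ λ u v → removed u v < F₃ u v
      survivor = proj₁ row , ∑-<⇒∃ _ _ (proj₂ row)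
        where row = ∑-<⇒∃ _ _ removed<many

      -- At the surviving triangle every summand of `removed` is 0 or 1 and their sum is below 1, so
      -- all vanish. What the survivor certifies is its trio of cells: all large, no pair bad. These
      -- three cells alone contain enough triangles.
      conclude : N * N² * δ M ≤ triangles
      conclude = final
        where
        u = proj₁ survivor
        v = proj₁ (proj₂ survivor)
        w = third u v
        survives = proj₂ (proj₂ survivor)
        a = π u
        b = π v
        c = π w
        0≤bad : ∀ i x y → 0ℚ ≤ badEdge i x y
        0≤bad i x y = 0≤a*b (0≤𝟙 (E i x y)) (0≤𝟙 (bad (g i) (π x) (π y)))
        s₁ = 𝟙 (small u)
        s₂ = 𝟙 (small v)
        s₃ = 𝟙 (small w)
        b₁ = badEdge zero v w
        b₂ = badEdge (suc zero) u w
        b₃ = badEdge (suc (suc zero)) u v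
        0≤s₁ : 0ℚ ≤ s₁
        0≤s₁ = 0≤𝟙 (small u)
        0≤s₂ : 0ℚ ≤ s₂
        0≤s₂ = 0≤𝟙 (small v)
        0≤s₃ : 0ℚ ≤ s₃
        0≤s₃ = 0≤𝟙 (small w)
        0≤b₁ = 0≤bad zero v w
        0≤b₂ = 0≤bad (suc zero) u w
        0≤b₃ = 0≤bad (suc (suc zero)) u v
        edge₃ : E (suc (suc zero)) u v ≡ true
        edge₃ = 0<𝟙⇒true (≤-<-trans (0≤a+b (0≤a+b (0≤a+b 0≤s₁ 0≤s₂) 0≤s₃) (0≤a+b (0≤a+b 0≤b₁ 0≤b₂) 0≤b₃))
            survives)
        removed<1 : removed u v < 1ℚ
        removed<1 = <-≤-trans survives (𝟙≤1 (E (suc (suc zero)) u v))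
        less-than-1 : ∀ {x} {y} → x ≤ removed u v → x ≡ 𝟙 y → y ≡ false
        less-than-1 {x} {false} p e = refl
        less-than-1 {x} {true}  p e = contradiction (≤-<-trans (eq-≤ (sym e) p) removed<1) (<-irrefl refl)
        edge*bad : ∀ {e} {z} → e ≡ true → 𝟙 e * z ≡ z
        edge*bad {z = z} refl = *-identityˡ z
        not-small : ∀ {x} → small x ≡ false → σ ≤ size π (π x)
        not-small {x} e = ≮⇒≥ (does-false (size π (π x) <? σ) e)
        not-bad : ∀ i {x y} → bad (g i) (π x) (π y) ≡ false → ℕ⇒ℚ 8 * lowCount (g i) (π x) (π y) ≤
            size π (π x) * size π (π y)
        not-bad i {x} {y} e = ≮⇒≥ (does-false (size π (π x) * size π (π y) <? ℕ⇒ℚ 8 * lowCount (g i) (π x)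
            (π y)) e)
        σ≤a : σ ≤ size π a
        σ≤a = not-small (less-than-1 (≤-by-diff (0≤a+b (0≤a+b 0≤s₂ 0≤s₃) (0≤a+b (0≤a+b 0≤b₁ 0≤b₂) 0≤b₃))
            (lemma s₁ s₂ s₃ (b₁ + b₂ + b₃))) refl)
          where
          lemma : ∀ a b c d → a + b + c + d - a ≡ b + c + d
          lemma = RingSolver.solve-∀ ℚ-ring
        σ≤b : σ ≤ size π b
        σ≤b = not-small (less-than-1 (≤-by-diff (0≤a+b (0≤a+b 0≤s₁ 0≤s₃) (0≤a+b (0≤a+b 0≤b₁ 0≤b₂) 0≤b₃))
            (lemma s₁ s₂ s₃ (b₁ + b₂ + b₃))) refl)
          where
          lemma : ∀ a b c d → a + b + c + d - b ≡ a + c + d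
          lemma = RingSolver.solve-∀ ℚ-ring
        σ≤c : σ ≤ size π c
        σ≤c = not-small (less-than-1 (≤-by-diff (0≤a+b (0≤a+b 0≤s₁ 0≤s₂) (0≤a+b (0≤a+b 0≤b₁ 0≤b₂) 0≤b₃))
            (lemma s₁ s₂ s₃ (b₁ + b₂ + b₃))) refl)
          where
          lemma : ∀ a b c d → a + b + c + d - c ≡ a + b + d
          lemma = RingSolver.solve-∀ ℚ-ring
        good₁ : ℕ⇒ℚ 8 * lowCount (g zero) b c ≤ size π b * size π c
        good₁ = not-bad zero (less-than-1 (≤-by-diff (0≤a+b (0≤a+b (0≤a+b 0≤s₁ 0≤s₂) 0≤s₃) (0≤a+b 0≤b₂ 0≤b₃))
            (lemma (s₁ + s₂ + s₃) b₁ b₂ b₃)) (edge*bad (edge₁ u v edge₃)))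
          where
          lemma : ∀ d a b c → d + (a + b + c) - a ≡ d + (b + c)
          lemma = RingSolver.solve-∀ ℚ-ring
        good₂ : ℕ⇒ℚ 8 * lowCount (g (suc zero)) a c ≤ size π a * size π c
        good₂ = not-bad (suc zero) (less-than-1 (≤-by-diff (0≤a+b (0≤a+b (0≤a+b 0≤s₁ 0≤s₂) 0≤s₃)
            (0≤a+b 0≤b₁ 0≤b₃)) (lemma (s₁ + s₂ + s₃) b₁ b₂ b₃)) (edge*bad (edge₂ u v edge₃)))
          where
          lemma : ∀ d a b c → d + (a + b + c) - b ≡ d + (a + c)
          lemma = RingSolver.solve-∀ ℚ-ring
        good₃ : ℕ⇒ℚ 8 * lowCount (g (suc (suc zero))) a b ≤ size π a * size π b
        good₃ = not-bad (suc (suc zero)) (less-than-1 (≤-by-diff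
            (0≤a+b (0≤a+b (0≤a+b 0≤s₁ 0≤s₂) 0≤s₃) (0≤a+b 0≤b₁ 0≤b₂)) (lemma (s₁ + s₂ + s₃) b₁ b₂ b₃))
            (edge*bad edge₃))
          where
          lemma : ∀ d a b c → d + (a + b + c) - c ≡ d + (a + b)
          lemma = RingSolver.solve-∀ ℚ-ring
        α β γ : Fin n → ℚ
        α x = 𝟙 (π x == a)
        β x = 𝟙 (π x == b)
        γ x = 𝟙 (π x == c)
        X₀ X₃ ρ Nβ : ℚ
        X₀ = ∑₃ (λ u v w → α u * (β v * γ w) * (F₁ v w * (F₂ u w * F₃ u v)))
        X₃ = ∑₃ (λ u v w → α u * (β v * γ w) * (g zero v w * (g (suc zero) u w * g (suc (suc zero)) u v)))
        ρ  = size π a * (size π b * size π c) - size π a * lowCount (g zero) b c - size π b * lowCount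
            (g (suc zero)) a c - size π c * lowCount (g (suc (suc zero))) a b
        Nβ = N * (N² * η M)
        restrict : X₀ ≤ triangles
        restrict = ∑₃-mono (λ u v w → ≤-eq (*-monoʳ (0≤a*b (0≤𝟙 (E zero v w))
            (0≤a*b (0≤𝟙 (E (suc zero) u w)) (0≤𝟙 (E (suc (suc zero)) u v))))
          (proj₂ (Unit-* (Unit-𝟙 (π u == a)) (Unit-* (Unit-𝟙 (π v == b)) (Unit-𝟙 (π w == c))))))
              (*-identityˡ _))
        replace : X₃ ≤ X₀ + (Nβ + Nβ + Nβ)
        replace = triangle-counting F₁ F₂ F₃ (g zero) (g (suc zero)) (g (suc (suc zero))) (F-Unit (suc zero))
            (F-Unit (suc (suc zero))) (g-Unit zero) (g-Unit (suc zero))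
          (proj₂ (uniform zero)) (proj₂ (uniform (suc zero))) (proj₂ (uniform (suc (suc zero)))) α β γ
          (λ x → Unit-𝟙 (π x == a)) (λ x → Unit-𝟙 (π x == b)) (λ x → Unit-𝟙 (π x == c))
        dense : t * t * t * ρ ≤ X₃
        dense = dense-cells π t 0≤t (g zero) (g (suc zero)) (g (suc (suc zero)))
            (λ x y → proj₁ (g-Unit zero x y)) (λ x y → proj₁ (g-Unit (suc zero) x y))
            (λ x y → proj₁ (g-Unit (suc (suc zero)) x y)) a b c
        cells-large : σ * (σ * σ) ≤ size π a * (size π b * size π c)
        cells-large = *-mono 0≤σ (0≤a*b (size-nonNeg π b) (size-nonNeg π c)) σ≤a
            (*-mono 0≤σ (size-nonNeg π c) σ≤b σ≤c)
        ρ-large : (+ 5 / 8) * (size π a * (size π b * size π c)) ≤ ρ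
        ρ-large = ≤-by-diff (0≤a*b (nonNegative⁻¹ (+ 1 / 8)) (0≤a+b
            (0≤a+b (0≤a*b (size-nonNeg π a) (diff-nonNeg good₁))
            (0≤a*b (size-nonNeg π b) (diff-nonNeg good₂))) (0≤a*b (size-nonNeg π c) (diff-nonNeg good₃))))
          (lemma (size π a) (size π b) (size π c) (lowCount (g zero) b c) (lowCount (g (suc zero)) a c)
              (lowCount (g (suc (suc zero))) a b))
          where
          lemma : ∀ a b c x y z → a * (b * c) - a * x - b * y - c * z - (+ 5 / 8) * (a * (b * c)) ≡
                  (+ 1 / 8) * (a * (b * c - (+ 8 / 1) * x) + b * (a * c - (+ 8 / 1) * y) + c *
                      (a * b - (+ 8 / 1) * z))
          lemma = RingSolver.solve-∀ ℚ-ring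
        main-term : t * t * t * ((+ 5 / 8) * (σ * (σ * σ))) ≤ t * t * t * ρ
        main-term = *-monoˡ (<⇒≤ 0<t³) (≤-trans (*-monoˡ (nonNegative⁻¹ (+ 5 / 8)) cells-large) ρ-large)
        η-small : 0ℚ ≤ N * N² * (ℕ⇒ℚ 3 * (s M * (+ 1 / 24) - η M))
        η-small = 0≤a*b (0≤a*b (<⇒≤ 0<n) 0≤N²) (0≤a*b (0≤ℕ⇒ℚ 3)
            (diff-nonNeg (p⊓q≤q (τ M) (s M * (+ 1 / 24)))))
        -- In units of `N³`: `5/8` of `s`, less three counting errors of at most `s/24` each, leaves
        -- `s/2`.
        final : N * N² * δ M ≤ triangles
        final = ≤-by-diff (0≤a+b (0≤a+b (0≤a+b (diff-nonNeg restrict) (diff-nonNeg replace))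
            (0≤a+b (diff-nonNeg dense) (diff-nonNeg main-term))) η-small)
          (collect triangles X₀ X₃ ρ N (η M) t (τ M))
          where
          collect : ∀ T X₀ X₃ ρ N η t τ → T - N * (N * N) * (½ * (t * t * t * (τ * τ * τ))) ≡
            (T - X₀) + (X₀ + (N * (N * N * η) + N * (N * N * η) + N * (N * N * η)) - X₃) +
            ((X₃ - t * t * t * ρ) + (t * t * t * ρ - t * t * t * ((+ 5 / 8) * (τ * N * (τ * N * (τ * N)))))) +
            N * (N * N) * ((+ 3 / 1) * (t * t * t * (τ * τ * τ) * (+ 1 / 24) - η))
          collect = RingSolver.solve-∀ ℚ-ring

    gain : ℚ
    gain = N² * (κ * (+ 1 / 4))

    0<gain : 0ℚ < gain
    0<gain = 0<a*b (0<a*b 0<n 0<n) 0<κ/4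

    totalEnergy≤ : ∀ {M} (π : Fin n → Fin M) G → AllUnit G → ∀ j c → ℕ⇒ℚ 3 ≤ ℕ⇒ℚ j * c → totalEnergy π G ≤
        ℕ⇒ℚ j * (N² * c)
    totalEnergy≤ π G G-Unit j c p = begin
      totalEnergy π G      ≤⟨ ∑-≤-const (λ i →
          energy≤ (F i) (lift π (G i)) (F-Unit i) (λ x y → G-Unit i (π x) (π y))) ⟩
      ℕ⇒ℚ 3 * N²           ≤⟨ *-monoʳ 0≤N² p ⟩
      ℕ⇒ℚ j * c * N²       ≡⟨ lemma (ℕ⇒ℚ j) c N² ⟩
      ℕ⇒ℚ j * (N² * c)     ∎
      where
      open ≤-Reasoning
      lemma : ∀ j c m → j * c * m ≡ j * (m * c)
      lemma = RingSolver.solve-∀ ℚ-ring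

    -- By the parallelogram law the midpoint of g and g′ has smaller energy than g, unless g and g′ are close.
    module Midpoint {M M′} (π : Fin n → Fin M) (G : Approximant M) (G-Unit : AllUnit G)
        (R : Refinement π G M′)
                    (i : Fin 3) (far : N² * κ < energy (lift π (G i)) (lift (π′ R) (G′ R i))) where
      old mid : Approximant M′
      old k a b = G k (coarsen R a) (coarsen R b)
      mid k a b = ½ * (old k a b + G′ R k a b)

      Gₘ : Approximant M′
      Gₘ k = if does (k Fin.≟ i) then mid k else old k

      old-Unit : AllUnit old
      old-Unit k a b = G-Unit k (coarsen R a) (coarsen R b)

      Gₘ-Unit : AllUnit Gₘ
      Gₘ-Unit k a b = pick (does (k Fin.≟ i))
        where
        pick : ∀ z → Unit ((if z then mid k else old k) a b)
        pick true  = 0≤a*b (nonNegative⁻¹ ½) (0≤a+b (proj₁ (old-Unit k a b)) (proj₁ (G′-Unit R k a b))) ,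
                     *-monoˡ (nonNegative⁻¹ ½) (+-mono-≤ (proj₂ (old-Unit k a b)) (proj₂ (G′-Unit R k a b)))
        pick false = old-Unit k a b

      lift-old : ∀ k x y → lift (π′ R) (old k) x y ≡ lift π (G k) x y
      lift-old k x y = cong₂ (G k) (π≡coarsen R x) (π≡coarsen R y)

      energy-old : ∀ k → energy (F k) (lift (π′ R) (old k)) ≡ energyAt π G k
      energy-old k = energy-cong (F k) (lift-old k)

      energy-mid : energy (F i) (lift (π′ R) (mid i)) + gain ≤ energyAt π G i
      energy-mid = begin
        energy (F i) (lift (π′ R) (mid i)) + gain
          ≡⟨ cong (_+ gain) (trans (∑∑-cong (λ x y →
              trans (cong (λ z → (F i x y - ½ * (z + h x y)) * (F i x y - ½ * (z + h x y))) (lift-old i x y))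
              (parallelogram (F i x y) (g x y) (h x y))))
               (trans (∑∑-distrib-- _ _) (cong₂ _-_ (trans (sym (*-distribˡ-∑∑ ½ _))
                   (cong (½ *_) (∑∑-distrib-+ _ _))) (sym (*-distribˡ-∑∑ (+ 1 / 4) _))))) ⟩
        ½ * (energy (F i) g + energy (F i) h) - (+ 1 / 4) * energy g h + gain
          ≤⟨ ≤-by-diff (0≤a+b (0≤a*b (nonNegative⁻¹ ½) (diff-nonNeg (energy-≤ R i)))
              (0≤a*b (nonNegative⁻¹ (+ 1 / 4)) (diff-nonNeg (<⇒≤ far))))
              (collect (energy (F i) g) (energy (F i) h) (energy g h) N² κ) ⟩
        energy (F i) g ∎
        where
        open ≤-Reasoning
        g h : Fin n → Fin n → ℚ
        g = lift π (G i)
        h = lift (π′ R) (G′ R i)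
        parallelogram : ∀ f g h → (f - ½ * (g + h)) * (f - ½ * (g + h)) ≡
            ½ * ((f - g) * (f - g) + (f - h) * (f - h)) - (+ 1 / 4) * ((g - h) * (g - h))
        parallelogram = RingSolver.solve-∀ ℚ-ring
        collect : ∀ e e′ d m κ → e - (½ * (e + e′) - (+ 1 / 4) * d + m * (κ * (+ 1 / 4))) ≡
            ½ * (e - e′) + (+ 1 / 4) * (d - m * κ)
        collect = RingSolver.solve-∀ ℚ-ring

      total-decreases : totalEnergy (π′ R) Gₘ + gain ≤ totalEnergy π G
      total-decreases = ∑-mono-gain (λ k → mono k (k Fin.≟ i)) i
        (eq-≤ (cong (λ z → energy (F i) (lift (π′ R) (if z then mid i else old i)) + gain)
            (dec-true (i Fin.≟ i) refl)) energy-mid)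
        where
        mono : ∀ k (d : Dec (k ≡ i)) → energy (F k) (lift (π′ R) (if does d then mid k else old k)) ≤
            energyAt π G k
        mono k (yes refl) = ≤-trans (eq-≤ (sym (+-identityʳ _))
            (+-monoʳ-≤ (energy (F k) (lift (π′ R) (mid k))) (<⇒≤ 0<gain))) energy-mid
        mono k (no _)     = ≤-reflexive (energy-old k)

    -- As long as the coarse and the fine approximant are far apart, the next round starts on the
    -- refined partition with their midpoint and has lost `gain` of the total energy.
    iterate : ∀ j {M} (π : Fin n → Fin M) (G : Approximant M) → AllUnit G → totalEnergy π G ≤ ℕ⇒ℚ j * gain →
              N * N² * δmin j M ≤ triangles
    iterate j {M} π G G-Unit E≤ = decide j E≤ (∀⊎∃ closeness)
      where
      open Weak (η M) (0<η M) 0<n using (weak-regularity)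
      regular = weak-regularity (weakFuel M) π G G-Unit
        (totalEnergy≤ π G G-Unit (weakFuel M) (η M * η M) (proj₂
            (archimedean′ (ℕ⇒ℚ 3) (0<a*b (0<η M) (0<η M)))))
      R = proj₁ regular
      distance : Fin 3 → ℚ
      distance i = energy (lift π (G i)) (lift (π′ R) (G′ R i))
      closeness : ∀ i → distance i ≤ N² * κ ⊎ N² * κ < distance i
      closeness i = cases (distance i ≤? N² * κ)
        where
        cases : Dec (distance i ≤ N² * κ) → distance i ≤ N² * κ ⊎ N² * κ < distance i
        cases (yes p) = inj₁ p
        cases (no p)  = inj₂ (≰⇒> p)
      decide : ∀ j → totalEnergy π G ≤ ℕ⇒ℚ j * gain →
          (∀ i → distance i ≤ N² * κ) ⊎ (∃ λ i → N² * κ < distance i) → N * N² * δmin j M ≤ triangles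
      decide j _ (inj₁ close) = ≤-trans (*-monoˡ (0≤a*b (<⇒≤ 0<n) 0≤N²) (δmin≤δ j M))
          (Good.conclude π G R (proj₂ regular) close)
      decide zero E≤ (inj₂ (i , far)) = contradiction
        (<-≤-trans 0<gain (≤-trans (eq-≤ (sym (+-identityˡ gain))
            (+-monoˡ-≤ gain (∑-nonNeg (λ k → 0≤energy (F k) (lift (π′ R) (Gₘ k))))))
          (≤-trans total-decreases (≤-eq E≤ (*-zeroˡ gain))))) (<-irrefl refl)
        where open Midpoint π G G-Unit R i far
      decide (suc j) E≤ (inj₂ (i , far)) = ≤-trans (*-monoˡ (0≤a*b (<⇒≤ 0<n) 0≤N²)
          (p⊓q≤q (δ M) (δmin j (cells (weakFuel M) M))))
        (iterate j (π′ R) Gₘ Gₘ-Unit (spend j total-decreases E≤))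
        where open Midpoint π G G-Unit R i far

    removal : N * N² * δmin fuel 1 ≤ triangles
    removal = iterate fuel {1} (λ _ → zero) (λ _ _ _ → 0ℚ) (λ _ _ _ → ≤-refl , 0≤1)
      (totalEnergy≤ {1} (λ _ → zero) (λ _ _ _ → 0ℚ) (λ _ _ _ → ≤-refl , 0≤1) fuel (κ * (+ 1 / 4))
          (proj₂ (archimedean′ (ℕ⇒ℚ 3) 0<κ/4)))

-- Residues modulo p

module Residues (p : ℕ) ⦃ _ : ℕ.NonZero p ⦄ where

  infix 4 _≈_
  record _≈_ (x y : ℤ) : Set where
    constructor mk≈
    field ≈⇒∣ : + p Signed.∣ (x ℤ.- y)

  open _≈_ public

  -- Congruences are proved by certificates: an integer identity that expresses `x - y` through
  -- differences already known to be divisible, left to the ring solver.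
  ≈-by : ∀ {x y a b} k → a ≈ b → x ℤ.- y ≡ k ℤ.* (a ℤ.- b) → x ≈ y
  ≈-by k (mk≈ d) e = mk≈ (subst (+ p Signed.∣_) (sym e) (∣n⇒∣m*n k d))

  ≈-by₂ : ∀ {x y a b c d} k l → a ≈ b → c ≈ d → x ℤ.- y ≡ k ℤ.* (a ℤ.- b) ℤ.+ l ℤ.* (c ℤ.- d) → x ≈ y
  ≈-by₂ k l (mk≈ d) (mk≈ d′) e = mk≈ (subst (+ p Signed.∣_) (sym e) (∣m∣n⇒∣m+n (∣n⇒∣m*n k d) (∣n⇒∣m*n l d′)))

  ≈-reflexive : ∀ {x y} → x ≡ y → x ≈ y
  ≈-reflexive {x} refl = mk≈ (divides 0ℤ (lemma x))
    where
    lemma : ∀ x → x ℤ.- x ≡ 0ℤ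
    lemma = ℤSolver.solve-∀

  ≈-refl : ∀ {x} → x ≈ x
  ≈-refl = ≈-reflexive refl

  ≈-sym : ∀ {x y} → x ≈ y → y ≈ x
  ≈-sym {x} {y} e = ≈-by ℤ.-1ℤ e (lemma x y)
    where
    lemma : ∀ x y → y ℤ.- x ≡ ℤ.-1ℤ ℤ.* (x ℤ.- y)
    lemma = ℤSolver.solve-∀

  ≈-trans : ∀ {x y z} → x ≈ y → y ≈ z → x ≈ z
  ≈-trans {x} {y} {z} e f = ≈-by₂ ℤ.1ℤ ℤ.1ℤ e f (lemma x y z)
    where
    lemma : ∀ x y z → x ℤ.- z ≡ ℤ.1ℤ ℤ.* (x ℤ.- y) ℤ.+ ℤ.1ℤ ℤ.* (y ℤ.- z)
    lemma = ℤSolver.solve-∀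

  +-cong-≈ : ∀ {x y z w} → x ≈ y → z ≈ w → x ℤ.+ z ≈ y ℤ.+ w
  +-cong-≈ {x} {y} {z} {w} e f = ≈-by₂ ℤ.1ℤ ℤ.1ℤ e f (lemma x y z w)
    where
    lemma : ∀ x y z w → x ℤ.+ z ℤ.- (y ℤ.+ w) ≡ ℤ.1ℤ ℤ.* (x ℤ.- y) ℤ.+ ℤ.1ℤ ℤ.* (z ℤ.- w)
    lemma = ℤSolver.solve-∀

  *-congˡ-≈ : ∀ c {x y} → x ≈ y → c ℤ.* x ≈ c ℤ.* y
  *-congˡ-≈ c {x} {y} e = ≈-by c e (lemma c x y)
    where
    lemma : ∀ c x y → c ℤ.* x ℤ.- c ℤ.* y ≡ c ℤ.* (x ℤ.- y)
    lemma = ℤSolver.solve-∀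

  neg-cong-≈ : ∀ {x y} → x ≈ y → ℤ.- x ≈ ℤ.- y
  neg-cong-≈ {x} {y} e = ≈-by ℤ.-1ℤ e (lemma x y)
    where
    lemma : ∀ x y → ℤ.- x ℤ.- ℤ.- y ≡ ℤ.-1ℤ ℤ.* (x ℤ.- y)
    lemma = ℤSolver.solve-∀

  opaque
    red : ℤ → Fin p
    red z = fromℕ< (ℤ.n%ℕd<d z p)

    ι-red : ∀ z → ι (red z) ≈ z
    ι-red z = mk≈ (divides (ℤ.- (z ℤ./ℕ p)) (trans (cong₂ ℤ._-_ (cong +_ (Fin.toℕ-fromℕ< (ℤ.n%ℕd<d z p)))
        (ℤ.a≡a%ℕn+[a/ℕn]*n z p))
      (lemma (+ (z ℤ.%ℕ p)) (z ℤ./ℕ p) (+ p))))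
      where
      lemma : ∀ r q p → r ℤ.- (r ℤ.+ q ℤ.* p) ≡ (ℤ.- q) ℤ.* p
      lemma = ℤSolver.solve-∀

  ι-injective : ∀ {x y : Fin p} → ι x ≈ ι y → x ≡ y
  ι-injective {x} {y} (mk≈ d) = Fin.toℕ-injective (ℤ.+-injective
      (ℤ.i-j≡0⇒i≡j (ι x) (ι y) (ℤ.∣i∣≡0⇒i≡0 zero-diff)))
    where
    small : ℤ.∣ ι x ℤ.- ι y ∣ ℕ.< p
    small = ℕ.≤-<-trans (subst (ℕ._≤ toℕ x ℕ.⊔ toℕ y) (cong ℤ.∣_∣ (sym (ℤ.m-n≡m⊖n (toℕ x) (toℕ y))))
        (ℤ.∣m⊝n∣≤m⊔n (toℕ x) (toℕ y)))
      (ℕ.⊔-lub (Fin.toℕ<n x) (Fin.toℕ<n y))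
    zero-if-small : ∀ m → p ℕ.∣ m → m ℕ.< p → m ≡ 0
    zero-if-small zero    _ _ = refl
    zero-if-small (suc m) d l = contradiction (ℕ.∣⇒≤ d) (ℕ.<⇒≱ l)
    zero-diff : ℤ.∣ ι x ℤ.- ι y ∣ ≡ 0
    zero-diff = zero-if-small _ (∣⇒∣ᵤ d) small

  red-cong : ∀ {x y} → x ≈ y → red x ≡ red y
  red-cong {x} {y} e = ι-injective (≈-trans (ι-red x) (≈-trans e (≈-sym (ι-red y))))

  red-ι : ∀ x → red (ι x) ≡ x
  red-ι x = ι-injective (ι-red (ι x))

  Invertible : ℤ → Set
  Invertible e = ∃ λ i → i ℤ.* e ≈ ℤ.1ℤ

  Invertible-* : ∀ {e f} → Invertible e → Invertible f → Invertible (e ℤ.* f)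
  Invertible-* {e} {f} (i , p) (j , q) = j ℤ.* i , ≈-by₂ (j ℤ.* f) ℤ.1ℤ p q (lemma e f i j)
    where
    lemma : ∀ e f i j → j ℤ.* i ℤ.* (e ℤ.* f) ℤ.- ℤ.1ℤ ≡
        j ℤ.* f ℤ.* (i ℤ.* e ℤ.- ℤ.1ℤ) ℤ.+ ℤ.1ℤ ℤ.* (j ℤ.* f ℤ.- ℤ.1ℤ)
    lemma = ℤSolver.solve-∀

  Invertible-neg : ∀ {e} → Invertible e → Invertible (ℤ.- e)
  Invertible-neg {e} (i , p) = ℤ.- i , ≈-by ℤ.1ℤ p (lemma e i)
    where
    lemma : ∀ e i → (ℤ.- i) ℤ.* (ℤ.- e) ℤ.- ℤ.1ℤ ≡ ℤ.1ℤ ℤ.* (i ℤ.* e ℤ.- ℤ.1ℤ)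
    lemma = ℤSolver.solve-∀

  1-invertible : Invertible ℤ.1ℤ
  1-invertible = ℤ.1ℤ , ≈-refl

  *-cancelˡ-≈ : ∀ {e x y} → Invertible e → e ℤ.* x ≈ e ℤ.* y → x ≈ y
  *-cancelˡ-≈ {e} {x} {y} (i , p) q = ≈-by₂ i (y ℤ.- x) q p (lemma e i x y)
    where
    lemma : ∀ e i x y → x ℤ.- y ≡ i ℤ.* (e ℤ.* x ℤ.- e ℤ.* y) ℤ.+ (y ℤ.- x) ℤ.* (i ℤ.* e ℤ.- ℤ.1ℤ)
    lemma = ℤSolver.solve-∀

  nonzero⇒invertible : Prime p → ∀ {e} → ¬ e ≡ 0ℤ → ℤ.∣ e ∣ ℕ.< p → Invertible e
  nonzero⇒invertible p-prime {e} e≢0 small = sign-cases e refl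
    where
    instance
      ∣e∣≢0 : ℕ.NonZero ℤ.∣ e ∣
      ∣e∣≢0 = ℕ.≢-nonZero (λ q → e≢0 (ℤ.∣i∣≡0⇒i≡0 q))
    cast : ∀ {a b c d} → 1 ℕ.+ a ℕ.* b ≡ c ℕ.* d → ℤ.1ℤ ℤ.+ + a ℤ.* + b ≡ + c ℤ.* + d
    cast {a} {b} {c} {d} q = trans (cong (ℤ._+_ ℤ.1ℤ) (sym (ℤ.pos-* a b))) (trans (cong +_ q) (ℤ.pos-* c d))
    from-Bézout : Bézout.Identity 1 p ℤ.∣ e ∣ → Invertible (+ ℤ.∣ e ∣)
    from-Bézout (Bézout.+- x y q) = ℤ.- (+ y) ,
        mk≈ (divides (ℤ.- (+ x)) (trans (lemma (+ y) (+ ℤ.∣ e ∣))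
        (trans (cong ℤ.-_ (cast {y} {ℤ.∣ e ∣} {x} {p} q)) (ℤ.neg-distribˡ-* (+ x) (+ p)))))
      where
      lemma : ∀ y e → (ℤ.- y) ℤ.* e ℤ.- ℤ.1ℤ ≡ ℤ.- (ℤ.1ℤ ℤ.+ y ℤ.* e)
      lemma = ℤSolver.solve-∀
    from-Bézout (Bézout.-+ x y q) = + y , mk≈ (divides (+ x) (trans
        (cong (ℤ._- ℤ.1ℤ) (sym (cast {x} {p} {y} {ℤ.∣ e ∣} q))) (lemma (+ x) (+ p))))
      where
      lemma : ∀ x p → ℤ.1ℤ ℤ.+ x ℤ.* p ℤ.- ℤ.1ℤ ≡ x ℤ.* p
      lemma = ℤSolver.solve-∀
    abs-invertible : Invertible (+ ℤ.∣ e ∣)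
    abs-invertible = from-Bézout (coprime-Bézout (prime⇒coprime p-prime small))
    sign-cases : ∀ z → e ≡ z → Invertible e
    sign-cases (+ m)      refl = abs-invertible
    sign-cases ℤ.-[1+ m ] refl = Invertible-neg abs-invertible

  ∑-affine : ∀ {e} → Invertible e → ∀ h (f : Fin p → ℚ) → ∑ (λ x → f (red (e ℤ.* ι x ℤ.+ h))) ≡ ∑ f
  ∑-affine {e} (i , ie≈1) h f = sym (∑-permute f (permutation to from to-from from-to))
    where
    to from : Fin p → Fin p
    to x   = red (e ℤ.* ι x ℤ.+ h)
    from y = red (i ℤ.* (ι y ℤ.- h))
    to-from : ∀ y → to (from y) ≡ y
    to-from y = trans (red-cong (≈-by₂ e (ι y ℤ.- h) (ι-red (i ℤ.* (ι y ℤ.- h))) ie≈1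
        (lemma e i h (ι (from y)) (ι y)))) (red-ι y)
      where
      lemma : ∀ e i h x y → e ℤ.* x ℤ.+ h ℤ.- y ≡
          e ℤ.* (x ℤ.- i ℤ.* (y ℤ.- h)) ℤ.+ (y ℤ.- h) ℤ.* (i ℤ.* e ℤ.- ℤ.1ℤ)
      lemma = ℤSolver.solve-∀
    from-to : ∀ x → from (to x) ≡ x
    from-to x = trans (red-cong (≈-by₂ i (ι x) (ι-red (e ℤ.* ι x ℤ.+ h)) ie≈1
        (lemma e i h (ι (to x)) (ι x)))) (red-ι x)
      where
      lemma : ∀ e i h y x → i ℤ.* (y ℤ.- h) ℤ.- x ≡ i ℤ.* (y ℤ.- (e ℤ.* x ℤ.+ h)) ℤ.+ x ℤ.* (i ℤ.* e ℤ.- ℤ.1ℤ)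
      lemma = ℤSolver.solve-∀

∑-card : ∀ {n} (A : Subset n) → ∑ (λ x → 𝟙 (lookup A x)) ≡ ℕ⇒ℚ ∣ A ∣
∑-card []          = ∑-empty _
∑-card (true ∷ A)  = trans (∑-suc _) (trans (cong (_+_ 1ℚ) (∑-card A)) (sym (ℕ⇒ℚ-suc ∣ A ∣)))
∑-card (false ∷ A) = trans (∑-suc _) (trans (+-identityˡ _) (∑-card A))

-- Three-variable equations

module _ {n : ℕ} where
  -- Counts with multiplicity: the sum is then the length of the list, repetitions or not, and the
  -- indicator of membership is still dominated.
  occurrences : List (Fin n) → Fin n → ℚ
  occurrences []       x = 0ℚ
  occurrences (f ∷ fs) x = 𝟙 (f == x) + occurrences fs x

  0≤occurrences : ∀ fs x → 0ℚ ≤ occurrences fs x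
  0≤occurrences []       x = ≤-refl
  0≤occurrences (f ∷ fs) x = 0≤a+b (0≤𝟙 (f == x)) (0≤occurrences fs x)

  ∑-point : ∀ (f : Fin n) → ∑ (λ x → 𝟙 (f == x)) ≡ 1ℚ
  ∑-point f = trans (∑-cong (λ x → sym (*-identityʳ (𝟙 (f == x))))) (∑-delta f (λ _ → 1ℚ))

  ∑-occurrences : ∀ fs → ∑ (occurrences fs) ≡ ℕ⇒ℚ (length fs)
  ∑-occurrences []       = ∑-zero n
  ∑-occurrences (f ∷ fs) = trans (∑-distrib-+ _ _) (trans (cong₂ _+_ (∑-point f) (∑-occurrences fs))
      (sym (ℕ⇒ℚ-suc (length fs))))

  ∈⇒1≤occurrences : ∀ {fs x} → x ∈ₗ fs → 1ℚ ≤ occurrences fs x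
  ∈⇒1≤occurrences {f ∷ fs} {x} (here refl) =
      eq-≤ (sym (cong (λ b → 𝟙 b + 0ℚ) (==-refl f))) (+-monoʳ-≤ (𝟙 (f == x)) (0≤occurrences fs x))
  ∈⇒1≤occurrences {f ∷ fs} {x} (there p)   =
      ≤-trans (∈⇒1≤occurrences p) (eq-≤ (sym (+-identityˡ _)) (+-monoˡ-≤ (occurrences fs x) (0≤𝟙 (f == x))))

lookup⇒∈ : ∀ {n} {A : Subset n} {x} → lookup A x ≡ true → x ∈ A
lookup⇒∈ {A = A} {x} = lookup⇒[]= x A

∈⇒lookup : ∀ {n} {A : Subset n} {x} → x ∈ A → lookup A x ≡ true
∈⇒lookup = []=⇒lookup

module Triple (p : ℕ) ⦃ p≢0 : ℕ.NonZero p ⦄ (A : Subset p) (c₁ c₂ c₃ : ℤ) (c-sum : c₁ ℤ.+ c₂ ℤ.+ c₃ ≡ 0ℤ)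
              (inv₁ : Residues.Invertible p c₁) (inv₂ : Residues.Invertible p c₂)
                  (inv₃ : Residues.Invertible p c₃) where
  open Residues p

  N : ℚ
  N = ℕ⇒ℚ p

  0<N : 0ℚ < N
  0<N = 0<ℕ⇒ℚ p

  0≤N : 0ℚ ≤ N
  0≤N = <⇒≤ 0<N

  a : ℤ → Bool
  a z = lookup A (red z)

  a-cong : ∀ {x y} → x ≈ y → a x ≡ a y
  a-cong e = cong (lookup A) (red-cong e)

  -- (X, Y, Z) is the cross product of (u, v, w) and the coefficient vector, so it solves the
  -- equation while each entry depends on two of u, v, w only; u + v + w = 0 gives X = Y = Z.
  X Y Z : ℤ → ℤ → ℤ
  X v w = c₂ ℤ.* w ℤ.- c₃ ℤ.* v
  Y u w = ℤ.- c₁ ℤ.* w ℤ.+ c₃ ℤ.* u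
  Z u v = c₁ ℤ.* v ℤ.- c₂ ℤ.* u

  XYZ-equation : ∀ u v w s → c₁ ℤ.* X (v ℤ.+ s) w ℤ.+ c₂ ℤ.* Y u w ℤ.+ c₃ ℤ.* Z u v ≡ ℤ.- (c₁ ℤ.* c₃) ℤ.* s
  XYZ-equation u v w s = lemma c₁ c₂ c₃ u v w s
    where
    lemma : ∀ c₁ c₂ c₃ u v w s → c₁ ℤ.* (c₂ ℤ.* w ℤ.- c₃ ℤ.* (v ℤ.+ s)) ℤ.+ c₂ ℤ.*
        (ℤ.- c₁ ℤ.* w ℤ.+ c₃ ℤ.* u) ℤ.+ c₃ ℤ.* (c₁ ℤ.* v ℤ.- c₂ ℤ.* u) ≡ ℤ.- (c₁ ℤ.* c₃) ℤ.* s
    lemma = ℤSolver.solve-∀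

  -- For z = `Z u v`, the number of pairs x, y in `A` with `c₁x + c₂y = -c₃z`, parametrised by `w`.
  Q : ℤ → ℤ → ℚ
  Q u v = ∑ λ (w : Fin p) → 𝟙 (a (X v (ι w))) * 𝟙 (a (Y u (ι w)))

  -- This is `p` times the number of solutions in `A` with right-hand side `-c₁c₃s`: moving (u, v,
  -- w) by a multiple of the coefficient vector changes no entry.
  T₃ : ℤ → ℚ
  T₃ s = ∑∑ λ (u v : Fin p) → 𝟙 (a (Z (ι u) (ι v))) * Q (ι u) (ι v ℤ.+ s)

  Q≤N : ∀ u v → Q u v ≤ N
  Q≤N u v = ≤-eq (∑-≤-const (λ w → proj₂ (Unit-* (Unit-𝟙 (a (X v (ι w)))) (Unit-𝟙 (a (Y u (ι w)))))))
      (*-identityʳ N)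

  ∑-over-Z : ∀ u (f : Fin p → ℚ) → ∑ (λ v → f (red (Z u (ι v)))) ≡ ∑ f
  ∑-over-Z u f = ∑-affine inv₁ (ℤ.- (c₂ ℤ.* u)) f

  ∑∑-over-Z : ∀ (f : Fin p → ℚ) → ∑∑ (λ u v → f (red (Z (ι u) (ι v)))) ≡ N * ∑ f
  ∑∑-over-Z f = trans (∑-cong (λ u → ∑-over-Z (ι u) f)) (∑-const p (∑ f))

  Density : ℚ
  Density = ∑ λ x → 𝟙 (lookup A x)

  module _ (q : ℕ) where
    open TriangleRemoval q

    many-solutions : N * (ℕ⇒ℚ 32 * t) ≤ Density → N * (N * N) * δmin fuel 1 ≤ T₃ 0ℤ
    many-solutions dense = ≤-eq removal triangles≡T₃
      where
      E : Fin 3 → Fin p → Fin p → Bool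
      E zero          v w = a (X (ι v) (ι w))
      E (suc zero)    u w = a (Y (ι u) (ι w))
      E (suc (suc _)) u v = a (Z (ι u) (ι v))
      third : Fin p → Fin p → Fin p
      third u v = red (ℤ.-1ℤ ℤ.* ι u ℤ.+ (ℤ.- ι v))
      c-sum≈0 : c₁ ℤ.+ c₂ ℤ.+ c₃ ≈ 0ℤ
      c-sum≈0 = ≈-reflexive c-sum
      edge₁ : ∀ u v → a (Z (ι u) (ι v)) ≡ true → a (X (ι v) (ι (third u v))) ≡ true
      edge₁ u v e = trans (a-cong (≈-by₂ c₂ (ℤ.- ι v) (ι-red (ℤ.-1ℤ ℤ.* ι u ℤ.+ (ℤ.- ι v))) c-sum≈0
          (lemma c₁ c₂ c₃ (ι u) (ι v) (ι (third u v))))) e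
        where
        lemma : ∀ c₁ c₂ c₃ u v w → c₂ ℤ.* w ℤ.- c₃ ℤ.* v ℤ.- (c₁ ℤ.* v ℤ.- c₂ ℤ.* u) ≡
                c₂ ℤ.* (w ℤ.- (ℤ.-1ℤ ℤ.* u ℤ.+ (ℤ.- v))) ℤ.+ (ℤ.- v) ℤ.* (c₁ ℤ.+ c₂ ℤ.+ c₃ ℤ.- 0ℤ)
        lemma = ℤSolver.solve-∀
      edge₂ : ∀ u v → a (Z (ι u) (ι v)) ≡ true → a (Y (ι u) (ι (third u v))) ≡ true
      edge₂ u v e = trans (a-cong (≈-by₂ (ℤ.- c₁) (ι u) (ι-red (ℤ.-1ℤ ℤ.* ι u ℤ.+ (ℤ.- ι v))) c-sum≈0
          (lemma c₁ c₂ c₃ (ι u) (ι v) (ι (third u v))))) e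
        where
        lemma : ∀ c₁ c₂ c₃ u v w → ℤ.- c₁ ℤ.* w ℤ.+ c₃ ℤ.* u ℤ.- (c₁ ℤ.* v ℤ.- c₂ ℤ.* u) ≡
                (ℤ.- c₁) ℤ.* (w ℤ.- (ℤ.-1ℤ ℤ.* u ℤ.+ (ℤ.- v))) ℤ.+ u ℤ.* (c₁ ℤ.+ c₂ ℤ.+ c₃ ℤ.- 0ℤ)
        lemma = ℤSolver.solve-∀
      reindex₁ : ∀ f → ∑∑ (λ u v → f v (third u v)) ≡ ∑∑ f
      reindex₁ f = trans (∑-comm _) (∑-cong (λ v → ∑-affine (Invertible-neg 1-invertible) (ℤ.- ι v) (f v)))
      reindex₂ : ∀ f → ∑∑ (λ u v → f u (third u v)) ≡ ∑∑ f
      reindex₂ f = ∑-cong (λ u → trans (∑-cong (λ v → cong (λ z → f u (red z)) (lemma (ι u) (ι v))))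
          (∑-affine (Invertible-neg 1-invertible) (ℤ.- ι u) (f u)))
        where
        lemma : ∀ u v → ℤ.-1ℤ ℤ.* u ℤ.+ (ℤ.- v) ≡ ℤ.-1ℤ ℤ.* v ℤ.+ (ℤ.- u)
        lemma = ℤSolver.solve-∀
      many : N * N * (ℕ⇒ℚ 32 * t) ≤ ∑∑ (λ u v → 𝟙 (a (Z (ι u) (ι v))))
      many = eq-≤ (*-assoc N N (ℕ⇒ℚ 32 * t)) (≤-eq (*-monoˡ 0≤N dense)
          (sym (∑∑-over-Z (λ x → 𝟙 (lookup A x)))))
      open Graph 0<N E third edge₁ edge₂ reindex₁ reindex₂ many using (removal; triangles)
      triangles≡T₃ : triangles ≡ T₃ 0ℤ
      triangles≡T₃ = ∑∑-cong (λ u v → trans (∑-cong (λ w →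
          rearrange (𝟙 (a (X (ι v) (ι w)))) (𝟙 (a (Y (ι u) (ι w)))) (𝟙 (a (Z (ι u) (ι v))))))
        (trans (sym (*-distribˡ-∑ (𝟙 (a (Z (ι u) (ι v)))) _))
            (cong (λ z → 𝟙 (a (Z (ι u) (ι v))) * Q (ι u) z) (sym (ℤ.+-identityʳ (ι v))))))
        where
        rearrange : ∀ x y z → x * (y * z) ≡ z * (x * y)
        rearrange = RingSolver.solve-∀ ℚ-ring

  -- Both entries are bijective in `w`, so each forbidden value excludes one `w` per entry. The
  -- entries coincide only at `w = -(u + v)`, because `c₁ + c₂ = -c₃` is invertible.
  choose-pair : ∀ Fb u v → ℕ⇒ℚ (length Fb) + ℕ⇒ℚ (length Fb) + 1ℚ < Q u v →
    ∃ λ w → let x = red (X v (ι w)) ; y = red (Y u (ι w)) in x ∈ A × y ∈ A × x ∉ₗ Fb × y ∉ₗ Fb × ¬ x ≡ y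
  choose-pair Fb u v large = w , lookup⇒∈ {A = A} ax , lookup⇒∈ {A = A} ay ,
      (λ x∈ → absurd (≤-trans (∈⇒1≤occurrences x∈) (≤-by-diff (0≤a+b 0≤o₂ 0≤o₃) (lemma₁ o₁ o₂ o₃)))) ,
      (λ y∈ → absurd (≤-trans (∈⇒1≤occurrences y∈) (≤-by-diff (0≤a+b 0≤o₁ 0≤o₃) (lemma₂ o₁ o₂ o₃)))) ,
      (λ x≡y → absurd (eq-≤ (sym (cong 𝟙 (dec-true (red 0ℤ Fin.≟ red (ℤ.1ℤ ℤ.* ι w ℤ.+ (u ℤ.+ v)))
          (collision x≡y)))) (≤-by-diff (0≤a+b 0≤o₁ 0≤o₂) (lemma₃ o₁ o₂ o₃))))
    where
    obstruction : Fin p → ℚ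
    obstruction w = occurrences Fb (red (X v (ι w))) + occurrences Fb (red (Y u (ι w))) + 𝟙
        (red 0ℤ == red (ℤ.1ℤ ℤ.* ι w ℤ.+ (u ℤ.+ v)))
    ∑-obstruction : ∑ obstruction ≡ ℕ⇒ℚ (length Fb) + ℕ⇒ℚ (length Fb) + 1ℚ
    ∑-obstruction = trans (∑-distrib-+ _ _) (cong₂ _+_ (trans (∑-distrib-+ _ _) (cong₂ _+_
      (trans (∑-affine inv₂ (ℤ.- (c₃ ℤ.* v)) (occurrences Fb)) (∑-occurrences Fb))
      (trans (∑-affine (Invertible-neg inv₁) (c₃ ℤ.* u) (occurrences Fb)) (∑-occurrences Fb))))
      (trans (∑-affine 1-invertible (u ℤ.+ v) (λ x → 𝟙 (red 0ℤ == x))) (∑-point (red 0ℤ))))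
    found : ∃ λ w → obstruction w < 𝟙 (a (X v (ι w))) * 𝟙 (a (Y u (ι w)))
    found = ∑-<⇒∃ _ _ (≤-<-trans (≤-reflexive ∑-obstruction) large)
    w = proj₁ found
    o₁ o₂ o₃ : ℚ
    o₁ = occurrences Fb (red (X v (ι w)))
    o₂ = occurrences Fb (red (Y u (ι w)))
    o₃ = 𝟙 (red 0ℤ == red (ℤ.1ℤ ℤ.* ι w ℤ.+ (u ℤ.+ v)))
    0≤o₁ : 0ℚ ≤ o₁
    0≤o₁ = 0≤occurrences Fb (red (X v (ι w)))
    0≤o₂ : 0ℚ ≤ o₂
    0≤o₂ = 0≤occurrences Fb (red (Y u (ι w)))
    0≤o₃ : 0ℚ ≤ o₃
    0≤o₃ = 0≤𝟙 (red 0ℤ == red (ℤ.1ℤ ℤ.* ι w ℤ.+ (u ℤ.+ v)))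
    both : ∀ {b c} → 0ℚ < 𝟙 b * 𝟙 c → b ≡ true × c ≡ true
    both {true}  {true}  _ = refl , refl
    both {true}  {false} q = contradiction q (<-irrefl refl)
    both {false} {true}  q = contradiction q (<-irrefl refl)
    both {false} {false} q = contradiction q (<-irrefl refl)
    members = both (≤-<-trans (0≤a+b (0≤a+b 0≤o₁ 0≤o₂) 0≤o₃) (proj₂ found))
    ax : a (X v (ι w)) ≡ true
    ax = proj₁ members
    ay : a (Y u (ι w)) ≡ true
    ay = proj₂ members
    absurd : 1ℚ ≤ obstruction w → ⊥
    absurd q = <-irrefl refl (≤-<-trans q (<-≤-trans (proj₂ found)
        (proj₂ (Unit-* (Unit-𝟙 (a (X v (ι w)))) (Unit-𝟙 (a (Y u (ι w))))))))
    lemma₁ : ∀ a b c → a + b + c - a ≡ b + c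
    lemma₁ = RingSolver.solve-∀ ℚ-ring
    lemma₂ : ∀ a b c → a + b + c - b ≡ a + c
    lemma₂ = RingSolver.solve-∀ ℚ-ring
    lemma₃ : ∀ a b c → a + b + c - c ≡ a + b
    lemma₃ = RingSolver.solve-∀ ℚ-ring
    collision : red (X v (ι w)) ≡ red (Y u (ι w)) → red 0ℤ ≡ red (ℤ.1ℤ ℤ.* ι w ℤ.+ (u ℤ.+ v))
    collision e = red-cong (*-cancelˡ-≈ inv₃ (≈-by₂ ℤ.1ℤ (ℤ.- ι w)
        (≈-trans (≈-sym (ι-red (X v (ι w)))) (≈-trans (≈-reflexive (cong ι e)) (ι-red (Y u (ι w)))))
      (≈-reflexive c-sum) (lemma c₁ c₂ c₃ u v (ι w))))
      where
      lemma : ∀ c₁ c₂ c₃ u v w → c₃ ℤ.* 0ℤ ℤ.- c₃ ℤ.* (ℤ.1ℤ ℤ.* w ℤ.+ (u ℤ.+ v)) ≡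
              ℤ.1ℤ ℤ.* (c₂ ℤ.* w ℤ.- c₃ ℤ.* v ℤ.- (ℤ.- c₁ ℤ.* w ℤ.+ c₃ ℤ.* u)) ℤ.+ (ℤ.- w) ℤ.*
                  (c₁ ℤ.+ c₂ ℤ.+ c₃ ℤ.- 0ℤ)
      lemma = ℤSolver.solve-∀

  choose-triple : ∀ Fb s → N * N * (ℕ⇒ℚ 3 * (ℕ⇒ℚ (length Fb) + 1ℚ)) < T₃ s →
    ∃ λ x → ∃ λ y → ∃ λ z → (x ∈ A × y ∈ A × z ∈ A) × (x ∉ₗ Fb × y ∉ₗ Fb × z ∉ₗ Fb) ×
        (¬ x ≡ y × ¬ x ≡ z × ¬ y ≡ z) ×
    c₁ ℤ.* ι x ℤ.+ c₂ ℤ.* ι y ℤ.+ c₃ ℤ.* ι z ≈ ℤ.- (c₁ ℤ.* c₃) ℤ.* s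
  choose-triple Fb s large = x , y , z , (proj₁ x,y , proj₁ (proj₂ x,y) , lookup⇒∈ {A = A} az) ,
      ((λ x∈ → proj₁ (proj₂ (proj₂ x,y)) (there x∈)) ,
          (λ y∈ → proj₁ (proj₂ (proj₂ (proj₂ x,y))) (there y∈)) , z∉Fb) ,
      (proj₂ (proj₂ (proj₂ (proj₂ x,y))) , (λ x≡z → proj₁ (proj₂ (proj₂ x,y)) (here x≡z)) ,
          (λ y≡z → proj₁ (proj₂ (proj₂ (proj₂ x,y))) (here y≡z))) ,
      ≈-trans (+-cong-≈ (+-cong-≈ (*-congˡ-≈ c₁ (ι-red _)) (*-congˡ-≈ c₂ (ι-red _)))
          (*-congˡ-≈ c₃ (ι-red _))) (≈-reflexive (XYZ-equation (ι u) (ι v) (ι w) s))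
    where
    L : ℚ
    L = ℕ⇒ℚ (length Fb)
    obstruction : Fin p → Fin p → ℚ
    -- The factor `N` lets a forbidden z outweigh `Q`, which is at most `N`; the rest is what
    -- `choose-pair` demands once z has joined the list.
    obstruction u v = occurrences Fb (red (Z (ι u) (ι v))) * N + (1ℚ + L + (1ℚ + L) + 1ℚ)
    ∑∑-obstruction : ∑∑ obstruction ≡ N * N * (ℕ⇒ℚ 3 * (L + 1ℚ))
    ∑∑-obstruction = trans (∑∑-distrib-+ _ _) (trans (cong₂ _+_
        (trans (∑∑-over-Z (λ x → occurrences Fb x * N)) (cong (N *_)
            (trans (sym (*-distribʳ-∑ N _)) (cong (_* N) (∑-occurrences Fb)))))
        (∑∑-const p p _)) (lemma N L))
      where
      lemma : ∀ n l → n * (l * n) + n * n * (1ℚ + l + (1ℚ + l) + 1ℚ) ≡ n * n * ((+ 3 / 1) * (l + 1ℚ))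
      lemma = RingSolver.solve-∀ ℚ-ring
    Good : Fin p → Fin p → Set
    Good u v = obstruction u v < 𝟙 (a (Z (ι u) (ι v))) * Q (ι u) (ι v ℤ.+ s)
    found : ∃₂ Good
    found = proj₁ row , ∑-<⇒∃ _ _ (proj₂ row)
      where row = ∑-<⇒∃ _ _ (≤-<-trans (≤-reflexive ∑∑-obstruction) large)
    u v z : Fin p
    u = proj₁ found
    v = proj₁ (proj₂ found)
    z = red (Z (ι u) (ι v))
    0≤rest : 0ℚ ≤ 1ℚ + L + (1ℚ + L) + 1ℚ
    0≤rest = 0≤a+b (0≤a+b (0≤a+b 0≤1 (0≤ℕ⇒ℚ (length Fb))) (0≤a+b 0≤1 (0≤ℕ⇒ℚ (length Fb)))) 0≤1
    0≤occ : 0ℚ ≤ occurrences Fb z * N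
    0≤occ = 0≤a*b (0≤occurrences Fb z) 0≤N
    az : a (Z (ι u) (ι v)) ≡ true
    az = nonzero-factor (≤-<-trans (0≤a+b 0≤occ 0≤rest) (proj₂ (proj₂ found)))
      where
      nonzero-factor : ∀ {b r} → 0ℚ < 𝟙 b * r → b ≡ true
      nonzero-factor {true}      _ = refl
      nonzero-factor {false} {r} q = contradiction (<-eq q (*-zeroˡ r)) (<-irrefl refl)
    good : obstruction u v < Q (ι u) (ι v ℤ.+ s)
    good = <-eq (proj₂ (proj₂ found)) (trans (cong (λ b → 𝟙 b * Q (ι u) (ι v ℤ.+ s)) az) (*-identityˡ _))
    z∉Fb : z ∉ₗ Fb
    z∉Fb z∈ = <-irrefl refl (<-≤-trans (≤-<-trans (≤-trans (≤-trans
        (eq-≤ (sym (*-identityˡ N)) (*-monoʳ 0≤N (∈⇒1≤occurrences z∈)))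
      (≤-by-diff 0≤rest (lemma (occurrences Fb z * N) (1ℚ + L + (1ℚ + L) + 1ℚ)))) ≤-refl) good)
          (Q≤N (ι u) (ι v ℤ.+ s)))
      where
      lemma : ∀ a b → a + b - a ≡ b
      lemma = RingSolver.solve-∀ ℚ-ring
    pair = choose-pair (z ∷ Fb) (ι u) (ι v ℤ.+ s)
      (≤-<-trans (eq-≤ (cong (λ l → l + l + 1ℚ) (ℕ⇒ℚ-suc (length Fb)))
          (≤-by-diff 0≤occ (lemma (occurrences Fb z * N) (1ℚ + L + (1ℚ + L) + 1ℚ)))) good)
      where
      lemma : ∀ a b → a + b - b ≡ a
      lemma = RingSolver.solve-∀ ℚ-ring
    w x y : Fin p
    w = proj₁ pair
    x = red (X (ι v ℤ.+ s) (ι w))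
    y = red (Y (ι u) (ι w))
    x,y = proj₂ pair

  module Popular (δ : ℚ) where
    threshold : ℚ
    threshold = N * (½ * δ)

    -- `Q u v` depends only on `Z u v`, so asking for some u and v is a condition on z.
    IsPopular : Fin p → Set
    IsPopular z = ∃ λ (u : Fin p) → ∃ λ (v : Fin p) → red (Z (ι u) (ι v)) ≡ z × a (Z (ι u) (ι v)) ≡
        true × threshold ≤ Q (ι u) (ι v)

    popular? : ∀ z → Dec (IsPopular z)
    popular? z = Fin.any? λ u → Fin.any? λ v →
        (red (Z (ι u) (ι v)) Fin.≟ z) ×-dec (a (Z (ι u) (ι v)) Bool.≟ true) ×-dec (threshold ≤? Q (ι u) (ι v))

    A′ : Subset p
    A′ = tabulate (λ z → does (popular? z))

    ∈A′⇒popular : ∀ {z} → z ∈ A′ → IsPopular z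
    ∈A′⇒popular {z} z∈ = does-true (popular? z) (trans (sym (lookup∘tabulate (λ z → does (popular? z)) z))
        (∈⇒lookup z∈))

    popular⇒lookup : ∀ {z} → IsPopular z → lookup A′ z ≡ true
    popular⇒lookup {z} pop = trans (lookup∘tabulate (λ z → does (popular? z)) z) (dec-true (popular? z) pop)

    A′⊆A : ∀ {z} → z ∈ A′ → z ∈ A
    A′⊆A z∈ = from-popular (∈A′⇒popular z∈)
      where
      from-popular : ∀ {z} → IsPopular z → z ∈ A
      from-popular (u , v , e , az , _) = subst (_∈ A) e (lookup⇒∈ {A = A} az)

    -- Elements that are not popular contribute at most `N² · threshold`, half of `N³δ`. A popular
    -- one contributes at most `N²`: it equals `Z u v` for `N` pairs u, v, each with `Q ≤ N`.
    A′-dense : 0ℚ ≤ δ → N * (N * N) * δ ≤ T₃ 0ℤ → threshold ≤ ∑ (λ x → 𝟙 (lookup A′ x))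
    A′-dense 0≤δ many = *-cancelˡ-≤-pos (N * N) ⦃ positive (0<a*b 0<N 0<N) ⦄
        (≤-by-diff (diff-nonNeg (≤-trans many upper)) (lemma N δ D))
      where
      D : ℚ
      D = ∑ (λ x → 𝟙 (lookup A′ x))
      lemma : ∀ n δ d → n * n * d - n * n * (n * (½ * δ)) ≡
          n * (d * n) + n * n * (n * (½ * δ)) - n * (n * n) * δ
      lemma = RingSolver.solve-∀ ℚ-ring
      0≤threshold : 0ℚ ≤ threshold
      0≤threshold = 0≤a*b 0≤N (0≤a*b (nonNegative⁻¹ ½) 0≤δ)
      pointwise : ∀ u v → 𝟙 (a (Z (ι u) (ι v))) * Q (ι u) (ι v ℤ.+ 0ℤ) ≤
          𝟙 (lookup A′ (red (Z (ι u) (ι v)))) * N + threshold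
      pointwise u v = cases refl (threshold ≤? Q (ι u) (ι v))
        where
        0≤rhs : ∀ b → 0ℚ ≤ 𝟙 b * N
        0≤rhs b = 0≤a*b (0≤𝟙 b) 0≤N
        cases : ∀ {b} → a (Z (ι u) (ι v)) ≡ b → Dec (threshold ≤ Q (ι u) (ι v)) →
            𝟙 b * Q (ι u) (ι v ℤ.+ 0ℤ) ≤ 𝟙 (lookup A′ (red (Z (ι u) (ι v)))) * N + threshold
        cases {false} _ _ = eq-≤ (*-zeroˡ (Q (ι u) (ι v ℤ.+ 0ℤ)))
            (0≤a+b (0≤rhs (lookup A′ (red (Z (ι u) (ι v))))) 0≤threshold)
        cases {true} az (yes q) = ≤-eq (eq-≤ (*-identityˡ _) (≤-trans (Q≤N (ι u) (ι v ℤ.+ 0ℤ))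
            (≤-by-diff 0≤threshold (lemma′ N threshold))))
            (cong (λ b → 𝟙 b * N + threshold) (sym (popular⇒lookup (u , v , refl , az , q))))
          where
          lemma′ : ∀ n t → 1ℚ * n + t - n ≡ t
          lemma′ = RingSolver.solve-∀ ℚ-ring
        cases {true} az (no q) = eq-≤ (trans (*-identityˡ _) (cong (Q (ι u)) (ℤ.+-identityʳ (ι v))))
            (≤-trans (<⇒≤ (≰⇒> q))
          (eq-≤ (sym (+-identityˡ threshold)) (+-monoˡ-≤ threshold
              (0≤rhs (lookup A′ (red (Z (ι u) (ι v))))))))
      upper : T₃ 0ℤ ≤ N * (D * N) + N * N * threshold
      upper = ≤-eq (∑∑-mono pointwise) (trans (∑∑-distrib-+ _ _) (cong₂ _+_
        (trans (∑∑-over-Z (λ x → 𝟙 (lookup A′ x) * N)) (cong (N *_) (sym (*-distribʳ-∑ N _))))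
            (∑∑-const p p threshold)))

    expand : ∀ {z} → z ∈ A′ → ∀ Fb → ℕ⇒ℚ (length Fb) + ℕ⇒ℚ (length Fb) + 1ℚ < threshold →
      ∃ λ x → ∃ λ y → x ∈ A × y ∈ A × x ∉ₗ Fb × y ∉ₗ Fb × ¬ x ≡ y × c₁ ℤ.* ι x ℤ.+ c₂ ℤ.* ι y ≈
          (c₁ ℤ.+ c₂) ℤ.* ι z
    expand z∈ Fb large = go (∈A′⇒popular z∈)
      where
      go : ∀ {z} → IsPopular z → ∃ λ x → ∃ λ y → x ∈ A × y ∈ A × x ∉ₗ Fb × y ∉ₗ Fb × ¬ x ≡
          y × c₁ ℤ.* ι x ℤ.+ c₂ ℤ.* ι y ≈ (c₁ ℤ.+ c₂) ℤ.* ι z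
      go {z} (u , v , e , _ , q) = red (X (ι v) (ι w)) , red (Y (ι u) (ι w)) , proj₁ x,y ,
          proj₁ (proj₂ x,y) , proj₁ (proj₂ (proj₂ x,y)) , proj₁ (proj₂ (proj₂ (proj₂ x,y))) ,
          proj₂ (proj₂ (proj₂ (proj₂ x,y))) ,
          ≈-trans (+-cong-≈ (*-congˡ-≈ c₁ (ι-red _)) (*-congˡ-≈ c₂ (ι-red _)))
            (≈-by₂ (ℤ.- (c₁ ℤ.+ c₂)) (Z (ι u) (ι v)) (≈-trans (≈-reflexive (cong ι (sym e)))
                (ι-red (Z (ι u) (ι v)))) (≈-reflexive (sym c-sum)) (lemma c₁ c₂ c₃ (ι u) (ι v) (ι w) (ι z)))
        where
        pair = choose-pair Fb (ι u) (ι v) (<-≤-trans large q)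
        w = proj₁ pair
        x,y = proj₂ pair
        lemma : ∀ c₁ c₂ c₃ u v w z → c₁ ℤ.* (c₂ ℤ.* w ℤ.- c₃ ℤ.* v) ℤ.+ c₂ ℤ.* (ℤ.- c₁ ℤ.* w ℤ.+ c₃ ℤ.* u)
            ℤ.- (c₁ ℤ.+ c₂) ℤ.* z ≡
                (ℤ.- (c₁ ℤ.+ c₂)) ℤ.* (z ℤ.- (c₁ ℤ.* v ℤ.- c₂ ℤ.* u)) ℤ.+ (c₁ ℤ.* v ℤ.- c₂ ℤ.* u) ℤ.*
                    (0ℤ ℤ.- (c₁ ℤ.+ c₂ ℤ.+ c₃))
        lemma = ℤSolver.solve-∀

-- Almost periods

a≤∣a∣ : ∀ a → a ≤ ℚ.∣ a ∣
a≤∣a∣ a = cases (∣p∣≡p∨∣p∣≡-p a)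
  where
  cases : ℚ.∣ a ∣ ≡ a ⊎ ℚ.∣ a ∣ ≡ - a → a ≤ ℚ.∣ a ∣
  cases (inj₁ e) = ≤-reflexive (sym e)
  cases (inj₂ e) = ≤-trans (≤-by-diff -a≥0 (lemma a)) (0≤∣p∣ a)
    where
    -a≥0 : 0ℚ ≤ - a
    -a≥0 = ≤-eq (0≤∣p∣ a) e
    lemma : ∀ a → 0ℚ - a ≡ - a
    lemma = RingSolver.solve-∀ ℚ-ring

∣a-b∣≡∣b-a∣ : ∀ a b → ℚ.∣ a - b ∣ ≡ ℚ.∣ b - a ∣
∣a-b∣≡∣b-a∣ a b = trans (cong ℚ.∣_∣ (lemma a b)) (∣-p∣≡∣p∣ (b - a))
  where
  lemma : ∀ a b → a - b ≡ - (b - a)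
  lemma = RingSolver.solve-∀ ℚ-ring

∣a-c∣≤ : ∀ a b c → ℚ.∣ a - c ∣ ≤ ℚ.∣ a - b ∣ + ℚ.∣ b - c ∣
∣a-c∣≤ a b c = eq-≤ (cong ℚ.∣_∣ (lemma a b c)) (∣p+q∣≤∣p∣+∣q∣ (a - b) (b - c))
  where
  lemma : ∀ a b c → a - c ≡ (a - b) + (b - c)
  lemma = RingSolver.solve-∀ ℚ-ring

∣a∣≤positive-parts : ∀ a → ℚ.∣ a ∣ ≤ 𝟙 (does (0ℚ <? a)) * a + 𝟙 (does (0ℚ <? - a)) * (- a)
∣a∣≤positive-parts a = cases (∣p∣≡p∨∣p∣≡-p a) (0ℚ <? a) (0ℚ <? - a)
  where
  positive-part : ∀ {x} (d : Dec (0ℚ < x)) → 0ℚ ≤ 𝟙 (does d) * x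
  positive-part {x} (yes q) = ≤-eq (<⇒≤ q) (sym (*-identityˡ x))
  positive-part {x} (no q)  = ≤-reflexive (sym (*-zeroˡ x))
  dominates : ∀ {x} (d : Dec (0ℚ < x)) → x ≤ 𝟙 (does d) * x
  dominates {x} (yes q) = ≤-reflexive (sym (*-identityˡ x))
  dominates {x} (no q)  = ≤-eq (≮⇒≥ q) (sym (*-zeroˡ x))
  cases : ℚ.∣ a ∣ ≡ a ⊎ ℚ.∣ a ∣ ≡ - a → (d : Dec (0ℚ < a)) (d′ : Dec (0ℚ < - a)) → ℚ.∣ a ∣ ≤
      𝟙 (does d) * a + 𝟙 (does d′) * (- a)
  cases (inj₁ e) d d′ = eq-≤ (trans e (sym (+-identityʳ a))) (+-mono-≤ (dominates d) (positive-part d′))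
  cases (inj₂ e) d d′ = eq-≤ (trans e (sym (+-identityˡ (- a)))) (+-mono-≤ (positive-part d) (dominates d′))

-- Rows with positive and rows with negative sum serve as test sets for the two cut bounds; hence
-- `β + β`.
Uniform-abs : ∀ {n β} (F g : Fin n → Fin n → ℚ) → Uniform F g β → ∀ (ψ : Fin n → ℚ) → (∀ w → Unit (ψ w)) →
              ∑ (λ v → ℚ.∣ ∑ (λ w → (F v w - g v w) * ψ w) ∣) ≤ β + β
Uniform-abs {n} {β} F g (cut , cut′) ψ uψ = begin
  ∑ (λ v → ℚ.∣ r v ∣)                                               ≤⟨
      ∑-mono (λ v → ∣a∣≤positive-parts (r v)) ⟩
  ∑ (λ v → 𝟙 (S v) * r v + 𝟙 (S′ v) * (- r v))                      ≡⟨ ∑-distrib-+ _ _ ⟩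
  ∑ (λ v → 𝟙 (S v) * r v) + ∑ (λ v → 𝟙 (S′ v) * (- r v))            ≡⟨
      cong₂ _+_ (∑-cong unfold) (∑-cong unfold′) ⟩
  ∑∑ (λ v w → (F v w - g v w) * (𝟙 (S v) * ψ w)) + ∑∑ (λ v w → (g v w - F v w) * (𝟙 (S′ v) * ψ w))
    ≤⟨ +-mono-≤ (cut-weights (λ v w → F v w - g v w) cut (λ v → 𝟙 (S v)) ψ (λ v → Unit-𝟙 (S v)) uψ)
                (cut-weights (λ v w → g v w - F v w) cut′ (λ v → 𝟙 (S′ v)) ψ (λ v → Unit-𝟙 (S′ v)) uψ) ⟩
  β + β                                                              ∎
  where
  open ≤-Reasoning
  r : Fin n → ℚ
  r v = ∑ (λ w → (F v w - g v w) * ψ w)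
  S S′ : Fin n → Bool
  S v  = does (0ℚ <? r v)
  S′ v = does (0ℚ <? - r v)
  lemma : ∀ s f g p → s * ((f - g) * p) ≡ (f - g) * (s * p)
  lemma = RingSolver.solve-∀ ℚ-ring
  lemma′ : ∀ s f g p → s * (- ((f - g) * p)) ≡ (g - f) * (s * p)
  lemma′ = RingSolver.solve-∀ ℚ-ring
  unfold : ∀ v → 𝟙 (S v) * r v ≡ ∑ (λ w → (F v w - g v w) * (𝟙 (S v) * ψ w))
  unfold v = trans (*-distribˡ-∑ (𝟙 (S v)) _) (∑-cong (λ w → lemma (𝟙 (S v)) (F v w) (g v w) (ψ w)))
  unfold′ : ∀ v → 𝟙 (S′ v) * (- r v) ≡ ∑ (λ w → (g v w - F v w) * (𝟙 (S′ v) * ψ w))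
  unfold′ v = trans (cong (𝟙 (S′ v) *_) (sym (∑-neg _))) (trans (*-distribˡ-∑ (𝟙 (S′ v)) _)
      (∑-cong (λ w → lemma′ (𝟙 (S′ v)) (F v w) (g v w) (ψ w))))

greedy : ∀ {n} {R : Fin n → Fin n → Set} → (∀ s t → Dec (R s t)) → ∀ xs →
         ∃ λ ts → AllPairs (λ s t → ¬ R s t) ts × All (λ x → Any (λ t → x ≡ t ⊎ R x t) ts) xs
greedy R? [] = [] , [] , []
greedy {R = R} R? (x ∷ xs) = extend (greedy R? xs)
  where
  extend : (∃ λ ts → AllPairs (λ s t → ¬ R s t) ts × All (λ x → Any (λ t → x ≡ t ⊎ R x t) ts) xs) →
           ∃ λ ts → AllPairs (λ s t → ¬ R s t) ts × All (λ x → Any (λ t → x ≡ t ⊎ R x t) ts) (x ∷ xs)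
  extend (ts , separated , covers) = decide (Any.any? (R? x) ts)
    where
    decide : Dec (Any (R x) ts) → ∃ λ ts → AllPairs (λ s t → ¬ R s t) ts × All
        (λ x → Any (λ t → x ≡ t ⊎ R x t) ts) (x ∷ xs)
    decide (yes q) = ts , separated , Any.map inj₂ q ∷ covers
    decide (no q)  = x ∷ ts , ¬Any⇒All¬ ts q ∷ separated , here (inj₁ refl) ∷ All.map there covers

module _ (p : ℕ) ⦃ _ : ℕ.NonZero p ⦄ where
  open Residues p

  -- The translates `U + s` and `U + t` share the point `v`.
  Meets : (Fin p → Bool) → Fin p → Fin p → Set
  Meets U s t = ∃ λ (v : Fin p) → U (red (ι v ℤ.- ι s)) ≡ true × U (red (ι v ℤ.- ι t)) ≡ true

  -- A maximal family of pairwise disjoint translates of U has at most p / ∣U∣ members, and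
  -- every translate of U meets one of them.
  translates-cover : ∀ (U : Fin p → Bool) K → ℕ⇒ℚ p < ℕ⇒ℚ (suc K) * ∑ (λ v → 𝟙 (U v)) →
    ∃ λ (κ : Fin p → Fin K) → ∀ s s′ → κ s ≡ κ s′ → ∃ λ t → (s ≡ t ⊎ Meets U s t) × (s′ ≡ t ⊎ Meets U s′ t)
  translates-cover U K large = κ , same-colour
    where
    meets? : ∀ s t → Dec (Meets U s t)
    meets? s t = Fin.any? λ v → (U (red (ι v ℤ.- ι s)) Bool.≟ true) ×-dec (U (red (ι v ℤ.- ι t)) Bool.≟ true)
    family = greedy meets? (allFin p)
    ts = proj₁ family
    hits : List (Fin p) → Fin p → ℚ
    hits []       v = 0ℚ
    hits (t ∷ ts) v = 𝟙 (U (red (ι v ℤ.- ι t))) + hits ts v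
    ∑-hits : ∀ ts → ∑ (hits ts) ≡ ℕ⇒ℚ (length ts) * ∑ (λ v → 𝟙 (U v))
    ∑-hits []       = trans (∑-zero p) (sym (*-zeroˡ (∑ (λ v → 𝟙 (U v)))))
    ∑-hits (t ∷ ts) = trans (∑-distrib-+ _ _) (trans (cong₂ _+_ shifted (∑-hits ts))
        (trans (lemma (ℕ⇒ℚ (length ts)) (∑ (λ v → 𝟙 (U v)))) (cong (_* ∑ (λ v → 𝟙 (U v)))
        (sym (ℕ⇒ℚ-suc (length ts))))))
      where
      shifted : ∑ (λ v → 𝟙 (U (red (ι v ℤ.- ι t)))) ≡ ∑ (λ v → 𝟙 (U v))
      shifted = trans (∑-cong (λ v → cong (λ z → 𝟙 (U (red (z ℤ.- ι t)))) (sym (ℤ.*-identityˡ (ι v)))))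
          (∑-affine 1-invertible (ℤ.- ι t) (λ v → 𝟙 (U v)))
      lemma : ∀ m u → u + m * u ≡ (1ℚ + m) * u
      lemma = RingSolver.solve-∀ ℚ-ring
    no-hits : ∀ v t → U (red (ι v ℤ.- ι t)) ≡ true → ∀ ts → All (λ t′ → ¬ Meets U t t′) ts → hits ts v ≡ 0ℚ
    no-hits v t e []        [] = refl
    no-hits v t e (t′ ∷ ts) (¬meets ∷ rest) =
        trans (cong₂ _+_ (cong 𝟙 (Bool.¬-not (λ e′ → ¬meets (v , e , e′)))) (no-hits v t e ts rest))
        (+-identityʳ 0ℚ)
    hits≤1 : ∀ ts → AllPairs (λ s t → ¬ Meets U s t) ts → ∀ v → hits ts v ≤ 1ℚ
    hits≤1 []       [] v = 0≤1
    hits≤1 (t ∷ ts) (sep ∷ seps) v = cases (U (red (ι v ℤ.- ι t))) refl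
      where
      cases : ∀ b → U (red (ι v ℤ.- ι t)) ≡ b → 𝟙 b + hits ts v ≤ 1ℚ
      cases true  e = ≤-reflexive (trans (cong (_+_ 1ℚ) (no-hits v t e ts sep)) (+-identityʳ 1ℚ))
      cases false e = eq-≤ (+-identityˡ (hits ts v)) (hits≤1 ts seps v)
    few : length ts ℕ.≤ K
    few = ℕ.s≤s⁻¹ (ℕ⇒ℚ-cancel-< (*-cancelʳ-<-nonNeg (∑ (λ v → 𝟙 (U v)))
        ⦃ nonNegative (∑-nonNeg (λ v → 0≤𝟙 (U v))) ⦄
      (≤-<-trans (eq-≤ (sym (∑-hits ts)) (≤-eq (∑-≤-const (hits≤1 ts (proj₁ (proj₂ family))))
          (*-identityʳ (ℕ⇒ℚ p)))) large)))
    nearest : ∀ x → Any (λ t → x ≡ t ⊎ Meets U x t) ts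
    nearest x = All.lookup (proj₂ (proj₂ family)) (∈-allFin x)
    κ : Fin p → Fin K
    κ x = inject≤ (Any.index (nearest x)) few
    same-colour : ∀ s s′ → κ s ≡ κ s′ → ∃ λ t → (s ≡ t ⊎ Meets U s t) × (s′ ≡ t ⊎ Meets U s′ t)
    same-colour s s′ e = List.lookup ts (Any.index (nearest s)) , lookup-index (nearest s) ,
      subst (λ i → s′ ≡ List.lookup ts i ⊎ Meets U s′ (List.lookup ts i))
          (sym (inject≤-injective few few _ _ e)) (lookup-index (nearest s′))

module AlmostPeriods (p : ℕ) ⦃ p≢0 : ℕ.NonZero p ⦄ (A : Subset p) (c₁ c₂ c₃ : ℤ)
    (c-sum : c₁ ℤ.+ c₂ ℤ.+ c₃ ≡ 0ℤ)
                     (inv₁ : Residues.Invertible p c₁) (inv₂ : Residues.Invertible p c₂)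
                         (inv₃ : Residues.Invertible p c₃) where
  open Residues p
  open Triple p A c₁ c₂ c₃ c-sum inv₁ inv₂ inv₃

  -- L¹ distance between the columns of `Q`; `v` is an almost period when `dist v 0ℤ` is small.
  dist : ℤ → ℤ → ℚ
  dist v v′ = ∑ λ (u : Fin p) → ℚ.∣ Q (ι u) v - Q (ι u) v′ ∣

  Q-cong : ∀ {u u′ v v′} → u ≈ u′ → v ≈ v′ → Q u v ≡ Q u′ v′
  Q-cong {u} {u′} {v} {v′} e f = ∑-cong (λ w → cong₂ (λ b c → 𝟙 b * 𝟙 c)
      (a-cong (≈-by (ℤ.- c₃) f (lemma c₂ c₃ v v′ (ι w)))) (a-cong (≈-by c₃ e (lemma′ c₁ c₃ u u′ (ι w)))))
    where
    lemma : ∀ c₂ c₃ v v′ w → c₂ ℤ.* w ℤ.- c₃ ℤ.* v ℤ.- (c₂ ℤ.* w ℤ.- c₃ ℤ.* v′) ≡ (ℤ.- c₃) ℤ.* (v ℤ.- v′)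
    lemma = ℤSolver.solve-∀
    lemma′ : ∀ c₁ c₃ u u′ w → ℤ.- c₁ ℤ.* w ℤ.+ c₃ ℤ.* u ℤ.- (ℤ.- c₁ ℤ.* w ℤ.+ c₃ ℤ.* u′) ≡ c₃ ℤ.* (u ℤ.- u′)
    lemma′ = ℤSolver.solve-∀

  -- Substitute `w + c₃h` for `w`: the triple moves along the coefficient vector. This is what makes
  -- `dist` translation invariant.
  Q-shift : ∀ u v h → Q (u ℤ.+ c₁ ℤ.* h) (v ℤ.+ c₂ ℤ.* h) ≡ Q u v
  Q-shift u v h = trans (sym (∑-affine 1-invertible (c₃ ℤ.* h)
      (λ w → 𝟙 (a (X (v ℤ.+ c₂ ℤ.* h) (ι w))) * 𝟙 (a (Y (u ℤ.+ c₁ ℤ.* h) (ι w))))))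
      (∑-cong (λ w → cong₂ (λ b c → 𝟙 b * 𝟙 c)
        (a-cong (≈-by c₂ (ι-red (ℤ.1ℤ ℤ.* ι w ℤ.+ c₃ ℤ.* h)) (lemma c₂ c₃ v h (ι w)
            (ι (red (ℤ.1ℤ ℤ.* ι w ℤ.+ c₃ ℤ.* h))))))
        (a-cong (≈-by (ℤ.- c₁) (ι-red (ℤ.1ℤ ℤ.* ι w ℤ.+ c₃ ℤ.* h))
            (lemma′ c₁ c₃ u h (ι w) (ι (red (ℤ.1ℤ ℤ.* ι w ℤ.+ c₃ ℤ.* h))))))))
    where
    lemma : ∀ c₂ c₃ v h w w′ → c₂ ℤ.* w′ ℤ.- c₃ ℤ.* (v ℤ.+ c₂ ℤ.* h) ℤ.- (c₂ ℤ.* w ℤ.- c₃ ℤ.* v) ≡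
        c₂ ℤ.* (w′ ℤ.- (ℤ.1ℤ ℤ.* w ℤ.+ c₃ ℤ.* h))
    lemma = ℤSolver.solve-∀
    lemma′ : ∀ c₁ c₃ u h w w′ → ℤ.- c₁ ℤ.* w′ ℤ.+ c₃ ℤ.* (u ℤ.+ c₁ ℤ.* h) ℤ.- (ℤ.- c₁ ℤ.* w ℤ.+ c₃ ℤ.* u) ≡
        (ℤ.- c₁) ℤ.* (w′ ℤ.- (ℤ.1ℤ ℤ.* w ℤ.+ c₃ ℤ.* h))
    lemma′ = ℤSolver.solve-∀

  dist-cong : ∀ {v v′ w w′} → v ≈ w → v′ ≈ w′ → dist v v′ ≡ dist w w′
  dist-cong e f = ∑-cong (λ u → cong₂ (λ x y → ℚ.∣ x - y ∣) (Q-cong ≈-refl e) (Q-cong ≈-refl f))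

  dist-sym : ∀ v w → dist v w ≡ dist w v
  dist-sym v w = ∑-cong (λ u → ∣a-b∣≡∣b-a∣ (Q (ι u) v) (Q (ι u) w))

  dist-triangle : ∀ v w x → dist v x ≤ dist v w + dist w x
  dist-triangle v w x = ≤-eq (∑-mono (λ u → ∣a-c∣≤ (Q (ι u) v) (Q (ι u) w) (Q (ι u) x))) (∑-distrib-+ _ _)

  dist-self : ∀ v → dist v v ≡ 0ℚ
  dist-self v = trans (∑-cong (λ u → cong ℚ.∣_∣ (+-inverseʳ (Q (ι u) v)))) (∑-zero p)

  dist-shift-c₂ : ∀ v w h → dist (v ℤ.+ c₂ ℤ.* h) (w ℤ.+ c₂ ℤ.* h) ≡ dist v w
  dist-shift-c₂ v w h = trans (sym (∑-affine 1-invertible (c₁ ℤ.* h)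
      (λ u → ℚ.∣ Q (ι u) (v ℤ.+ c₂ ℤ.* h) - Q (ι u) (w ℤ.+ c₂ ℤ.* h) ∣)))
    (∑-cong (λ u → cong₂ (λ x y → ℚ.∣ x - y ∣) (shifted u v) (shifted u w)))
    where
    shifted : ∀ u v → Q (ι (red (ℤ.1ℤ ℤ.* ι u ℤ.+ c₁ ℤ.* h))) (v ℤ.+ c₂ ℤ.* h) ≡ Q (ι u) v
    shifted u v = trans (Q-cong (≈-trans (ι-red _) (≈-reflexive
        (cong (ℤ._+ c₁ ℤ.* h) (ℤ.*-identityˡ (ι u))))) ≈-refl) (Q-shift (ι u) v h)

  dist-shift : ∀ v w h → dist (v ℤ.+ h) (w ℤ.+ h) ≡ dist v w
  dist-shift v w h = trans (dist-cong (via-c₂ v) (via-c₂ w)) (dist-shift-c₂ v w (proj₁ inv₂ ℤ.* h))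
    where
    i = proj₁ inv₂
    via-c₂ : ∀ v → v ℤ.+ h ≈ v ℤ.+ c₂ ℤ.* (i ℤ.* h)
    via-c₂ v = ≈-by (ℤ.- h) (proj₂ inv₂) (lemma c₂ i v h)
      where
      lemma : ∀ c i v h → v ℤ.+ h ℤ.- (v ℤ.+ c ℤ.* (i ℤ.* h)) ≡ (ℤ.- h) ℤ.* (i ℤ.* c ℤ.- ℤ.1ℤ)
      lemma = ℤSolver.solve-∀

  dist-+ : ∀ v w → dist (v ℤ.+ w) 0ℤ ≤ dist v 0ℤ + dist w 0ℤ
  dist-+ v w = ≤-trans (dist-triangle (v ℤ.+ w) (0ℤ ℤ.+ w) 0ℤ)
      (≤-reflexive (cong₂ _+_ (dist-shift v 0ℤ w) (dist-cong (≈-reflexive (ℤ.+-identityˡ w)) ≈-refl)))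

  dist-difference : ∀ v w → dist (v ℤ.- w) 0ℤ ≡ dist v w
  dist-difference v w = trans (sym (dist-shift (v ℤ.- w) 0ℤ w))
      (dist-cong (≈-reflexive (lemma v w)) (≈-reflexive (ℤ.+-identityˡ w)))
    where
    lemma : ∀ v w → v ℤ.- w ℤ.+ w ≡ v
    lemma = ℤSolver.solve-∀

  -- Drop the weight of z, at most 1, and sum over u first: every `v` then contributes
  -- `dist (v + s) v`, which is `dist s 0` by invariance.
  T₃-Lipschitz : ∀ s → T₃ 0ℤ ≤ T₃ s + N * dist s 0ℤ
  T₃-Lipschitz s = ≤-by-diff (diff-nonNeg difference) (rearrange (T₃ 0ℤ) (T₃ s) (N * dist s 0ℤ))
    where
    rearrange : ∀ a b c → b + c - a ≡ c - (a - b)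
    rearrange = RingSolver.solve-∀ ℚ-ring
    pointwise : ∀ b x y → 𝟙 b * x - 𝟙 b * y ≤ ℚ.∣ y - x ∣
    pointwise true  x y = eq-≤ (cong₂ _-_ (*-identityˡ x) (*-identityˡ y))
        (≤-trans (a≤∣a∣ (x - y)) (≤-reflexive (∣a-b∣≡∣b-a∣ x y)))
    pointwise false x y = eq-≤ (cong₂ _-_ (*-zeroˡ x) (*-zeroˡ y)) (0≤∣p∣ (y - x))
    difference : T₃ 0ℤ - T₃ s ≤ N * dist s 0ℤ
    difference = begin
      T₃ 0ℤ - T₃ s                                                               ≡⟨ ∑∑-distrib-- _ _ ⟨
      ∑∑ (λ u v → 𝟙 (a (Z (ι u) (ι v))) * Q (ι u) (ι v ℤ.+ 0ℤ) - 𝟙 (a (Z (ι u) (ι v))) * Q (ι u) (ι v ℤ.+ s))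
        ≤⟨ ∑∑-mono (λ u v → pointwise (a (Z (ι u) (ι v))) (Q (ι u) (ι v ℤ.+ 0ℤ)) (Q (ι u) (ι v ℤ.+ s))) ⟩
      ∑∑ (λ (u v : Fin p) → ℚ.∣ Q (ι u) (ι v ℤ.+ s) - Q (ι u) (ι v ℤ.+ 0ℤ) ∣)     ≡⟨ ∑-comm _ ⟩
      ∑ (λ (v : Fin p) → dist (ι v ℤ.+ s) (ι v ℤ.+ 0ℤ))                           ≡⟨
          ∑-cong (λ v → trans (cong₂ dist (ℤ.+-comm (ι v) s) (ℤ.+-comm (ι v) 0ℤ)) (dist-shift s 0ℤ (ι v))) ⟩
      ∑ (λ (_ : Fin p) → dist s 0ℤ)                                               ≡⟨ ∑-const p (dist s 0ℤ) ⟩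
      N * dist s 0ℤ                                                               ∎
      where open ≤-Reasoning

-- Colour classes whose differences are almost periods

module PeriodParameters (ζ : ℚ) (0<ζ : 0ℚ < ζ) where
  -- A typical point deviates by at most `4N²η`. Two typical points of one cell are then `8N²η`
  -- apart, and two points of one colour, each compared with a common third point, `16N²η = N²ζ`.
  η : ℚ
  η = ζ * (+ 1 / 16)

  0<η : 0ℚ < η
  0<η = 0<a*b 0<ζ (positive⁻¹ (+ 1 / 16))

  fuel M K : ℕ
  fuel = proj₁ (archimedean′ 1ℚ (0<a*b 0<η 0<η))
  M    = cells fuel 1
  K    = suc M ℕ.+ (suc M ℕ.+ (suc M ℕ.+ suc M))

module PeriodColouring (ζ : ℚ) (0<ζ : 0ℚ < ζ) (p : ℕ) ⦃ p≢0 : ℕ.NonZero p ⦄ (A : Subset p) (c₁ c₂ c₃ : ℤ)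
    (c-sum : c₁ ℤ.+ c₂ ℤ.+ c₃ ≡ 0ℤ)
                     (inv₁ : Residues.Invertible p c₁) (inv₂ : Residues.Invertible p c₂)
                         (inv₃ : Residues.Invertible p c₃) where
  open Residues p
  open Triple p A c₁ c₂ c₃ c-sum inv₁ inv₂ inv₃
  open AlmostPeriods p A c₁ c₂ c₃ c-sum inv₁ inv₂ inv₃
  open PeriodParameters ζ 0<ζ

  -- Only the factor with `X` is regularised. The factor with `Y` enters as a weight of the cut
  -- norm, so one partition serves every `u`.
  F : Fin 1 → Fin p → Fin p → ℚ
  F _ v w = 𝟙 (a (X (ι v) (ι w)))

  open Regularity {p} {1} F (λ _ v w → Unit-𝟙 (a (X (ι v) (ι w))))
  open Weak η 0<η 0<N using (weak-regularity)

  regular : Σ (Refinement {1} (λ _ → zero) (λ _ _ _ → 0ℚ) M) λ R → ∀ i →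
      Uniform (F i) (lift (Refinement.π′ R) (Refinement.G′ R i)) (N * N * η)
  regular = weak-regularity fuel {1} (λ _ → zero) (λ _ _ _ → 0ℚ) (λ _ _ _ → ≤-refl , 0≤1)
    (≤-trans (∑-≤-const (λ i → energy≤ (F i) (λ _ _ → 0ℚ) (λ v w → Unit-𝟙 (a (X (ι v) (ι w))))
        (λ _ _ → ≤-refl , 0≤1)))
      (≤-eq (*-monoʳ (0≤a² N) (proj₂ (archimedean′ 1ℚ (0<a*b 0<η 0<η)))) (lemma (ℕ⇒ℚ fuel) (η * η) (N * N))))
    where
    lemma : ∀ j c m → j * c * m ≡ j * (m * c)
    lemma = RingSolver.solve-∀ ℚ-ring

  π : Fin p → Fin M
  π = Refinement.π′ (proj₁ regular)

  G : Fin M → Fin M → ℚ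
  G = Refinement.G′ (proj₁ regular) zero

  -- The approximate value of Q u v; it depends only on the cell of v.
  profile : Fin M → Fin p → ℚ
  profile b u = ∑ λ w → G b (π w) * 𝟙 (a (Y (ι u) (ι w)))

  deviation : Fin p → ℚ
  deviation v = ∑ λ u → ℚ.∣ Q (ι u) (ι v) - profile (π v) u ∣

  ∑-deviation : ∑ deviation ≤ N * (N * N * η + N * N * η)
  ∑-deviation = eq-≤ (trans (∑-comm _) (∑∑-cong (λ u v → cong ℚ.∣_∣ (difference u v))))
    (∑-≤-const (λ u → Uniform-abs (F zero) (lift π G) (proj₂ regular zero) (λ w → 𝟙 (a (Y (ι u) (ι w))))
        (λ w → Unit-𝟙 (a (Y (ι u) (ι w))))))
    where
    factor : ∀ x g y → x * y - g * y ≡ (x - g) * y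
    factor = RingSolver.solve-∀ ℚ-ring
    difference : ∀ u v → Q (ι u) (ι v) - profile (π v) u ≡ ∑ (λ w →
        (F zero v w - lift π G v w) * 𝟙 (a (Y (ι u) (ι w))))
    difference u v = trans (sym (∑-distrib-- _ _)) (∑-cong (λ w →
        factor (F zero v w) (G (π v) (π w)) (𝟙 (a (Y (ι u) (ι w))))))

  bound : ℚ
  bound = N * N * (ℕ⇒ℚ 4 * η)

  0<bound : 0ℚ < bound
  0<bound = 0<a*b (0<a*b 0<N 0<N) (0<a*b (0<ℕ⇒ℚ 4) 0<η)

  typical : Fin p → Bool
  typical v = does (deviation v ≤? bound)

  -- Markov's inequality.
  half-typical : N * ½ ≤ ∑ (λ v → 𝟙 (typical v))
  half-typical = *-cancelˡ-≤-pos bound ⦃ positive 0<bound ⦄ (≤-by-diff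
      (diff-nonNeg (≤-trans lower ∑-deviation)) (lemma N η (∑ (λ v → 𝟙 (typical v)))))
    where
    lemma : ∀ n η d → n * n * ((+ 4 / 1) * η) * d - n * n * ((+ 4 / 1) * η) * (n * ½) ≡
        n * (n * n * η + n * n * η) - (n * (n * n * ((+ 4 / 1) * η)) - n * n * ((+ 4 / 1) * η) * d)
    lemma = RingSolver.solve-∀ ℚ-ring
    pointwise : ∀ {e} → 0ℚ ≤ e → (d : Dec (e ≤ bound)) → bound - bound * 𝟙 (does d) ≤ e
    pointwise 0≤e (yes _) = eq-≤ (trans (cong (λ z → bound - z) (*-identityʳ bound)) (+-inverseʳ bound)) 0≤e
    pointwise 0≤e (no q)  = eq-≤ (trans (cong (λ z → bound - z) (*-zeroʳ bound)) (+-identityʳ bound))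
        (<⇒≤ (≰⇒> q))
    lower : N * bound - bound * ∑ (λ v → 𝟙 (typical v)) ≤ ∑ deviation
    lower = eq-≤ (sym (trans (∑-distrib-- _ _) (cong₂ _-_ (∑-const p bound) (sym (*-distribˡ-∑ bound _)))))
      (∑-mono (λ v → pointwise (∑-nonNeg (λ u → 0≤∣p∣ (Q (ι u) (ι v) - profile (π v) u)))
          (deviation v ≤? bound)))

  -- Pigeonhole: half of the points are typical, so one of the `M` cells holds `N/(2M)` of them. The
  -- weaker `N/(4(M + 1))` gives a strict inequality and fits `K = 4(M + 1)`.
  popular-cell : ∃ λ b → N * ((+ 1 / 4) * inv M) < ∑ (λ v → 𝟙 (π v == b) * 𝟙 (typical v))
  popular-cell = ∑-<⇒∃ _ _ (≤-<-trans (eq-≤ (∑-const M _) (eq-≤ (rearrange (ℕ⇒ℚ M) N (inv M))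
      (*-monoˡ 0≤N (*-monoˡ (nonNegative⁻¹ (+ 1 / 4)) (m*inv≤1 M)))))
    (<-≤-trans (<-by-diff (<-eq (0<a*b 0<N (positive⁻¹ (+ 1 / 4))) (sym (lemma N))))
        (≤-eq half-typical (∑-fibres π (λ _ v → 𝟙 (typical v))))))
    where
    rearrange : ∀ m n i → m * (n * ((+ 1 / 4) * i)) ≡ n * ((+ 1 / 4) * (m * i))
    rearrange = RingSolver.solve-∀ ℚ-ring
    lemma : ∀ n → n * ½ - n * ((+ 1 / 4) * 1ℚ) ≡ n * (+ 1 / 4)
    lemma = RingSolver.solve-∀ ℚ-ring

  -- Its points have columns close to one common profile. The cells of `π` cannot serve as colour
  -- classes, since they may contain atypical points; translates of `U` reach every point.
  U : Fin p → Bool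
  U v = (π v == proj₁ popular-cell) ∧ typical v

  U-large : N < ℕ⇒ℚ (suc K) * ∑ (λ v → 𝟙 (U v))
  U-large = begin-strict
    N                                                                            ≡⟨ *-identityʳ N ⟨
    N * 1ℚ                                                                       ≡⟨
        cong (N *_) (inv-cancel M) ⟨
    N * (inv M * ℕ⇒ℚ (suc M))                                                    ≡⟨
        lemma N (inv M) (ℕ⇒ℚ (suc M)) ⟩
    (m + (m + (m + m))) * (N * ((+ 1 / 4) * inv M))                              <⟨ *-monoʳ-<-pos
        (m + (m + (m + m))) ⦃ positive 0<4m ⦄ (proj₂ popular-cell) ⟩
    (m + (m + (m + m))) * ∑ (λ v → 𝟙 (π v == proj₁ popular-cell) * 𝟙 (typical v)) ≡⟨
        cong₂ _*_ (sym K-value) (∑-cong (λ v → 𝟙-∧ (π v == proj₁ popular-cell) (typical v))) ⟩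
    ℕ⇒ℚ K * ∑ (λ v → 𝟙 (U v))                                                    ≤⟨
        *-monoʳ (∑-nonNeg (λ v → 0≤𝟙 (U v))) (ℕ⇒ℚ-mono (ℕ.n≤1+n K)) ⟩
    ℕ⇒ℚ (suc K) * ∑ (λ v → 𝟙 (U v))                                              ∎
    where
    open ≤-Reasoning
    m : ℚ
    m = ℕ⇒ℚ (suc M)
    0<m : 0ℚ < m
    0<m = 0<ℕ⇒ℚ (suc M)
    0<4m : 0ℚ < m + (m + (m + m))
    0<4m = +-mono-< 0<m (+-mono-< 0<m (+-mono-< 0<m 0<m))
    K-value : ℕ⇒ℚ K ≡ m + (m + (m + m))
    K-value = trans (ℕ⇒ℚ-+ (suc M) _) (cong (_+_ m) (trans (ℕ⇒ℚ-+ (suc M) _)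
        (cong (_+_ m) (ℕ⇒ℚ-+ (suc M) (suc M)))))
    lemma : ∀ n i m → n * (i * m) ≡ (m + (m + (m + m))) * (n * ((+ 1 / 4) * i))
    lemma = RingSolver.solve-∀ ℚ-ring
    𝟙-∧ : ∀ b c → 𝟙 b * 𝟙 c ≡ 𝟙 (b ∧ c)
    𝟙-∧ true  c = *-identityˡ (𝟙 c)
    𝟙-∧ false c = *-zeroˡ (𝟙 c)

  U-close : ∀ {v w} → U v ≡ true → U w ≡ true → dist (ι v) (ι w) ≤ bound + bound
  U-close {v} {w} ev ew = begin
    dist (ι v) (ι w)
      ≤⟨ ∑-mono (λ u → ∣a-c∣≤ (Q (ι u) (ι v)) (profile (π v) u) (Q (ι u) (ι w))) ⟩
    ∑ (λ u → ℚ.∣ Q (ι u) (ι v) - profile (π v) u ∣ + ℚ.∣ profile (π v) u - Q (ι u) (ι w) ∣)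
      ≡⟨ ∑-distrib-+ _ _ ⟩
    deviation v + ∑ (λ u → ℚ.∣ profile (π v) u - Q (ι u) (ι w) ∣)
      ≡⟨ cong (_+_ (deviation v)) (∑-cong (λ u →
          trans (cong (λ b → ℚ.∣ profile b u - Q (ι u) (ι w) ∣) same-cell)
          (∣a-b∣≡∣b-a∣ (profile (π w) u) (Q (ι u) (ι w))))) ⟩
    deviation v + deviation w
      ≤⟨ +-mono-≤ (does-true (deviation v ≤? bound) (proj₂ (∧-both (π v == proj₁ popular-cell) ev)))
          (does-true (deviation w ≤? bound) (proj₂ (∧-both (π w == proj₁ popular-cell) ew))) ⟩
    bound + bound ∎
    where
    open ≤-Reasoning
    ∧-both : ∀ b {c} → b ∧ c ≡ true → b ≡ true × c ≡ true
    ∧-both true {true} _ = refl , refl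
    same-cell : π v ≡ π w
    same-cell = trans (does-true (π v Fin.≟ _) (proj₁ (∧-both (π v == proj₁ popular-cell) ev)))
        (sym (does-true (π w Fin.≟ _) (proj₁ (∧-both (π w == proj₁ popular-cell) ew))))

  -- Translation by `v - s - t` carries s and t to `v - t` and `v - s`, both in `U`.
  meets⇒close : ∀ {s t} → s ≡ t ⊎ Meets p U s t → dist (ι s) (ι t) ≤ bound + bound
  meets⇒close {s} (inj₁ refl) = eq-≤ (dist-self (ι s)) (0≤a+b (<⇒≤ 0<bound) (<⇒≤ 0<bound))
  meets⇒close {s} {t} (inj₂ (v , es , et)) =
      eq-≤ (trans (sym (dist-shift (ι s) (ι t) h)) (dist-cong
      (≈-trans (≈-reflexive (lemma (ι s) (ι t) (ι v))) (≈-sym (ι-red _)))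
      (≈-trans (≈-reflexive (lemma′ (ι s) (ι t) (ι v))) (≈-sym (ι-red _)))))
      (U-close et es)
    where
    h = ι v ℤ.- ι s ℤ.- ι t
    lemma : ∀ s t v → s ℤ.+ (v ℤ.- s ℤ.- t) ≡ v ℤ.- t
    lemma = ℤSolver.solve-∀
    lemma′ : ∀ s t v → t ℤ.+ (v ℤ.- s ℤ.- t) ≡ v ℤ.- s
    lemma′ = ℤSolver.solve-∀

  colouring : ∃ λ (κ : Fin p → Fin K) → ∀ s s′ → κ s ≡ κ s′ → dist (ι s) (ι s′) ≤ N * N * ζ
  colouring = proj₁ cover , λ s s′ e → close s s′ (proj₂ cover s s′ e)
    where
    cover = translates-cover p U K U-large
    close : ∀ s s′ → (∃ λ t → (s ≡ t ⊎ Meets p U s t) × (s′ ≡ t ⊎ Meets p U s′ t)) → dist (ι s) (ι s′) ≤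
        N * N * ζ
    close s s′ (t , m , m′) = ≤-trans (dist-triangle (ι s) (ι t) (ι s′))
      (≤-eq (+-mono-≤ (meets⇒close m) (eq-≤ (dist-sym (ι t) (ι s′)) (meets⇒close m′))) (lemma (N * N) ζ))
      where
      lemma : ∀ m z → m * ((+ 4 / 1) * (z * (+ 1 / 16))) + m * ((+ 4 / 1) * (z * (+ 1 / 16))) +
          (m * ((+ 4 / 1) * (z * (+ 1 / 16))) + m * ((+ 4 / 1) * (z * (+ 1 / 16)))) ≡ m * z
      lemma = RingSolver.solve-∀ ℚ-ring

-- Solutions with distinct entries

module Solutions (p : ℕ) ⦃ _ : ℕ.NonZero p ⦄ where
  open Residues p

  -- Fb lists the values that may no longer be used.
  Sol : List ℤ → Subset p → List (Fin p) → ℤ → Set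
  Sol []       A Fb t = t ≈ 0ℤ
  Sol (c ∷ cs) A Fb t = ∃ λ (x : Fin p) → x ∈ A × x ∉ₗ Fb × Sol cs A (x ∷ Fb) (t ℤ.- c ℤ.* ι x)

  Sol-cong : ∀ cs {A Fb t t′} → t ≈ t′ → Sol cs A Fb t → Sol cs A Fb t′
  Sol-cong []       e q = ≈-trans (≈-sym e) q
  Sol-cong (c ∷ cs) e (x , x∈ , x∉ , q) = x , x∈ , x∉ , Sol-cong cs (+-cong-≈ e ≈-refl) q

  Sol-mono : ∀ cs {A Fb Fb′ t} → (∀ {x} → x ∈ₗ Fb′ → x ∈ₗ Fb) → Sol cs A Fb t → Sol cs A Fb′ t
  Sol-mono []       f q = q
  Sol-mono (c ∷ cs) f (x , x∈ , x∉ , q) = x , x∈ , (λ x∈Fb′ → x∉ (f x∈Fb′)) ,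
    Sol-mono cs (λ { (here e) → here e ; (there m) → there (f m) }) q

  Sol-↭ : ∀ {cs ds} → cs ↭ ds → ∀ {A Fb t} → Sol cs A Fb t → Sol ds A Fb t
  Sol-↭ Perm.refl q = q
  Sol-↭ (prep c r) (x , x∈ , x∉ , q) = x , x∈ , x∉ , Sol-↭ r q
  Sol-↭ (swap {ys = ds} c d r) {t = t} (x , x∈ , x∉ , y , y∈ , y∉ , q) =
    y , y∈ , (λ m → y∉ (there m)) , x , x∈ , (λ { (here e) → y∉ (here (sym e)) ; (there m) → x∉ m }) ,
    Sol-mono ds (λ { (here e) → there (here e) ; (there (here e)) → here e ; (there (there m)) →
        there (there m) })
      (Sol-cong ds (≈-reflexive (lemma t (c ℤ.* ι x) (d ℤ.* ι y))) (Sol-↭ r q))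
    where
    lemma : ∀ t x y → t ℤ.- x ℤ.- y ≡ t ℤ.- y ℤ.- x
    lemma = ℤSolver.solve-∀
  Sol-↭ (Perm.trans r r′) q = Sol-↭ r′ (Sol-↭ r q)

  -- The merged variable stands last: x and y are chosen when all other entries are already in `Fb`,
  -- so they can avoid them. The value z which they replace is not an entry of the new solution.
  Sol-split : ∀ {A A′ c d} m → (∀ {z} → z ∈ A′ → z ∈ A) →
    (∀ {z} → z ∈ A′ → ∀ Fb → length Fb ℕ.≤ m → ∃ λ x → ∃ λ y → x ∈ A × y ∈ A × x ∉ₗ Fb × y ∉ₗ Fb × ¬ x ≡
        y × c ℤ.* ι x ℤ.+ d ℤ.* ι y ≈ (c ℤ.+ d) ℤ.* ι z) →
    ∀ rest {Fb t} → length Fb ℕ.+ length rest ℕ.≤ m → Sol (rest ++ (c ℤ.+ d) ∷ []) A′ Fb t →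
        Sol (rest ++ c ∷ d ∷ []) A Fb t
  Sol-split {c = c} {d} m sub expand [] {Fb} {t} len (z , z∈ , _ , q) =
      from-pair (expand z∈ Fb (subst (ℕ._≤ m) (ℕ.+-identityʳ (length Fb)) len))
    where
    from-pair : (∃ λ x → ∃ λ y → x ∈ _ × y ∈ _ × x ∉ₗ Fb × y ∉ₗ Fb × ¬ x ≡ y × c ℤ.* ι x ℤ.+ d ℤ.* ι y ≈
        (c ℤ.+ d) ℤ.* ι z) → Sol (c ∷ d ∷ []) _ Fb t
    from-pair (x , y , x∈ , y∈ , x∉ , y∉ , x≢y , e) = x , x∈ , x∉ , y , y∈ ,
        (λ { (here e′) → x≢y (sym e′) ; (there m) → y∉ m }) ,
      ≈-by₂ ℤ.-1ℤ ℤ.1ℤ e q (lemma t (c ℤ.* ι x) (d ℤ.* ι y) ((c ℤ.+ d) ℤ.* ι z))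
      where
      lemma : ∀ t x y z → t ℤ.- x ℤ.- y ℤ.- 0ℤ ≡ ℤ.-1ℤ ℤ.* (x ℤ.+ y ℤ.- z) ℤ.+ ℤ.1ℤ ℤ.* (t ℤ.- z ℤ.- 0ℤ)
      lemma = ℤSolver.solve-∀
  Sol-split m sub expand (r ∷ rest) {Fb} len (x , x∈ , x∉ , q) = x , sub x∈ , x∉ ,
    Sol-split m sub expand rest (subst (ℕ._≤ m) (ℕ.+-suc (length Fb) (length rest)) len) q

  total : List (Fin p × Fin p) → ℤ
  total []             = 0ℤ
  total ((s , s′) ∷ ts) = ι s ℤ.- ι s′ ℤ.+ total ts

  SameColour : ∀ {K} → (Fin p → Fin K) → List (Fin p × Fin p) → Set
  SameColour κ = All (λ s → κ (proj₁ s) ≡ κ (proj₂ s))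

-- Zero-sum equations with a perturbed right-hand side

sumℤ : List ℤ → ℤ
sumℤ = foldr ℤ._+_ 0ℤ

NonZeroℤ : ℤ → Set
NonZeroℤ c = ¬ c ≡ 0ℤ

Dense : ∀ {p} → Subset p → ℚ → Set
Dense {p} A ε = ℕ⇒ℚ p * ε ≤ ∑ (λ x → 𝟙 (lookup A x))

-- The colour classes of κ play the role of Bohr cells: sums of at most ℓ differences inside
-- classes stand for the elements of a Bohr set.
Representable : List ℤ → Set
Representable cs = ∀ ε → 0ℚ < ε → ∀ L ℓ → ∃₂ λ K P → ∀ p ⦃ _ : ℕ.NonZero p ⦄ → Prime p → P ℕ.< p →
    (A : Subset p) → Dense A ε →
  ∃ λ (κ : Fin p → Fin K) → ∀ ts → length ts ℕ.≤ ℓ → Solutions.SameColour p κ ts → ∀ Fb → length Fb ℕ.≤ L →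
  Solutions.Sol p cs A Fb (Solutions.total p ts)

Representable-↭ : ∀ {cs ds} → cs ↭ ds → Representable cs → Representable ds
Representable-↭ r rep ε 0<ε L ℓ with rep ε 0<ε L ℓ
... | K , P , f = K , P , λ p p-prime large A dense → proj₁ (f p p-prime large A dense) ,
  λ ts len same Fb lenFb → Solutions.Sol-↭ p r (proj₂ (f p p-prime large A dense) ts len same Fb lenFb)

removal-parameter : ∀ ε → 0ℚ < ε → ∃ λ q → ℕ⇒ℚ 32 * inv q ≤ ε
removal-parameter ε 0<ε = q , ≤-trans (*-monoʳ (<⇒≤ (0<inv q)) (proj₂ found))
    (eq-≤ (lemma (ℕ⇒ℚ q) ε (inv q)) (≤-eq (*-monoˡ (<⇒≤ 0<ε) (m*inv≤1 q)) (*-identityʳ ε)))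
  where
  found = archimedean′ (ℕ⇒ℚ 32) 0<ε
  q = proj₁ found
  lemma : ∀ q e i → q * e * i ≡ e * (q * i)
  lemma = RingSolver.solve-∀ ℚ-ring

module DensityConstants (ε : ℚ) (0<ε : 0ℚ < ε) where
  q : ℕ
  q = proj₁ (removal-parameter ε 0<ε)

  δ : ℚ
  δ = TriangleRemoval.δmin q (TriangleRemoval.fuel q) 1

  0<δ : 0ℚ < δ
  0<δ = TriangleRemoval.0<δmin q (TriangleRemoval.fuel q) 1

  0<½δ : 0ℚ < ½ * δ
  0<½δ = 0<a*b (positive⁻¹ ½) 0<δ

  dense⇒many : ∀ p ⦃ _ : ℕ.NonZero p ⦄ (A : Subset p) c₁ c₂ c₃ c-sum inv₁ inv₂ inv₃ → Dense A ε →
    ℕ⇒ℚ p * (ℕ⇒ℚ p * ℕ⇒ℚ p) * δ ≤ Triple.T₃ p A c₁ c₂ c₃ c-sum inv₁ inv₂ inv₃ 0ℤ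
  dense⇒many p A c₁ c₂ c₃ c-sum inv₁ inv₂ inv₃ dense =
    Triple.many-solutions p A c₁ c₂ c₃ c-sum inv₁ inv₂ inv₃ q
        (≤-trans (*-monoˡ (0≤ℕ⇒ℚ p) (proj₂ (removal-parameter ε 0<ε))) dense)

  size-threshold : ℚ → ℕ
  size-threshold b = proj₁ (archimedean′ b 0<½δ)

  above-threshold : ∀ b {p} → size-threshold b ℕ.< p → b < ℕ⇒ℚ p * (½ * δ)
  above-threshold b {p} large = ≤-<-trans (proj₂ (archimedean′ b 0<½δ))
      (*-monoˡ-<-pos (½ * δ) ⦃ positive 0<½δ ⦄ strict)
    where
    strict : ℕ⇒ℚ (size-threshold b) < ℕ⇒ℚ p
    strict = <-≤-trans (<-by-diff (<-eq (0<ℕ⇒ℚ 1) (sym (trans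
        (cong (_- ℕ⇒ℚ (size-threshold b)) (ℕ⇒ℚ-suc (size-threshold b))) (lemma (ℕ⇒ℚ (size-threshold b)))))))
        (ℕ⇒ℚ-mono large)
      where
      lemma : ∀ m → 1ℚ + m - m ≡ 1ℚ
      lemma = RingSolver.solve-∀ ℚ-ring

three-variables : ∀ c₁ c₂ c₃ → NonZeroℤ c₁ → NonZeroℤ c₂ → NonZeroℤ c₃ → c₁ ℤ.+ c₂ ℤ.+ c₃ ≡ 0ℤ →
    Representable (c₁ ∷ c₂ ∷ c₃ ∷ [])
three-variables c₁ c₂ c₃ c₁≢0 c₂≢0 c₃≢0 c-sum ε 0<ε L ℓ = K , P , represent
  where
  open DensityConstants ε 0<ε
  ζ : ℚ
  -- Each of up to `ℓ` differences moves the count by at most `N³ζ`; together they may use up half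
  -- of `N³δ`.
  ζ = ½ * δ * inv ℓ
  0<ζ : 0ℚ < ζ
  0<ζ = 0<a*b 0<½δ (0<inv ℓ)
  open PeriodParameters ζ 0<ζ using (K)
  bound : ℚ
  bound = ℕ⇒ℚ 3 * (ℕ⇒ℚ L + 1ℚ)
  P : ℕ
  -- The first summand makes the remaining `N³δ/2` exceed the loss to forbidden values; the others
  -- make the coefficients invertible modulo p.
  P = size-threshold bound ℕ.+ (ℤ.∣ c₁ ∣ ℕ.+ (ℤ.∣ c₂ ∣ ℕ.+ ℤ.∣ c₃ ∣))
  represent : ∀ p ⦃ _ : ℕ.NonZero p ⦄ → Prime p → P ℕ.< p → (A : Subset p) → Dense A ε →
    ∃ λ (κ : Fin p → Fin K) → ∀ ts → length ts ℕ.≤ ℓ → Solutions.SameColour p κ ts → ∀ Fb → length Fb ℕ.≤ L →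
    Solutions.Sol p (c₁ ∷ c₂ ∷ c₃ ∷ []) A Fb (Solutions.total p ts)
  represent p p-prime large A dense = κ , solve
    where
    open Residues p
    open Solutions p
    tail₁ = ℤ.∣ c₁ ∣ ℕ.+ (ℤ.∣ c₂ ∣ ℕ.+ ℤ.∣ c₃ ∣)
    tail≤ : tail₁ ℕ.≤ P
    tail≤ = ℕ.m≤n+m tail₁ (size-threshold bound)
    inv₁ : Invertible c₁
    inv₁ = nonzero⇒invertible p-prime c₁≢0 (ℕ.≤-<-trans (ℕ.≤-trans (ℕ.m≤m+n ℤ.∣ c₁ ∣ _) tail≤) large)
    inv₂ : Invertible c₂
    inv₂ = nonzero⇒invertible p-prime c₂≢0 (ℕ.≤-<-trans (ℕ.≤-trans
        (ℕ.≤-trans (ℕ.m≤m+n ℤ.∣ c₂ ∣ _) (ℕ.m≤n+m _ ℤ.∣ c₁ ∣)) tail≤) large)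
    inv₃ : Invertible c₃
    inv₃ = nonzero⇒invertible p-prime c₃≢0 (ℕ.≤-<-trans (ℕ.≤-trans
        (ℕ.≤-trans (ℕ.m≤n+m ℤ.∣ c₃ ∣ _) (ℕ.m≤n+m _ ℤ.∣ c₁ ∣)) tail≤) large)
    open Triple p A c₁ c₂ c₃ c-sum inv₁ inv₂ inv₃
    open AlmostPeriods p A c₁ c₂ c₃ c-sum inv₁ inv₂ inv₃
    periods = PeriodColouring.colouring ζ 0<ζ p A c₁ c₂ c₃ c-sum inv₁ inv₂ inv₃
    scale : Invertible (ℤ.- (c₁ ℤ.* c₃))
    scale = Invertible-neg (Invertible-* inv₁ inv₃)
    e : ℤ
    e = proj₁ scale
    κ : Fin p → Fin K
    -- `T₃ s` belongs to the right-hand side `-c₁c₃s`. Dilating by the inverse `e` of `-c₁c₃` turns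
    -- this into the prescribed total.
    κ s = proj₁ periods (red (e ℤ.* ι s))
    0≤N²ζ : 0ℚ ≤ N * N * ζ
    0≤N²ζ = 0≤a*b (0≤a² N) (<⇒≤ 0<ζ)
    dist-pair : ∀ s s′ → κ s ≡ κ s′ → dist (e ℤ.* (ι s ℤ.- ι s′)) 0ℤ ≤ N * N * ζ
    dist-pair s s′ same = eq-≤ (trans (dist-cong (≈-reflexive (ℤ.*-distribˡ-+ e (ι s) (ℤ.- ι s′))) ≈-refl)
        (trans (cong (λ z → dist (e ℤ.* ι s ℤ.+ z) 0ℤ) (sym (ℤ.neg-distribʳ-* e (ι s′))))
          (trans (dist-difference (e ℤ.* ι s) (e ℤ.* ι s′)) (dist-cong (≈-sym (ι-red _)) (≈-sym (ι-red _))))))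
      (proj₂ periods (red (e ℤ.* ι s)) (red (e ℤ.* ι s′)) same)
    dist-total : ∀ ts → SameColour κ ts → dist (e ℤ.* total ts) 0ℤ ≤ ℕ⇒ℚ (length ts) * (N * N * ζ)
    dist-total [] [] = eq-≤ (trans (dist-cong (≈-reflexive (ℤ.*-zeroʳ e)) ≈-refl) (dist-self 0ℤ))
        (≤-reflexive (sym (*-zeroˡ (N * N * ζ))))
    dist-total ((s , s′) ∷ ts) (same ∷ rest) = begin
      dist (e ℤ.* (ι s ℤ.- ι s′ ℤ.+ total ts)) 0ℤ                      ≡⟨
          cong (λ z → dist z 0ℤ) (ℤ.*-distribˡ-+ e (ι s ℤ.- ι s′) (total ts)) ⟩
      dist (e ℤ.* (ι s ℤ.- ι s′) ℤ.+ e ℤ.* total ts) 0ℤ               ≤⟨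
          dist-+ (e ℤ.* (ι s ℤ.- ι s′)) (e ℤ.* total ts) ⟩
      dist (e ℤ.* (ι s ℤ.- ι s′)) 0ℤ + dist (e ℤ.* total ts) 0ℤ        ≤⟨
          +-mono-≤ (dist-pair s s′ same) (dist-total ts rest) ⟩
      N * N * ζ + ℕ⇒ℚ (length ts) * (N * N * ζ)                        ≡⟨
          lemma (N * N * ζ) (ℕ⇒ℚ (length ts)) ⟩
      (1ℚ + ℕ⇒ℚ (length ts)) * (N * N * ζ)                             ≡⟨
          cong (_* (N * N * ζ)) (sym (ℕ⇒ℚ-suc (length ts))) ⟩
      ℕ⇒ℚ (suc (length ts)) * (N * N * ζ)                              ∎
      where
      open ≤-Reasoning
      lemma : ∀ a m → a + m * a ≡ (1ℚ + m) * a
      lemma = RingSolver.solve-∀ ℚ-ring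
    solve : ∀ ts → length ts ℕ.≤ ℓ → SameColour κ ts → ∀ Fb → length Fb ℕ.≤ L →
        Sol (c₁ ∷ c₂ ∷ c₃ ∷ []) A Fb (total ts)
    solve ts len same Fb lenFb = assemble (choose-triple Fb S enough)
      where
      S : ℤ
      S = e ℤ.* total ts
      dist-small : dist S 0ℤ ≤ N * N * (½ * δ)
      dist-small = begin
        dist S 0ℤ                                  ≤⟨ dist-total ts same ⟩
        ℕ⇒ℚ (length ts) * (N * N * ζ)              ≤⟨ *-monoʳ 0≤N²ζ (ℕ⇒ℚ-mono len) ⟩
        ℕ⇒ℚ ℓ * (N * N * (½ * δ * inv ℓ))          ≡⟨ lemma (ℕ⇒ℚ ℓ) (N * N) (½ * δ) (inv ℓ) ⟩
        N * N * (½ * δ) * (ℕ⇒ℚ ℓ * inv ℓ)          ≤⟨ *-monoˡ (0≤a*b (0≤a² N) (<⇒≤ 0<½δ)) (m*inv≤1 ℓ) ⟩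
        N * N * (½ * δ) * 1ℚ                       ≡⟨ *-identityʳ _ ⟩
        N * N * (½ * δ)                            ∎
        where
        open ≤-Reasoning
        lemma : ∀ l n d i → l * (n * (d * i)) ≡ n * d * (l * i)
        lemma = RingSolver.solve-∀ ℚ-ring
      T₃-large : N * N * (N * (½ * δ)) ≤ T₃ S
      T₃-large = ≤-by-diff (0≤a+b (0≤a+b (diff-nonNeg (dense⇒many p A c₁ c₂ c₃ c-sum inv₁ inv₂ inv₃ dense))
          (diff-nonNeg (T₃-Lipschitz S))) (0≤a*b 0≤N (diff-nonNeg dist-small)))
        (lemma (T₃ 0ℤ) (T₃ S) (dist S 0ℤ) N δ)
        where
        lemma : ∀ t t′ d n δ → t′ - n * n * (n * (½ * δ)) ≡
            t - n * (n * n) * δ + (t′ + n * d - t) + n * (n * n * (½ * δ) - d)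
        lemma = RingSolver.solve-∀ ℚ-ring
      enough : N * N * (ℕ⇒ℚ 3 * (ℕ⇒ℚ (length Fb) + 1ℚ)) < T₃ S
      enough = ≤-<-trans (*-monoˡ (0≤a² N) (*-monoˡ (0≤ℕ⇒ℚ 3) (+-monoˡ-≤ 1ℚ (ℕ⇒ℚ-mono lenFb))))
        (<-≤-trans (*-monoʳ-<-pos (N * N) ⦃ positive (0<a*b 0<N 0<N) ⦄
            (above-threshold bound (ℕ.≤-<-trans (ℕ.m≤m+n (size-threshold bound) tail₁) large))) T₃-large)
      assemble : (∃ λ x → ∃ λ y → ∃ λ z → (x ∈ A × y ∈ A × z ∈ A) × (x ∉ₗ Fb × y ∉ₗ Fb × z ∉ₗ Fb) ×
          (¬ x ≡ y × ¬ x ≡ z × ¬ y ≡ z) ×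
                  c₁ ℤ.* ι x ℤ.+ c₂ ℤ.* ι y ℤ.+ c₃ ℤ.* ι z ≈ ℤ.- (c₁ ℤ.* c₃) ℤ.* S) →
                      Sol (c₁ ∷ c₂ ∷ c₃ ∷ []) A Fb (total ts)
      assemble (x , y , z , (x∈ , y∈ , z∈) , (x∉ , y∉ , z∉) , (x≢y , x≢z , y≢z) , eq) =
        x , x∈ , x∉ , y , y∈ , (λ { (here q) → x≢y (sym q) ; (there m) → y∉ m }) ,
        z , z∈ , (λ { (here q) → y≢z (sym q) ; (there (here q)) → x≢z (sym q) ; (there (there m)) → z∉ m }) ,
        ≈-by₂ ℤ.-1ℤ (ℤ.- total ts) eq (proj₂ scale) (lemma (total ts) (c₁ ℤ.* ι x) (c₂ ℤ.* ι y) (c₃ ℤ.* ι z)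
            (ℤ.- (c₁ ℤ.* c₃)) e)
        where
        lemma : ∀ t x y z c e → t ℤ.- x ℤ.- y ℤ.- z ℤ.- 0ℤ ≡
            ℤ.-1ℤ ℤ.* (x ℤ.+ y ℤ.+ z ℤ.- c ℤ.* (e ℤ.* t)) ℤ.+ (ℤ.- t) ℤ.* (e ℤ.* c ℤ.- ℤ.1ℤ)
        lemma = ℤSolver.solve-∀

-- The merged equation is solved inside the popular elements for `c₁, c₂, -(c₁ + c₂)`, a set of
-- density at least `½δ`, and its last value is then expanded into a pair from `A`. The colouring is
-- the one obtained for the popular set.
merge : ∀ c₁ c₂ rest → NonZeroℤ c₁ → NonZeroℤ c₂ → NonZeroℤ (c₁ ℤ.+ c₂) →
    Representable (rest ++ (c₁ ℤ.+ c₂) ∷ []) → Representable (c₁ ∷ c₂ ∷ rest)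
merge c₁ c₂ rest c₁≢0 c₂≢0 s≢0 rep ε 0<ε L ℓ = K , P , represent
  where
  open DensityConstants ε 0<ε
  c₃ : ℤ
  c₃ = ℤ.- (c₁ ℤ.+ c₂)
  c₃≢0 : NonZeroℤ c₃
  c₃≢0 e = s≢0 (trans (sym (ℤ.neg-involutive (c₁ ℤ.+ c₂))) (cong ℤ.-_ e))
  c-sum : c₁ ℤ.+ c₂ ℤ.+ c₃ ≡ 0ℤ
  c-sum = ℤ.+-inverseʳ (c₁ ℤ.+ c₂)
  m : ℕ
  -- Forbidden values at the moment of expansion: the given ones and the entries for `rest`.
  m = L ℕ.+ length rest
  bound : ℚ
  bound = ℕ⇒ℚ m + ℕ⇒ℚ m + 1ℚ
  inner = rep (½ * δ) 0<½δ L ℓ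
  K = proj₁ inner
  P : ℕ
  P = proj₁ (proj₂ inner) ℕ.+ (size-threshold bound ℕ.+ (ℤ.∣ c₁ ∣ ℕ.+ (ℤ.∣ c₂ ∣ ℕ.+ ℤ.∣ c₃ ∣)))
  represent : ∀ p ⦃ _ : ℕ.NonZero p ⦄ → Prime p → P ℕ.< p → (A : Subset p) → Dense A ε →
    ∃ λ (κ : Fin p → Fin K) → ∀ ts → length ts ℕ.≤ ℓ → Solutions.SameColour p κ ts → ∀ Fb → length Fb ℕ.≤ L →
    Solutions.Sol p (c₁ ∷ c₂ ∷ rest) A Fb (Solutions.total p ts)
  represent p p-prime large A dense = proj₁ coloured , λ ts len same Fb lenFb →
      Sol-↭ (++-comm rest (c₁ ∷ c₂ ∷ [])) (Sol-split m A′⊆A expand′ rest (ℕ.+-monoˡ-≤ (length rest) lenFb)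
          (proj₂ coloured ts len same Fb lenFb))
    where
    open Residues p
    open Solutions p
    tail₁ = ℤ.∣ c₁ ∣ ℕ.+ (ℤ.∣ c₂ ∣ ℕ.+ ℤ.∣ c₃ ∣)
    tail₀ = size-threshold bound ℕ.+ tail₁
    tail₀≤ : tail₀ ℕ.≤ P
    tail₀≤ = ℕ.m≤n+m tail₀ (proj₁ (proj₂ inner))
    tail≤ : tail₁ ℕ.≤ P
    tail≤ = ℕ.≤-trans (ℕ.m≤n+m tail₁ (size-threshold bound)) tail₀≤
    inv₁ : Invertible c₁
    inv₁ = nonzero⇒invertible p-prime c₁≢0 (ℕ.≤-<-trans (ℕ.≤-trans (ℕ.m≤m+n ℤ.∣ c₁ ∣ _) tail≤) large)
    inv₂ : Invertible c₂
    inv₂ = nonzero⇒invertible p-prime c₂≢0 (ℕ.≤-<-trans (ℕ.≤-trans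
        (ℕ.≤-trans (ℕ.m≤m+n ℤ.∣ c₂ ∣ _) (ℕ.m≤n+m _ ℤ.∣ c₁ ∣)) tail≤) large)
    inv₃ : Invertible c₃
    inv₃ = nonzero⇒invertible p-prime c₃≢0 (ℕ.≤-<-trans (ℕ.≤-trans
        (ℕ.≤-trans (ℕ.m≤n+m ℤ.∣ c₃ ∣ _) (ℕ.m≤n+m _ ℤ.∣ c₁ ∣)) tail≤) large)
    open Triple p A c₁ c₂ c₃ c-sum inv₁ inv₂ inv₃
    open Popular δ
    coloured = proj₂ (proj₂ inner) p p-prime (ℕ.≤-<-trans (ℕ.m≤m+n (proj₁ (proj₂ inner)) tail₀) large) A′
      (A′-dense (<⇒≤ 0<δ) (dense⇒many p A c₁ c₂ c₃ c-sum inv₁ inv₂ inv₃ dense))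
    expand′ : ∀ {z} → z ∈ A′ → ∀ Fb → length Fb ℕ.≤ m → ∃ λ x → ∃ λ y →
        x ∈ A × y ∈ A × x ∉ₗ Fb × y ∉ₗ Fb × ¬ x ≡ y × c₁ ℤ.* ι x ℤ.+ c₂ ℤ.* ι y ≈ (c₁ ℤ.+ c₂) ℤ.* ι z
    expand′ z∈ Fb len = expand z∈ Fb (≤-<-trans (+-monoˡ-≤ 1ℚ (+-mono-≤ (ℕ⇒ℚ-mono len) (ℕ⇒ℚ-mono len)))
      (above-threshold bound (ℕ.≤-<-trans (ℕ.≤-trans (ℕ.m≤m+n (size-threshold bound) tail₁) tail₀≤) large)))

sumℤ-∷ʳ : ∀ cs c → sumℤ (cs ++ c ∷ []) ≡ sumℤ cs ℤ.+ c
sumℤ-∷ʳ []       c = trans (ℤ.+-identityʳ c) (sym (ℤ.+-identityˡ c))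
sumℤ-∷ʳ (d ∷ cs) c = trans (cong (ℤ._+_ d) (sumℤ-∷ʳ cs c)) (sym (ℤ.+-assoc d (sumℤ cs) c))

-- Merging shortens the list, keeps its sum zero and, if the pair has nonzero sum, keeps the
-- coefficients nonzero. Such a pair exists among the first three; a permutation brings it to the
-- front.
zero-sum⇒representable : ∀ m cs → length cs ≡ 3 ℕ.+ m → All NonZeroℤ cs → sumℤ cs ≡ 0ℤ → Representable cs
zero-sum⇒representable zero (c₁ ∷ c₂ ∷ c₃ ∷ []) _ (n₁ ∷ n₂ ∷ n₃ ∷ []) z =
    three-variables c₁ c₂ c₃ n₁ n₂ n₃ (trans (lemma c₁ c₂ c₃) z)
  where
  lemma : ∀ a b c → a ℤ.+ b ℤ.+ c ≡ a ℤ.+ (b ℤ.+ (c ℤ.+ 0ℤ))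
  lemma = ℤSolver.solve-∀
zero-sum⇒representable (suc m) (c₁ ∷ c₂ ∷ c₃ ∷ rest) len (n₁ ∷ n₂ ∷ n₃ ∷ ns) z =
    cases (c₁ ℤ.+ c₂ ℤ.≟ 0ℤ) (c₁ ℤ.+ c₃ ℤ.≟ 0ℤ)
  where
  merge-first : ∀ a b c → NonZeroℤ a → NonZeroℤ b → NonZeroℤ c → NonZeroℤ (a ℤ.+ b) →
      a ℤ.+ (b ℤ.+ (c ℤ.+ sumℤ rest)) ≡ 0ℤ → Representable (a ∷ b ∷ c ∷ rest)
  merge-first a b c na nb nc ns′ z′ = merge a b (c ∷ rest) na nb ns′
    (zero-sum⇒representable m (c ∷ rest ++ (a ℤ.+ b) ∷ [])
      (trans (cong suc (trans (List.length-++ rest) (ℕ.+-comm (length rest) 1))) (ℕ.suc-injective len))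
      (nc ∷ All.++⁺ ns (ns′ ∷ []))
      (trans (cong (ℤ._+_ c) (sumℤ-∷ʳ rest (a ℤ.+ b))) (trans (lemma a b c (sumℤ rest)) z′)))
    where
    lemma : ∀ a b c r → c ℤ.+ (r ℤ.+ (a ℤ.+ b)) ≡ a ℤ.+ (b ℤ.+ (c ℤ.+ r))
    lemma = ℤSolver.solve-∀
  cases : Dec (c₁ ℤ.+ c₂ ≡ 0ℤ) → Dec (c₁ ℤ.+ c₃ ≡ 0ℤ) → Representable (c₁ ∷ c₂ ∷ c₃ ∷ rest)
  cases (no q) _ = merge-first c₁ c₂ c₃ n₁ n₂ n₃ q z
  cases (yes _) (no q) = Representable-↭ (prep c₁ (swap c₃ c₂ ↭-refl))
      (merge-first c₁ c₃ c₂ n₁ n₃ n₂ q (trans (lemma c₁ c₂ c₃ (sumℤ rest)) z))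
    where
    lemma : ∀ a b c r → a ℤ.+ (c ℤ.+ (b ℤ.+ r)) ≡ a ℤ.+ (b ℤ.+ (c ℤ.+ r))
    lemma = ℤSolver.solve-∀
  cases (yes e) (yes e′) = Representable-↭ (↭-trans (prep c₂ (swap c₃ c₁ ↭-refl)) (swap c₂ c₁ ↭-refl))
      (merge-first c₂ c₃ c₁ n₂ n₃ n₁ c₂+c₃≢0 (trans (lemma c₁ c₂ c₃ (sumℤ rest)) z))
    where
    lemma : ∀ a b c r → b ℤ.+ (c ℤ.+ (a ℤ.+ r)) ≡ a ℤ.+ (b ℤ.+ (c ℤ.+ r))
    lemma = ℤSolver.solve-∀
    double : ∀ a b c → a ℤ.+ a ≡ (a ℤ.+ b) ℤ.+ (a ℤ.+ c) ℤ.- (b ℤ.+ c)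
    double = ℤSolver.solve-∀
    2i≡0⇒i≡0 : ∀ i → i ℤ.+ i ≡ 0ℤ → i ≡ 0ℤ
    2i≡0⇒i≡0 (+ zero) _ = refl
    -- If all three pairwise sums vanished, so would `2c₁ = (c₁ + c₂) + (c₁ + c₃) - (c₂ + c₃)`.
    c₂+c₃≢0 : NonZeroℤ (c₂ ℤ.+ c₃)
    c₂+c₃≢0 e″ = n₁ (2i≡0⇒i≡0 c₁ (trans (double c₁ c₂ c₃) (cong₂ ℤ._-_ (cong₂ ℤ._+_ e e′) e″)))

-- Colouring the Cayley graph

avoid : ∀ {n} (A : Subset n) Fb → length Fb ℕ.< ∣ A ∣ → ∃ λ x → x ∈ A × x ∉ₗ Fb
avoid A Fb len = x , lookup⇒∈ {A = A} x∈ , λ m →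
    <-irrefl refl (≤-<-trans (∈⇒1≤occurrences m) (<-≤-trans (proj₂ found) (𝟙≤1 (lookup A x))))
  where
  strict : ℕ⇒ℚ (length Fb) < ℕ⇒ℚ ∣ A ∣
  strict = ≰⇒> (λ q → ℕ.<⇒≱ len (ℕ⇒ℚ-cancel-≤ q))
  found : ∃ λ x → occurrences Fb x < 𝟙 (lookup A x)
  found = ∑-<⇒∃ _ _ (≤-<-trans (≤-reflexive (∑-occurrences Fb)) (<-eq strict (sym (∑-card A))))
  x = proj₁ found
  x∈ : lookup A x ≡ true
  x∈ = 0<𝟙⇒true (≤-<-trans (0≤occurrences Fb x) (proj₂ found))

elements : ∀ {n} → Subset n → List (Fin n)
elements []          = []
elements (true ∷ A)  = zero ∷ List.map suc (elements A)
elements (false ∷ A) = List.map suc (elements A)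

length-elements : ∀ {n} (A : Subset n) → length (elements A) ≡ ∣ A ∣
length-elements []          = refl
length-elements (true ∷ A)  = cong suc (trans (List.length-map suc (elements A)) (length-elements A))
length-elements (false ∷ A) = trans (List.length-map suc (elements A)) (length-elements A)

∈⇒∈elements : ∀ {n} {A : Subset n} {x} → x ∈ A → x ∈ₗ elements A
∈⇒∈elements {A = true ∷ A}  {zero}  m = here refl
∈⇒∈elements {A = true ∷ A}  {suc x} m = there (∈-map⁺ suc (∈⇒∈elements (drop-there m)))
∈⇒∈elements {A = false ∷ A} {suc x} m = ∈-map⁺ suc (∈⇒∈elements (drop-there m))

module GreedyColouring {n : ℕ} (D : ℕ) (nbrs : Fin n → List (Fin n)) (degree : ∀ v → length (nbrs v) ℕ.≤ D)
                       (nbrs-sym : ∀ u v → u ∈ₗ nbrs v → v ∈ₗ nbrs u) where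
  -- A vertex may occur in its own list of neighbours, as happens when 0 lies in `A*`; hence the
  -- restriction to distinct vertices.
  ProperBelow : ℕ → (Fin n → Fin (suc D)) → Set
  ProperBelow i col = ∀ u v → toℕ u ℕ.< i → toℕ v ℕ.< i → ¬ u ≡ v → u ∈ₗ nbrs v → ¬ col u ≡ col v

  extend : ∀ (x : Fin n) → ∃ (ProperBelow (toℕ x)) → ∃ (ProperBelow (suc (toℕ x)))
  extend x (col , proper) = col′ , proper′
    where
    fresh : ∃ λ f → f ∉ₗ List.map col (nbrs x)
    fresh = proj₁ found , λ m → <-irrefl refl (≤-<-trans (∈⇒1≤occurrences m) (proj₂ found))
      where
      used = List.map col (nbrs x)
      few : ℕ⇒ℚ (length used) < ℕ⇒ℚ (suc D)
      few = ≰⇒> (λ q → ℕ.<⇒≱ (ℕ.s≤s (subst (ℕ._≤ D) (sym (List.length-map col (nbrs x))) (degree x)))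
          (ℕ⇒ℚ-cancel-≤ q))
      found : ∃ λ f → occurrences used f < 1ℚ
      found = ∑-<⇒∃ _ _ (≤-<-trans (≤-reflexive (∑-occurrences used))
          (<-eq few (sym (trans (∑-const (suc D) 1ℚ) (*-identityʳ _)))))
    f = proj₁ fresh
    col′ : Fin n → Fin (suc D)
    col′ y = if does (y Fin.≟ x) then f else col y
    col′-new : ∀ {y} → y ≡ x → col′ y ≡ f
    col′-new {y} e = cong (λ b → if b then f else col y) (dec-true (y Fin.≟ x) e)
    col′-old : ∀ {y} → ¬ y ≡ x → col′ y ≡ col y
    col′-old {y} e = cong (λ b → if b then f else col y) (dec-false (y Fin.≟ x) e)
    below : ∀ {y} → toℕ y ℕ.< suc (toℕ x) → ¬ y ≡ x → toℕ y ℕ.< toℕ x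
    below l e = ℕ.≤∧≢⇒< (ℕ.s≤s⁻¹ l) (λ q → e (Fin.toℕ-injective q))
    proper′ : ProperBelow (suc (toℕ x)) col′
    proper′ u v lu lv u≢v u∈ = cases (u Fin.≟ x) (v Fin.≟ x)
      where
      cases : Dec (u ≡ x) → Dec (v ≡ x) → ¬ col′ u ≡ col′ v
      cases (yes e) (yes e′) _ = u≢v (trans e (sym e′))
      cases (yes e) (no e′)  q = proj₂ fresh (subst (_∈ₗ List.map col (nbrs x))
          (trans (sym (col′-old e′)) (trans (sym q) (col′-new e)))
          (∈-map⁺ col (subst (λ z → v ∈ₗ nbrs z) e (nbrs-sym u v u∈))))
      cases (no e)  (yes e′) q = proj₂ fresh (subst (_∈ₗ List.map col (nbrs x))
          (trans (sym (col′-old e)) (trans q (col′-new e′))) (∈-map⁺ col (subst (λ z → u ∈ₗ nbrs z) e′ u∈)))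
      cases (no e)  (no e′)  q = proper u v (below lu e) (below lv e′) u≢v u∈
          (trans (sym (col′-old e)) (trans q (col′-old e′)))

  colour-below : ∀ i → i ℕ.≤ n → ∃ (ProperBelow i)
  colour-below zero    _ = (λ _ → zero) , λ _ _ ()
  colour-below (suc i) l = subst (λ j → ∃ (ProperBelow (suc j))) (Fin.toℕ-fromℕ< l)
    (extend (fromℕ< l) (subst (λ j → ∃ (ProperBelow j)) (sym (Fin.toℕ-fromℕ< l)) (colour-below i (ℕ.<⇒≤ l))))

  colour : ∃ λ (col : Fin n → Fin (suc D)) → ∀ u v → ¬ u ≡ v → u ∈ₗ nbrs v → ¬ col u ≡ col v
  colour = proj₁ (colour-below n ℕ.≤-refl) , λ u v →
      proj₂ (colour-below n ℕ.≤-refl) u v (Fin.toℕ<n u) (Fin.toℕ<n v)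

chosen unchosen : ∀ {k} → Subset k → (Fin k → ℤ) → List ℤ
chosen []          c = []
chosen (true ∷ I)  c = c zero ∷ chosen I (λ i → c (suc i))
chosen (false ∷ I) c = chosen I (λ i → c (suc i))
unchosen []          c = []
unchosen (true ∷ I)  c = unchosen I (λ i → c (suc i))
unchosen (false ∷ I) c = c zero ∷ unchosen I (λ i → c (suc i))

length-chosen : ∀ {k} (I : Subset k) c → length (chosen I c) ≡ ∣ I ∣
length-chosen []          c = refl
length-chosen (true ∷ I)  c = cong suc (length-chosen I _)
length-chosen (false ∷ I) c = length-chosen I _

sum-chosen : ∀ {k} (I : Subset k) c → sumℤ (chosen I c) ≡ sumOver I c
sum-chosen []          c = refl
sum-chosen (true ∷ I)  c = cong (ℤ._+_ (c zero)) (sum-chosen I _)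
sum-chosen (false ∷ I) c = trans (sum-chosen I _) (sym (ℤ.+-identityˡ _))

chosen-All : ∀ {k} {P : ℤ → Set} (I : Subset k) c → (∀ i → P (c i)) → All P (chosen I c)
chosen-All []          c q = []
chosen-All (true ∷ I)  c q = q zero ∷ chosen-All I _ (λ i → q (suc i))
chosen-All (false ∷ I) c q = chosen-All I _ (λ i → q (suc i))

partition-↭ : ∀ {k} (I : Subset k) c → unchosen I c ++ chosen I c ↭ List.tabulate c
partition-↭ []          c = ↭-refl
partition-↭ (true ∷ I)  c = ↭-trans (shift (c zero) (unchosen I _) (chosen I _))
    (prep (c zero) (partition-↭ I _))
partition-↭ (false ∷ I) c = prep (c zero) (partition-↭ I _)

module _ (p : ℕ) ⦃ _ : ℕ.NonZero p ⦄ where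
  open Residues p
  open Solutions p

  -- The clause on `Fb` is there for the induction: it separates the later entries from the one just
  -- chosen, which gives injectivity.
  Sol⇒assignment : ∀ {k} (c : Fin k → ℤ) {A Fb t} → Sol (List.tabulate c) A Fb t →
    ∃ λ (x : Fin k → Fin p) → Injective _≡_ _≡_ x × (∀ i → x i ∈ A) × (∀ i → x i ∉ₗ Fb) × sumFin
        (λ i → c i ℤ.* ι (x i)) ≈ t
  Sol⇒assignment {zero}  c q = (λ ()) , (λ { {()} }) , (λ ()) , (λ ()) , ≈-sym q
  Sol⇒assignment {suc k} c {A} {Fb} {t} (y , y∈ , y∉ , q) = cons (Sol⇒assignment (λ i → c (suc i)) q)
    where
    cons : (∃ λ (x : Fin k → Fin p) → Injective _≡_ _≡_ x × (∀ i → x i ∈ A) × (∀ i → x i ∉ₗ y ∷ Fb) × sumFin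
        (λ i → c (suc i) ℤ.* ι (x i)) ≈ t ℤ.- c zero ℤ.* ι y) →
           ∃ λ (x : Fin (suc k) → Fin p) → Injective _≡_ _≡_ x × (∀ i → x i ∈ A) × (∀ i → x i ∉ₗ Fb) × sumFin
               (λ i → c i ℤ.* ι (x i)) ≈ t
    cons (x , inj , x∈ , x∉ , e) = x′ , inj′ , (λ { zero → y∈ ; (suc i) → x∈ i }) ,
        (λ { zero → y∉ ; (suc i) m → x∉ i (there m) }) ,
        ≈-by ℤ.1ℤ e (lemma (c zero ℤ.* ι y) (sumFin (λ i → c (suc i) ℤ.* ι (x i))) t)
      where
      x′ : Fin (suc k) → Fin p
      x′ zero    = y
      x′ (suc i) = x i
      inj′ : Injective _≡_ _≡_ x′
      inj′ {zero}  {zero}  _ = refl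
      inj′ {zero}  {suc j} q = contradiction (here (sym q)) (x∉ j)
      inj′ {suc i} {zero}  q = contradiction (here q) (x∉ i)
      inj′ {suc i} {suc j} q = cong suc (inj q)
      lemma : ∀ y s t → y ℤ.+ s ℤ.- t ≡ ℤ.1ℤ ℤ.* (s ℤ.- (t ℤ.- y))
      lemma = ℤSolver.solve-∀

  _≈?_ : ∀ x y → Dec (x ≈ y)
  x ≈? y = map′ mk≈ ≈⇒∣ (+ p Signed.∣? (x ℤ.- y))

tuple : ∀ {K} (ds : List ℤ) → (ℤ → Fin K) → Fin (K ℕ.^ length ds)
tuple []       f = zero
tuple (d ∷ ds) f = combine (f d) (tuple ds f)

tuple-injective : ∀ {K} ds (f g : ℤ → Fin K) → tuple ds f ≡ tuple ds g → All (λ d → f d ≡ g d) ds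
tuple-injective []       f g e = []
tuple-injective (d ∷ ds) f g e = proj₁ both ∷ tuple-injective ds f g (proj₂ both)
  where both = combine-injective (f d) (tuple ds f) (g d) (tuple ds g) e

module Colouring (p : ℕ) ⦃ _ : ℕ.NonZero p ⦄ {K : ℕ} (κ : Fin p → Fin K) (A : Subset p) (ds : List ℤ) where
  open Residues p
  open Solutions p

  Period : Fin p → ℤ → Set
  Period y d = ∃₂ λ (s s′ : Fin p) → κ s ≡ κ s′ × ι s ℤ.- ι s′ ≈ d ℤ.* ι y

  period? : ∀ y d → Dec (Period y d)
  period? y d = Fin.any? λ s → Fin.any? λ s′ → (κ s Fin.≟ κ s′) ×-dec (_≈?_ p (ι s ℤ.- ι s′) (d ℤ.* ι y))

  InA* : Fin p → Set
  InA* y = lookup A y ≡ true × All (Period y) ds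

  inA*? : ∀ y → Dec (InA* y)
  inA*? y = (lookup A y Bool.≟ true) ×-dec All.all? (period? y) ds

  A* : Subset p
  A* = tabulate (λ y → does (inA*? y))

  ∈A*⇒ : ∀ {y} → y ∈ A* → InA* y
  ∈A*⇒ {y} m = does-true (inA*? y) (trans (sym (lookup∘tabulate (λ y → does (inA*? y)) y)) (∈⇒lookup m))

  ⇒∈A* : ∀ {y} → InA* y → y ∈ A*
  ⇒∈A* {y} q = lookup⇒∈ {A = A*} (trans (lookup∘tabulate (λ y → does (inA*? y)) y) (dec-true (inA*? y) q))

  -- Each variable taken from `A*` forbids one value and adds one difference to the right-hand side,
  -- so `length ds` bounds both lists throughout, and `A*` is never exhausted.
  many⇒solution : ∀ cs → length ds ℕ.≤ ∣ A* ∣ →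
    (∀ ts → length ts ℕ.≤ length ds → SameColour κ ts → ∀ Fb → length Fb ℕ.≤ length ds →
        Sol cs A Fb (total ts)) →
    Sol (ds ++ cs) A [] 0ℤ
  many⇒solution cs enough solve = build ds (λ m → m) [] [] 0ℤ [] ℕ.≤-refl ℕ.≤-refl ≈-refl
    where
    build : ∀ ds′ → (∀ {d} → d ∈ₗ ds′ → d ∈ₗ ds) → ∀ ts Fb t → SameColour κ ts →
            length Fb ℕ.+ length ds′ ℕ.≤ length ds → length ts ℕ.+ length ds′ ℕ.≤ length ds → t ≈ total ts →
                Sol (ds′ ++ cs) A Fb t
    build [] sub ts Fb t same l l′ e = Sol-cong cs (≈-sym e)
      (solve ts (subst (ℕ._≤ length ds) (ℕ.+-identityʳ (length ts)) l′) same Fb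
          (subst (ℕ._≤ length ds) (ℕ.+-identityʳ (length Fb)) l))
    build (d ∷ ds′) sub ts Fb t same l l′ e =
        step (avoid A* Fb (ℕ.≤-trans (ℕ.≤-trans (ℕ.s≤s (ℕ.m≤m+n (length Fb) (length ds′))) l₁) enough))
      where
      l₁ : suc (length Fb) ℕ.+ length ds′ ℕ.≤ length ds
      l₁ = subst (ℕ._≤ length ds) (ℕ.+-suc (length Fb) (length ds′)) l
      l₂ : suc (length ts) ℕ.+ length ds′ ℕ.≤ length ds
      l₂ = subst (ℕ._≤ length ds) (ℕ.+-suc (length ts) (length ds′)) l′
      lemma : ∀ t T s s′ y → t ℤ.- y ℤ.- (s′ ℤ.- s ℤ.+ T) ≡ ℤ.1ℤ ℤ.* (t ℤ.- T) ℤ.+ ℤ.1ℤ ℤ.* (s ℤ.- s′ ℤ.- y)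
      lemma = ℤSolver.solve-∀
      extend : ∀ {y} → y ∈ A → y ∉ₗ Fb → Period y d → Sol (d ∷ ds′ ++ cs) A Fb t
      extend {y} y∈ y∉ (s , s′ , k , e′) = y , y∈ , y∉ ,
          -- Moving `d · y = s - s′` to the right-hand side contributes `s′ - s`; hence the reversed
          -- pair.
          build ds′ (λ m → sub (there m)) ((s′ , s) ∷ ts) (y ∷ Fb) (t ℤ.- d ℤ.* ι y) (sym k ∷ same) l₁ l₂
        (≈-by₂ ℤ.1ℤ ℤ.1ℤ e e′ (lemma t (total ts) (ι s) (ι s′) (d ℤ.* ι y)))
      step : (∃ λ y → y ∈ A* × y ∉ₗ Fb) → Sol (d ∷ ds′ ++ cs) A Fb t
      step (y , y∈ , y∉) = extend (lookup⇒∈ {A = A} (proj₁ (∈A*⇒ y∈))) y∉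
          (All.lookup (proj₂ (∈A*⇒ y∈)) (sub (here refl)))

  -- The count: one `κ`-colour for each coefficient in `ds`, times one more than the degree of
  -- Cay(`A*`), where each element of `A*` gives an outgoing and an incoming neighbour.
  few⇒colouring : ∣ A* ∣ ℕ.≤ length ds → ChromaticAtMost A (K ℕ.^ length ds ℕ.* suc (length ds ℕ.+ length ds))
  few⇒colouring few = col , proper
    where
    D : ℕ
    D = length ds ℕ.+ length ds
    forward backward nbrs : Fin p → List (Fin p)
    forward  v = List.map (λ a → red (ι v ℤ.+ ι a)) (elements A*)
    backward v = List.map (λ a → red (ι v ℤ.- ι a)) (elements A*)
    nbrs v = forward v ++ backward v
    degree : ∀ v → length (nbrs v) ℕ.≤ D
    degree v = subst (ℕ._≤ D) (sym (List.length-++ (forward v)))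
        (ℕ.+-mono-≤ (bound (λ a → red (ι v ℤ.+ ι a))) (bound (λ a → red (ι v ℤ.- ι a))))
      where
      bound : ∀ (f : Fin p → Fin p) → length (List.map f (elements A*)) ℕ.≤ length ds
      bound f = subst (ℕ._≤ length ds) (sym (trans (List.length-map f (elements A*)) (length-elements A*)))
          few
    nbrs-sym : ∀ u v → u ∈ₗ nbrs v → v ∈ₗ nbrs u
    nbrs-sym u v m = cases (∈-++⁻ (forward v) m)
      where
      cases : u ∈ₗ forward v ⊎ u ∈ₗ backward v → v ∈ₗ nbrs u
      cases (inj₁ m′) = from (∈-map⁻ (λ a → red (ι v ℤ.+ ι a)) m′)
        where
        lemma : ∀ u v a → u ℤ.- a ℤ.- v ≡ ℤ.1ℤ ℤ.* (u ℤ.- (v ℤ.+ a))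
        lemma = ℤSolver.solve-∀
        from : (∃ λ a → a ∈ₗ elements A* × u ≡ red (ι v ℤ.+ ι a)) → v ∈ₗ nbrs u
        from (a , a∈ , e) = ∈-++⁺ʳ (forward u) (subst (_∈ₗ backward u)
            (trans (red-cong (≈-by ℤ.1ℤ (≈-trans (≈-reflexive (cong ι e)) (ι-red _))
            (lemma (ι u) (ι v) (ι a)))) (red-ι v)) (∈-map⁺ (λ a → red (ι u ℤ.- ι a)) a∈))
      cases (inj₂ m′) = from (∈-map⁻ (λ a → red (ι v ℤ.- ι a)) m′)
        where
        lemma : ∀ u v a → u ℤ.+ a ℤ.- v ≡ ℤ.1ℤ ℤ.* (u ℤ.- (v ℤ.- a))
        lemma = ℤSolver.solve-∀
        from : (∃ λ a → a ∈ₗ elements A* × u ≡ red (ι v ℤ.- ι a)) → v ∈ₗ nbrs u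
        from (a , a∈ , e) = ∈-++⁺ˡ (subst (_∈ₗ forward u) (trans
            (red-cong (≈-by ℤ.1ℤ (≈-trans (≈-reflexive (cong ι e)) (ι-red _)) (lemma (ι u) (ι v) (ι a))))
            (red-ι v)) (∈-map⁺ (λ a → red (ι u ℤ.+ ι a)) a∈))
    greedy-colour = GreedyColouring.colour D nbrs degree nbrs-sym
    periodColours : Fin p → ℤ → Fin K
    periodColours u d = κ (red (d ℤ.* ι u))
    col : Fin p → Fin (K ℕ.^ length ds ℕ.* suc D)
    col u = combine (tuple ds (periodColours u)) (proj₁ greedy-colour u)
    -- For an arc with difference `a` and ends agreeing in all period colours, `d · v` and `d · u`
    -- witness that `d · a` is a difference inside a class. So `a` lies in `A*`, and the greedy
    -- colouring separates the ends.
    arc⇒nbr : ∀ {u v} → All (λ d → periodColours u d ≡ periodColours v d) ds → Arc A u v → v ∈ₗ nbrs u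
    arc⇒nbr {u} {v} same (a , a∈ , d∣) = ∈-++⁺ˡ (subst (_∈ₗ forward u)
        (trans (red-cong (≈-by ℤ.-1ℤ v-u≈a (lemma (ι u) (ι v) (ι a)))) (red-ι v))
        (∈-map⁺ (λ a → red (ι u ℤ.+ ι a)) (∈⇒∈elements (⇒∈A* (∈⇒lookup a∈ ,
            All.map (λ {d} → period d) same)))))
      where
      lemma : ∀ u v a → u ℤ.+ a ℤ.- v ≡ ℤ.-1ℤ ℤ.* (v ℤ.- u ℤ.- a)
      lemma = ℤSolver.solve-∀
      v-u≈a : ι v ℤ.- ι u ≈ ι a
      v-u≈a = mk≈ (∣ᵤ⇒∣ d∣)
      period : ∀ d → periodColours u d ≡ periodColours v d → Period a d
      period d e = red (d ℤ.* ι v) , red (d ℤ.* ι u) , sym e ,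
        ≈-trans (+-cong-≈ (ι-red (d ℤ.* ι v)) (neg-cong-≈ (ι-red (d ℤ.* ι u))))
            (≈-by d v-u≈a (lemma′ d (ι u) (ι v) (ι a)))
        where
        lemma′ : ∀ d u v a → d ℤ.* v ℤ.- d ℤ.* u ℤ.- d ℤ.* a ≡ d ℤ.* (v ℤ.- u ℤ.- a)
        lemma′ = ℤSolver.solve-∀
    proper : ∀ u v → Adjacent A u v → ¬ col u ≡ col v
    proper u v (u≢v , arcs) e = cases arcs
      where
      both = combine-injective (tuple ds (periodColours u)) (proj₁ greedy-colour u)
          (tuple ds (periodColours v)) (proj₁ greedy-colour v) e
      same : All (λ d → periodColours u d ≡ periodColours v d) ds
      same = tuple-injective ds (periodColours u) (periodColours v) (proj₁ both)
      cases : Arc A u v ⊎ Arc A v u → ⊥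
      cases (inj₁ arc) = proj₂ greedy-colour v u (λ q → u≢v (sym q)) (arc⇒nbr same arc) (sym (proj₂ both))
      cases (inj₂ arc) = proj₂ greedy-colour u v u≢v (arc⇒nbr (All.map sym same) arc) (proj₂ both)

ChromaticAtMost-mono : ∀ {p} {A : Subset p} {C C′} → C ℕ.≤ C′ → ChromaticAtMost A C → ChromaticAtMost A C′
ChromaticAtMost-mono C≤C′ (col , proper) = (λ u → inject≤ (col u) C≤C′) , λ u v adj e →
    proper u v adj (inject≤-injective C≤C′ C≤C′ _ _ e)

ChromaticAtMost-order : ∀ {p} (A : Subset p) → ChromaticAtMost A p
ChromaticAtMost-order A = (λ u → u) , λ u v adj → proj₁ adj

theorem3p1 : (k : ℕ) → k ≥ 3 → (c : Fin k → ℤ) → (∀ i → ¬ (c i ≡ 0ℤ)) →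
    (∃ λ (I : Subset k) → ∣ I ∣ ≥ 3 × sumOver I c ≡ 0ℤ) →
    (ε : ℚ) → Positive ε →
    ∃ λ (C : ℕ) → (p : ℕ) → Prime p → (A : Subset p) →
    SolutionFree c p A → ε * ((+ p) / 1) ≤ (+ ∣ A ∣) / 1 →
    ChromaticAtMost A C
theorem3p1 k _ c c≢0 (I , ∣I∣≥3 , sum-I) ε 0<ε = P ℕ.+ C₀ , bounded
  where
  cs ds : List ℤ
  cs = chosen I c
  ds = unchosen I c
  ℓ : ℕ
  ℓ = length ds
  -- Both bounds are `ℓ`: every variable outside I brings one difference and one forbidden value.
  representable = zero-sum⇒representable (∣ I ∣ ℕ.∸ 3) cs (trans (length-chosen I c)
      (sym (ℕ.m+[n∸m]≡n ∣I∣≥3)))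
    (chosen-All I c c≢0) (trans (sum-chosen I c) sum-I) ε (positive⁻¹ ε ⦃ 0<ε ⦄) ℓ ℓ
  K P C₀ : ℕ
  K  = proj₁ representable
  P  = proj₁ (proj₂ representable)
  C₀ = K ℕ.^ ℓ ℕ.* suc (ℓ ℕ.+ ℓ)
  bounded : (p : ℕ) → Prime p → (A : Subset p) → SolutionFree c p A → ε * ((+ p) / 1) ≤ (+ ∣ A ∣) / 1 →
      ChromaticAtMost A (P ℕ.+ C₀)
  bounded p p-prime A free dense = by-size (P ℕ.<? p)
    where
    by-size : Dec (P ℕ.< p) → ChromaticAtMost A (P ℕ.+ C₀)
    -- For p at most `P` every vertex gets its own colour; the sum `P + C₀` covers both cases.
    by-size (no small)  = ChromaticAtMost-mono {A = A} (ℕ.≤-trans (ℕ.≮⇒≥ small) (ℕ.m≤m+n P C₀))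
        (ChromaticAtMost-order A)
    by-size (yes large) = ChromaticAtMost-mono {A = A} (ℕ.m≤n+m C₀ P) (by-periods (ℓ ℕ.≤? ∣ A* ∣))
      where
      instance
        p≢0 : ℕ.NonZero p
        p≢0 = prime⇒nonZero p-prime
      coloured = proj₂ (proj₂ representable) p p-prime large A
          (eq-≤ (*-comm (ℕ⇒ℚ p) ε) (≤-eq dense (sym (∑-card A))))
      open Colouring p (proj₁ coloured) A ds
      contradict : Solutions.Sol p (List.tabulate c) A [] 0ℤ → ⊥
      contradict sol = refute (Sol⇒assignment p c sol)
        where
        open Residues p
        value : (Fin k → Fin p) → ℤ
        value x = sumFin (λ i → c i ℤ.* ι (x i))
        refute : (∃ λ (x : Fin k → Fin p) → Injective _≡_ _≡_ x × (∀ i → x i ∈ A) × (∀ i → x i ∉ₗ []) × value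
            x ≈ 0ℤ) → ⊥
        refute (x , inj , x∈ , _ , mk≈ d) = free (x , inj , x∈ ,
            ∣⇒∣ᵤ {i = value x} (subst (+ p Signed.∣_) (ℤ.+-identityʳ (value x)) d))
      by-periods : Dec (ℓ ℕ.≤ ∣ A* ∣) → ChromaticAtMost A C₀
      -- If I is all of [k], then `ℓ` is 0 and this case always applies: a dense set is never
      -- solution-free for large p.
      by-periods (yes many) = ⊥-elim (contradict (Solutions.Sol-↭ p (partition-↭ I c)
          (many⇒solution cs many (proj₂ coloured))))
      by-periods (no few)   = few⇒colouring (ℕ.<⇒≤ (ℕ.≰⇒> few))
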